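{- Let $p$ be an odd prime. Then there does not exist a $(2p,p,2p,2)$ relative difference set in any group of order $2p^2$.
   Context: Let $G$ be a finite multiplicative group of order $mn$ and $N$ a subgroup of $G$ of order $n$. A $k$-subset $R$ of $G$ is an $(m,n,k,\lambda)$ relative difference set in $G$ relative to $N$ if every element $g\in G\setminus N$ has exactly $\lambda$ representations $g=r_1r_2^{ -1}$ with $r_1,r_2\in R$, and no non-identity element of $N$ has such a representation. A group $G$ "contains an $(m,n,k,\lambda)$ relative difference set" if such an $R$ exists in $G$ relative to some subgroup $N$ of order $n$. -}

module Defs where

open import Data.Nat using (ℕ; _*_)
open import Data.Fin using (Fin)
open import Data.Fin.Properties using (_≟_)
open import Data.Fin.Subset using (Subset; _∈_; _∉_; ∣_∣)
open import Data.Fin.Subset.Properties using (_∈?_)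
open import Data.List using (List; length; filter; cartesianProduct; allFin)
open import Data.Product using (_×_; _,_)
open import Relation.Nullary using (¬_)
open import Relation.Nullary.Decidable using (_×-dec_)
open import Relation.Binary.PropositionalEquality using (_≡_)
open import Algebra.Structures using (IsGroup)

-- A finite group of order n, presented (up to isomorphism) on the carrier Fin n.
record FinGroup (n : ℕ) : Set where
  field
    _∙_ : Fin n → Fin n → Fin n
    ε   : Fin n
    _⁻¹ : Fin n → Fin n
    isGroup : IsGroup _≡_ _∙_ ε _⁻¹

module _ {n : ℕ} (G : FinGroup n) where
  open FinGroup G

  record IsSubgroup (N : Subset n) : Set where
    field
      ε∈     : ε ∈ N
      ∙-closed : ∀ {x y} → x ∈ N → y ∈ N → (x ∙ y) ∈ N
      ⁻¹-closed : ∀ {x} → x ∈ N → (x ⁻¹) ∈ N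

  reps : Subset n → Fin n → List (Fin n × Fin n)
  reps R g = filter (λ { (a , b) → (a ∈? R) ×-dec ((b ∈? R) ×-dec (g ≟ (a ∙ (b ⁻¹)))) })
                    (cartesianProduct (allFin n) (allFin n))

  #reps : Subset n → Fin n → ℕ
  #reps R g = length (reps R g)

  -- R is a relative difference set with parameter λ relative to N
  -- (the other parameters m, n, k are imposed via the orders of G, N and R)
  record IsRDS (N R : Subset n) (λ′ : ℕ) : Set where
    field
      outside : ∀ g → g ∉ N → #reps R g ≡ λ′
      inside  : ∀ g → g ∈ N → ¬ (g ≡ ε) → #reps R g ≡ 0

record ContainsRDS {o : ℕ} (G : FinGroup o) (m n' k λ′ : ℕ) : Set where
  field
    order : o ≡ m * n'
    N : Subset o
    N-sub : IsSubgroup G N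
    N-size : ∣ N ∣ ≡ n'
    R : Subset o
    R-size : ∣ R ∣ ≡ k
    rds : IsRDS G N R λ′

{-# OPTIONS --safe #-}
module Submission where

-- A group G of order 2p² has an involution t and an abelian subgroup P of index 2 containing N.
-- Write R = A ∪ Bt with A, B ⊆ P, let σ be conjugation by t, and let U, V count the quotients in
-- A and in B.  The hypothesis on R becomes U + V = 2p·1 + 2(P − N) and A(σB)⁻¹ + B(σA)⁻¹ = 2P in
-- ℤ[P].  Then A and B are transversals of N in P, and multiplying all quotients in a coset gN gives
-- g²ᵖ = 1, so P is elementary abelian.
--
-- Let g ∉ N with σg = g or σg = g⁻¹.  Then σ acts on P/⟨g⟩ as ±1, and for a nontrivial character χ
-- of P/⟨g⟩ the relations say that (χ(A) + χ(B̂)) · conj(χ(A) − χ(B̂)) / 2 (B̂ = σB) is an element of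
-- ℤ[ζₚ] of absolute value p.  As p is totally ramified it is ±p times a root of unity, and parity
-- excludes all roots except 1.  Hence U(g) is even, and U has odd sum over every other coset of ⟨g⟩.
--
-- If σN = N, then U∘σ = U, and a coset of N stable under x ↦ σx or x ↦ (σx)⁻¹, on which U has sum p,
-- contains a fixed point g with U(g) odd: a contradiction.  If σN ≠ N, integrality of the product
-- R⁻¹R shows that p divides W(W + 2), where W is the sum of U over σN ∖ 1; so U or V vanishes there,
-- say U.  Again U∘σ = U, and for y ∈ N the coset of ⟨y(σy)⁻¹⟩ through y·σy gives the contradiction.

open import Defs
open import Algebra.Bundles using (Group; AbelianGroup; CommutativeRing)
import Algebra.Properties.AbelianGroup as AbelianGroupProperties
import Algebra.Properties.CommutativeMonoid.Mult as CommMult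
import Algebra.Properties.Group as GroupProperties
import Algebra.Properties.Monoid.Mult as Mult
open import Algebra.Structures using (IsAbelianGroup; IsCommutativeMonoid; IsGroup)
open import Data.Bool using (Bool; true; false; _∧_; _xor_; if_then_else_; not)
import Data.Bool.Properties as Boolₚ
open import Data.Empty using (⊥; ⊥-elim)
open import Data.Fin using (Fin; toℕ)
import Data.Fin.Properties as Finₚ
open import Data.Fin.Subset using (Subset) renaming (∣_∣ to ∥_∥)
open import Data.Fin.Subset.Properties using (_∈?_)
open import Data.Integer using (ℤ; +_; -[1+_]; -_; 0ℤ; 1ℤ; -1ℤ; _≤_; _+_; _-_; _*_; +≤+) renaming (∣_∣ to abs)
import Data.Integer.Properties as ℤₚ
open import Algebra.Properties.AbelianGroup ℤₚ.+-0-abelianGroup using () renaming (∙-cancelˡ to ℤ+-cancelˡ)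
open import Data.Integer.Divisibility.Signed
open import Data.Integer.Tactic.RingSolver using (solve-∀)
open import Data.List using (List; []; _∷_; _++_; allFin; applyUpTo; cartesianProduct; filter; length; map; tabulate; upTo)
open import Data.List.Membership.Propositional using (_∈_)
open import Data.List.Membership.Propositional.Properties using (∈-allFin; ∈-map⁻; ∈-upTo⁺)
open import Data.List.Properties using (length-++; length-map; length-tabulate; length-upTo)
open import Data.List.Relation.Unary.All as All using (All; []; _∷_)
open import Data.List.Relation.Unary.AllPairs using ([]; _∷_)
open import Data.List.Relation.Unary.Any using (here; there)
open import Data.List.Relation.Unary.Unique.Propositional using (Unique)
open import Data.List.Relation.Unary.Unique.Propositional.Properties using (allFin⁺; cartesianProduct⁺; map⁺; upTo⁺)
open import Data.Maybe using (nothing)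
open import Data.Nat as ℕ using (ℕ; zero; suc; s≤s; z≤n)
open import Data.Nat.Coprimality using (coprime-Bézout; prime⇒coprime)
import Data.Nat.Divisibility as ℕ∣
import Data.Nat.DivMod as ℕ/
open import Data.Nat.GCD using (module Bézout)
open import Data.Nat.Primality using (Prime; euclidsLemma; prime⇒irreducible; prime⇒nonZero; ¬prime[1])
import Data.Nat.Properties as ℕₚ
open import Data.Nat.Tactic.RingSolver using () renaming (solve-∀ to ℕ-solve-∀)
open import Data.Product using (∃; ∃₂; _×_; _,_; proj₁; proj₂)
open import Data.Sum using (_⊎_; inj₁; inj₂; reduce; [_,_]′)
open import Data.Vec using ([]; _∷_; lookup)
open import Data.Vec.Properties using ([]=⇒lookup; lookup⇒[]=)
open import Function using (_∘_; id)
open import Level using (0ℓ)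
open import Relation.Binary using (tri<; tri≈; tri>)
open import Relation.Binary.PropositionalEquality hiding ([_])
open import Relation.Nullary using (¬_; Dec; yes; no; contradiction; does)
open import Relation.Nullary.Decidable using (dec-false; dec-true; map′)
open import Relation.Unary using (Decidable)
import Tactic.RingSolver as RingTactic
import Tactic.RingSolver.Core.AlmostCommutativeRing as ACR

-- Finite sums

-- Characters of P/⟨g⟩ never appear: an element of ℤ[ζₚ] is a p-periodic integer sequence modulo
-- constants, absolute values are read off from correlations, and multiplication by ζ - 1 is, up to
-- a unit, the difference operator Δ. Total ramification becomes p | Δᵖf, after which the powers of
-- Δ are stripped one at a time by looking at sums of squares.
--
-- The relations mix B with σB, so they descend only to quotients by σ-stable subgroups. Hence the
-- condition σg = g or σg = g⁻¹, and hence the effort of the last two cases to locate such a g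
-- outside N. That P is elementary abelian makes every such quotient cyclic of order p.
--
-- Both χ(A) + χ(B̂) and χ(A) - χ(B̂) have squared absolute value 2p. The relations exhibit the
-- product of one with the conjugate of the other as twice an explicit integral element; dividing by
-- this 2 reaches absolute value p, where only trivial units are left.
--
-- P is the kernel of the transfer from G to ⟨t⟩, computed as the parity of a count; its
-- commutativity is again obtained by counting.

record Finite (X : Set) : Set where
  field
    elems    : List X
    complete : ∀ x → x ∈ elems
    unique   : Unique elems
    -- An injection into ℕ supplies decidable equality, and its order picks one element out of each
    -- pair in `involution-parity` and out of each coset of ⟨t⟩ in `IndexTwo`.
    code     : X → ℕ
    code-inj : ∀ {x y} → code x ≡ code y → x ≡ y

  infix 4 _≟_
  _≟_ : (x y : X) → Dec (x ≡ y)
  x ≟ y = map′ code-inj (cong code) (code x ℕₚ.≟ code y)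

open Finite using (elems)

-- The monoid is arbitrary because the same sums are taken in ℤ and, written ∏, in the abelian group
-- P.
module ListSum {C : Set} {_⊕_ : C → C → C} {0# : C} (M : IsCommutativeMonoid _≡_ _⊕_ 0#) where
  open IsCommutativeMonoid M using (assoc; comm; identityˡ; identityʳ)

  ∑ : {X : Set} → List X → (X → C) → C
  ∑ []       f = 0#
  ∑ (x ∷ xs) f = f x ⊕ ∑ xs f

  private
    interchange : ∀ a b c d → (a ⊕ b) ⊕ (c ⊕ d) ≡ (a ⊕ c) ⊕ (b ⊕ d)
    interchange a b c d = begin
      (a ⊕ b) ⊕ (c ⊕ d)  ≡⟨ assoc a b (c ⊕ d) ⟩
      a ⊕ (b ⊕ (c ⊕ d))  ≡⟨ cong (a ⊕_) (sym (assoc b c d)) ⟩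
      a ⊕ ((b ⊕ c) ⊕ d)  ≡⟨ cong (λ z → a ⊕ (z ⊕ d)) (comm b c) ⟩
      a ⊕ ((c ⊕ b) ⊕ d)  ≡⟨ cong (a ⊕_) (assoc c b d) ⟩
      a ⊕ (c ⊕ (b ⊕ d))  ≡⟨ assoc a c (b ⊕ d) ⟨
      (a ⊕ c) ⊕ (b ⊕ d)  ∎
      where open ≡-Reasoning

  module _ {X : Set} where

    ∑-cong : (xs : List X) {f g : X → C} → (∀ x → f x ≡ g x) → ∑ xs f ≡ ∑ xs g
    ∑-cong []       e = refl
    ∑-cong (x ∷ xs) e = cong₂ _⊕_ (e x) (∑-cong xs e)

    ∑-zero : (xs : List X) {f : X → C} → (∀ x → f x ≡ 0#) → ∑ xs f ≡ 0#
    ∑-zero []       e = refl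
    ∑-zero (x ∷ xs) e = trans (cong₂ _⊕_ (e x) (∑-zero xs e)) (identityˡ 0#)

    ∑-⊕ : (xs : List X) (f g : X → C) → ∑ xs (λ x → f x ⊕ g x) ≡ ∑ xs f ⊕ ∑ xs g
    ∑-⊕ []       f g = sym (identityˡ 0#)
    ∑-⊕ (x ∷ xs) f g = trans (cong ((f x ⊕ g x) ⊕_) (∑-⊕ xs f g)) (interchange (f x) (g x) (∑ xs f) (∑ xs g))

    ∑-++ : (xs ys : List X) (f : X → C) → ∑ (xs ++ ys) f ≡ ∑ xs f ⊕ ∑ ys f
    ∑-++ []       ys f = sym (identityˡ _)
    ∑-++ (x ∷ xs) ys f = trans (cong (f x ⊕_) (∑-++ xs ys f)) (sym (assoc (f x) _ _))

    private
      ∑-miss : (xs : List X) {f : X → C} {a : X} → All (a ≢_) xs →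
               (∀ x → x ≢ a → f x ≡ 0#) → ∑ xs f ≡ 0#
      ∑-miss []       []       z = refl
      ∑-miss (x ∷ xs) (n ∷ ns) z = trans (cong₂ _⊕_ (z x (n ∘ sym)) (∑-miss xs ns z)) (identityˡ 0#)

    ∑-single : {xs : List X} {f : X → C} {a : X} → Unique xs → a ∈ xs →
               (∀ x → x ≢ a → f x ≡ 0#) → ∑ xs f ≡ f a
    ∑-single {x ∷ xs} {f} (n ∷ u) (here refl) z = trans (cong (f x ⊕_) (∑-miss xs n z)) (identityʳ (f x))
    ∑-single {x ∷ xs} {f} (n ∷ u) (there i)   z =
      trans (cong₂ _⊕_ (z x (All.lookup n i)) (∑-single u i z)) (identityˡ _)

  ∑-map : {X Y : Set} (h : Y → X) (ys : List Y) (f : X → C) → ∑ (map h ys) f ≡ ∑ ys (f ∘ h)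
  ∑-map h []       f = refl
  ∑-map h (y ∷ ys) f = cong (f (h y) ⊕_) (∑-map h ys f)

  ∑-swap : {X Y : Set} (xs : List X) (ys : List Y) (f : X → Y → C) →
           ∑ xs (λ x → ∑ ys (f x)) ≡ ∑ ys (λ y → ∑ xs (λ x → f x y))
  ∑-swap []       ys f = sym (∑-zero ys (λ _ → refl))
  ∑-swap (x ∷ xs) ys f = trans (cong (∑ ys (f x) ⊕_) (∑-swap xs ys f)) (sym (∑-⊕ ys (f x) _))

  ∑-× : {X Y : Set} (xs : List X) (ys : List Y) (f : X × Y → C) →
        ∑ (cartesianProduct xs ys) f ≡ ∑ xs (λ x → ∑ ys (λ y → f (x , y)))
  ∑-× []       ys f = refl
  ∑-× (x ∷ xs) ys f = trans (∑-++ (map (x ,_) ys) (cartesianProduct xs ys) f)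
                            (cong₂ _⊕_ (∑-map (x ,_) ys f) (∑-× xs ys f))

  module _ {X : Set} (F : Finite X) where
    open Finite F using (complete; unique; _≟_)

    ∑-at : {f : X → C} (a : X) → (∀ x → x ≢ a → f x ≡ 0#) → ∑ (elems F) f ≡ f a
    ∑-at a = ∑-single unique (complete a)

    -- Both sides evaluate the double sum of `ind`, which is f placed on the graph of φ: by rows
    -- each x meets φ x only, by columns each y meets ψ y only.
    ∑-reindex : (φ ψ : X → X) → (∀ x → φ (ψ x) ≡ x) → (∀ x → ψ (φ x) ≡ x) →
                (f : X → C) → ∑ (elems F) (f ∘ φ) ≡ ∑ (elems F) f
    ∑-reindex φ ψ φψ ψφ f = begin
      ∑ E (λ x → f (φ x))                ≡⟨ ∑-cong E (λ x → trans (sym (hit x)) (sym (∑-at (φ x) (miss x)))) ⟩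
      ∑ E (λ x → ∑ E (λ y → ind x y))    ≡⟨ ∑-swap E E ind ⟩
      ∑ E (λ y → ∑ E (λ x → ind x y))    ≡⟨ ∑-cong E (λ y → trans (∑-at (ψ y) (λ x n → miss x y (λ e → n (trans (sym (ψφ x)) (cong ψ (sym e))))))
                                                                (trans (cong (ind (ψ y)) (sym (φψ y))) (trans (hit (ψ y)) (cong f (φψ y))))) ⟩
      ∑ E f                              ∎
      where
      open ≡-Reasoning
      E = elems F
      ind : X → X → C
      ind x y with y ≟ φ x
      ... | yes _ = f y
      ... | no _  = 0#
      hit : ∀ x → ind x (φ x) ≡ f (φ x)
      hit x with φ x ≟ φ x
      ... | yes _ = refl
      ... | no n  = contradiction refl n
      miss : ∀ x y → y ≢ φ x → ind x y ≡ 0#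
      miss x y n with y ≟ φ x
      ... | yes e = contradiction e n
      ... | no _  = refl

open ListSum ℤₚ.+-0-isCommutativeMonoid public

[_] : Bool → ℤ
[ true ]  = 1ℤ
[ false ] = 0ℤ

0≤[] : ∀ b → 0ℤ ≤ [ b ]
0≤[] true  = +≤+ ℕ.z≤n
0≤[] false = +≤+ ℕ.z≤n

[]≤1 : ∀ b → [ b ] ≤ 1ℤ
[]≤1 true  = +≤+ (ℕ.s≤s ℕ.z≤n)
[]≤1 false = +≤+ ℕ.z≤n

[]-idem : ∀ b → [ b ] * [ b ] ≡ [ b ]
[]-idem true  = refl
[]-idem false = refl

module _ {X : Set} where

  ∑-*ˡ : (xs : List X) (c : ℤ) (f : X → ℤ) → ∑ xs (λ x → c * f x) ≡ c * ∑ xs f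
  ∑-*ˡ []       c f = sym (ℤₚ.*-zeroʳ c)
  ∑-*ˡ (x ∷ xs) c f = trans (cong (_+_ (c * f x)) (∑-*ˡ xs c f)) (sym (ℤₚ.*-distribˡ-+ c (f x) (∑ xs f)))

  ∑-*ʳ : (xs : List X) (c : ℤ) (f : X → ℤ) → ∑ xs (λ x → f x * c) ≡ ∑ xs f * c
  ∑-*ʳ xs c f = trans (∑-cong xs (λ x → ℤₚ.*-comm (f x) c)) (trans (∑-*ˡ xs c f) (ℤₚ.*-comm c (∑ xs f)))

  ∑-neg : (xs : List X) (f : X → ℤ) → ∑ xs (λ x → - f x) ≡ - ∑ xs f
  ∑-neg []       f = refl
  ∑-neg (x ∷ xs) f = trans (cong (_+_ (- f x)) (∑-neg xs f)) (sym (ℤₚ.neg-distrib-+ (f x) _))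

  ∑-- : (xs : List X) (f g : X → ℤ) → ∑ xs (λ x → f x - g x) ≡ ∑ xs f - ∑ xs g
  ∑-- xs f g = trans (∑-⊕ xs f (λ x → - g x)) (cong (_+_ (∑ xs f)) (∑-neg xs g))

  ∑-const : (xs : List X) (c : ℤ) → ∑ xs (λ _ → c) ≡ + length xs * c
  ∑-const []       c = sym (ℤₚ.*-zeroˡ c)
  ∑-const (x ∷ xs) c = trans (cong (_+_ c) (∑-const xs c)) (lem (+ length xs) c)
    where
    lem : ∀ n c → c + n * c ≡ (1ℤ + n) * c
    lem = solve-∀

  ∑-≥0 : (xs : List X) {f : X → ℤ} → (∀ x → 0ℤ ≤ f x) → 0ℤ ≤ ∑ xs f
  ∑-≥0 []       h = ℤₚ.≤-refl
  ∑-≥0 (x ∷ xs) h = ℤₚ.+-mono-≤ (h x) (∑-≥0 xs h)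

  ∑-≤ : (xs : List X) {f g : X → ℤ} → (∀ x → f x ≤ g x) → ∑ xs f ≤ ∑ xs g
  ∑-≤ []       h = ℤₚ.≤-refl
  ∑-≤ (x ∷ xs) h = ℤₚ.+-mono-≤ (h x) (∑-≤ xs h)

  ∑-∣ : (xs : List X) {d : ℤ} {f : X → ℤ} → (∀ x → d ∣ f x) → d ∣ ∑ xs f
  ∑-∣ []       {d} h = divides 0ℤ (sym (ℤₚ.*-zeroˡ d))
  ∑-∣ (x ∷ xs) h = ∣m∣n⇒∣m+n (h x) (∑-∣ xs h)

∑-*-∑ : {X Y : Set} (xs : List X) (ys : List Y) (f : X → ℤ) (g : Y → ℤ) →
        ∑ xs f * ∑ ys g ≡ ∑ xs (λ x → ∑ ys (λ y → f x * g y))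
∑-*-∑ xs ys f g = trans (sym (∑-*ʳ xs (∑ ys g) f)) (∑-cong xs (λ x → sym (∑-*ˡ ys (f x) g)))

0≤+⇒ : ∀ {a b} → 0ℤ ≤ a → 0ℤ ≤ b → a + b ≡ 0ℤ → a ≡ 0ℤ × b ≡ 0ℤ
0≤+⇒ {+ zero}  {+ zero} _ _ _ = refl , refl
0≤+⇒ {+ suc a} {+ b} _ _ ()

∑-zero⁻ : {X : Set} {xs : List X} {f : X → ℤ} → (∀ x → 0ℤ ≤ f x) → ∑ xs f ≡ 0ℤ → ∀ {x} → x ∈ xs → f x ≡ 0ℤ
∑-zero⁻ {xs = x ∷ xs} h e (here refl) = proj₁ (0≤+⇒ (h x) (∑-≥0 xs h) e)
∑-zero⁻ {xs = x ∷ xs} h e (there i)   = ∑-zero⁻ h (proj₂ (0≤+⇒ (h x) (∑-≥0 xs h) e)) i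

-- The differences g - f are nonnegative and sum to zero. This is how counting bounds become exact:
-- for transversals, for factorizations in P and for orders of subgroups.
∑-tight : {X : Set} {xs : List X} {f g : X → ℤ} → (∀ x → f x ≤ g x) → ∑ xs f ≡ ∑ xs g → ∀ {x} → x ∈ xs → f x ≡ g x
∑-tight {xs = xs} {f} {g} h e {x} i = sym (ℤₚ.i-j≡0⇒i≡j (g x) (f x)
  (∑-zero⁻ (λ x → ℤₚ.i≤j⇒0≤j-i (h x))
           (trans (∑-- xs g f) (trans (cong (λ z → ∑ xs g - z) e) (ℤₚ.+-inverseʳ (∑ xs g)))) i))

module FiniteSum {X : Set} (F : Finite X) where
  open Finite F using (complete; unique; _≟_; code; code-inj) public

  Σ* : (X → ℤ) → ℤ
  Σ* = ∑ (elems F)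

  size : ℤ
  size = + length (elems F)

  δ : X → X → ℤ
  δ x y = [ does (x ≟ y) ]

  δ-refl : ∀ x → δ x x ≡ 1ℤ
  δ-refl x = cong [_] (dec-true (x ≟ x) refl)

  δ-≢ : ∀ {x y} → x ≢ y → δ x y ≡ 0ℤ
  δ-≢ {x} {y} n = cong [_] (dec-false (x ≟ y) n)

  Σ-δ : ∀ a (f : X → ℤ) → Σ* (λ x → δ x a * f x) ≡ f a
  Σ-δ a f = trans (∑-at F a (λ x n → trans (cong (_* f x) (δ-≢ n)) (ℤₚ.*-zeroˡ (f x))))
                  (trans (cong (_* f a) (δ-refl a)) (ℤₚ.*-identityˡ (f a)))

  Σ-one : Σ* (λ _ → 1ℤ) ≡ size
  Σ-one = trans (∑-const (elems F) 1ℤ) (ℤₚ.*-identityʳ size)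

  -- The terms off the fixed points of an involution ι pair up.
  involution-parity : (ι : X → X) → (∀ x → ι (ι x) ≡ x) → (f : X → ℤ) → (∀ x → f (ι x) ≡ f x) →
                      (∀ x → ι x ≡ x → + 2 ∣ f x) → + 2 ∣ Σ* f
  involution-parity ι ιι f fι fix =
    subst (+ 2 ∣_) (sym total) (∣m∣n⇒∣m+n (divides (Σ* low) (twice (Σ* low))) (∑-∣ (elems F) mid-even))
    where
    low mid high : X → ℤ
    low x with ℕₚ.<-cmp (code x) (code (ι x))
    ... | tri< _ _ _ = f x
    ... | tri≈ _ _ _ = 0ℤ
    ... | tri> _ _ _ = 0ℤ
    mid x with ℕₚ.<-cmp (code x) (code (ι x))
    ... | tri< _ _ _ = 0ℤ
    ... | tri≈ _ _ _ = f x
    ... | tri> _ _ _ = 0ℤ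
    high x with ℕₚ.<-cmp (code x) (code (ι x))
    ... | tri< _ _ _ = 0ℤ
    ... | tri≈ _ _ _ = 0ℤ
    ... | tri> _ _ _ = f x
    mid-even : ∀ x → + 2 ∣ mid x
    mid-even x with ℕₚ.<-cmp (code x) (code (ι x))
    ... | tri< _ _ _ = divides 0ℤ refl
    ... | tri≈ _ e _ = fix x (sym (code-inj e))
    ... | tri> _ _ _ = divides 0ℤ refl
    split : ∀ x → f x ≡ (low x + high x) + mid x
    split x with ℕₚ.<-cmp (code x) (code (ι x))
    ... | tri< _ _ _ = sym (trans (ℤₚ.+-identityʳ _) (ℤₚ.+-identityʳ _))
    ... | tri≈ _ _ _ = sym (ℤₚ.+-identityˡ _)
    ... | tri> _ _ _ = sym (trans (ℤₚ.+-identityʳ _) (ℤₚ.+-identityˡ _))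
    swapped : ∀ x → high (ι x) ≡ low x
    swapped x with ℕₚ.<-cmp (code x) (code (ι x)) | ℕₚ.<-cmp (code (ι x)) (code (ι (ι x)))
    ... | tri< a _ _ | tri< b _ _ = contradiction (subst (code (ι x) ℕ.<_) (cong code (ιι x)) b) (ℕₚ.<-asym a)
    ... | tri< a _ _ | tri≈ _ b _ = contradiction (trans b (cong code (ιι x))) (ℕₚ.<⇒≢ a ∘ sym)
    ... | tri< a _ _ | tri> _ _ b = fι x
    ... | tri≈ _ a _ | tri< b _ _ = refl
    ... | tri≈ _ a _ | tri≈ _ b _ = refl
    ... | tri≈ _ a _ | tri> _ _ b = contradiction (subst (ℕ._< code (ι x)) (cong code (ιι x)) b) (λ l → ℕₚ.<⇒≢ l a)
    ... | tri> _ _ a | tri< b _ _ = refl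
    ... | tri> _ _ a | tri≈ _ b _ = refl
    ... | tri> _ _ a | tri> _ _ b = contradiction (subst (ℕ._< code (ι x)) (cong code (ιι x)) b) (ℕₚ.<-asym a)
    twice : ∀ z → z + z ≡ z * + 2
    twice = solve-∀
    total : Σ* f ≡ (Σ* low + Σ* low) + Σ* mid
    total = begin
      Σ* f                                   ≡⟨ ∑-cong (elems F) split ⟩
      Σ* (λ x → (low x + high x) + mid x)    ≡⟨ ∑-⊕ (elems F) (λ x → low x + high x) mid ⟩
      Σ* (λ x → low x + high x) + Σ* mid     ≡⟨ cong (_+ Σ* mid) (∑-⊕ (elems F) low high) ⟩
      (Σ* low + Σ* high) + Σ* mid            ≡⟨ cong (λ z → (Σ* low + z) + Σ* mid) (sym (trans (∑-cong (elems F) (λ x → sym (swapped x))) (∑-reindex F ι ι ιι ιι high))) ⟩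
      (Σ* low + Σ* low) + Σ* mid             ∎
      where open ≡-Reasoning

  ∑-δ-unique : {ys : List X} → Unique ys → ∀ z → ∑ ys (δ z) ≤ 1ℤ
  ∑-δ-unique []        z = +≤+ ℕ.z≤n
  ∑-δ-unique {y ∷ ys} (n ∷ u) z with z ≟ y
  ... | no m = subst (_≤ 1ℤ) (sym (trans (cong (_+ ∑ ys (δ z)) (δ-≢ m)) (ℤₚ.+-identityˡ _))) (∑-δ-unique u z)
  ... | yes refl = ℤₚ.≤-reflexive (cong₂ _+_ (δ-refl z) (none n))
    where
    none : ∀ {ws} → All (z ≢_) ws → ∑ ws (δ z) ≡ 0ℤ
    none []       = refl
    none (m ∷ ms) = trans (cong₂ _+_ (δ-≢ m) (none ms)) refl

  module _ {ys : List X} (u : Unique ys) (len : length ys ≡ length (elems F)) where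

    private
      mult : X → ℤ
      mult z = ∑ ys (δ z)
      Σ-mult : (f : X → ℤ) → Σ* (λ z → mult z * f z) ≡ ∑ ys f
      Σ-mult f = trans (∑-cong (elems F) (λ z → sym (∑-*ʳ ys (f z) (δ z))))
                (trans (∑-swap (elems F) ys _) (∑-cong ys (λ y → Σ-δ y f)))
      -- Multiplicities in a list without repetition are at most 1, and here they sum to the number
      -- of elements of X, so each of them is 1.
      mult≡1 : ∀ z → mult z ≡ 1ℤ
      mult≡1 z = ∑-tight {g = λ _ → 1ℤ} (∑-δ-unique u)
        (trans (∑-cong (elems F) (λ z → sym (ℤₚ.*-identityʳ (mult z))))
        (trans (Σ-mult (λ _ → 1ℤ)) (trans (∑-const ys 1ℤ) (trans (cong (λ l → + l * 1ℤ) len) (sym (∑-const (elems F) 1ℤ)))))) (complete z)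

    ∑-relist : (f : X → ℤ) → ∑ ys f ≡ Σ* f
    ∑-relist f = trans (sym (Σ-mult f)) (∑-cong (elems F) (λ z → trans (cong (_* f z) (mult≡1 z)) (ℤₚ.*-identityˡ (f z))))

    relist-∈ : ∀ z → z ∈ ys
    relist-∈ z = go ys (λ e → contradiction (trans (sym (mult≡1 z)) e) (λ ()))
      where
      go : ∀ ws → ¬ (∑ ws (δ z) ≡ 0ℤ) → z ∈ ws
      go []       n = contradiction refl n
      go (w ∷ ws) n with z ≟ w
      ... | yes refl = here refl
      ... | no m     = there (go ws (λ e → n (cong₂ _+_ (δ-≢ m) e)))

-- Periodic integer sequences and ℤ[ζₚ]

∣-prime : ∀ {p} → Prime p → ∀ {a b} → + p ∣ a * b → + p ∣ a ⊎ + p ∣ b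
∣-prime {p} pr {a} {b} d with euclidsLemma (abs a) (abs b) pr (subst (p ℕ∣.∣_) (ℤₚ.abs-* a b) (∣⇒∣ᵤ d))
... | inj₁ e = inj₁ (∣ᵤ⇒∣ e)
... | inj₂ e = inj₂ (∣ᵤ⇒∣ e)

∣-minus : ∀ {d a b} → d ∣ a → d ∣ a - b → d ∣ b
∣-minus {d} {a} {b} da dab = subst (d ∣_) (lem a b) (∣m∣n⇒∣m-n da dab)
  where
  lem : ∀ a b → a - (a - b) ≡ b
  lem = solve-∀

S : ℕ → (ℕ → ℤ) → ℤ
S n = ∑ (upTo n)

∑-applyUpTo : {X : Set} (h : ℕ → X) (n : ℕ) (f : X → ℤ) → ∑ (applyUpTo h n) f ≡ S n (f ∘ h)
∑-applyUpTo h zero    f = refl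
∑-applyUpTo h (suc n) f = cong (_+_ (f (h 0))) (trans (∑-applyUpTo (h ∘ suc) n f) (sym (∑-applyUpTo suc n (f ∘ h))))

S-head : ∀ n (f : ℕ → ℤ) → S (suc n) f ≡ f 0 + S n (f ∘ suc)
S-head n f = cong (_+_ (f 0)) (∑-applyUpTo suc n f)

S-last : ∀ n (f : ℕ → ℤ) → S (suc n) f ≡ S n f + f n
S-last zero    f = ℤₚ.+-comm (f 0) 0ℤ
S-last (suc n) f = begin
  S (suc (suc n)) f                 ≡⟨ S-head (suc n) f ⟩
  f 0 + S (suc n) (f ∘ suc)         ≡⟨ cong (_+_ (f 0)) (S-last n (f ∘ suc)) ⟩
  f 0 + (S n (f ∘ suc) + f (suc n)) ≡⟨ ℤₚ.+-assoc (f 0) _ _ ⟨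
  (f 0 + S n (f ∘ suc)) + f (suc n) ≡⟨ cong (_+ f (suc n)) (S-head n f) ⟨
  S (suc n) f + f (suc n)           ∎
  where open ≡-Reasoning

S-cong< : ∀ n {f g : ℕ → ℤ} → (∀ j → j ℕ.< n → f j ≡ g j) → S n f ≡ S n g
S-cong< zero    h = refl
S-cong< (suc n) {f} {g} h = trans (S-last n f) (trans (cong₂ _+_ (S-cong< n (λ j l → h j (ℕₚ.m<n⇒m<1+n l))) (h n ℕₚ.≤-refl)) (sym (S-last n g)))

S-∣< : ∀ n {d} {f : ℕ → ℤ} → (∀ j → j ℕ.< n → d ∣ f j) → d ∣ S n f
S-∣< zero {d} h = divides 0ℤ (sym (ℤₚ.*-zeroˡ d))
S-∣< (suc n) {d} {f} h = subst (d ∣_) (sym (S-last n f)) (∣m∣n⇒∣m+n (S-∣< n (λ j l → h j (ℕₚ.m<n⇒m<1+n l))) (h n ℕₚ.≤-refl))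

S-reverse : ∀ n (f : ℕ → ℤ) → S n (λ l → f (n ℕ.∸ l)) ≡ S n (f ∘ suc)
S-reverse zero    f = refl
S-reverse (suc n) f = begin
  S (suc n) (λ l → f (suc n ℕ.∸ l))     ≡⟨ S-head n (λ l → f (suc n ℕ.∸ l)) ⟩
  f (suc n) + S n (λ l → f (n ℕ.∸ l))   ≡⟨ cong (_+_ (f (suc n))) (S-reverse n f) ⟩
  f (suc n) + S n (f ∘ suc)             ≡⟨ ℤₚ.+-comm (f (suc n)) _ ⟩
  S n (f ∘ suc) + f (suc n)             ≡⟨ S-last n (f ∘ suc) ⟨
  S (suc n) (f ∘ suc)                   ∎
  where open ≡-Reasoning

S-const : ∀ n c → S n (λ _ → c) ≡ + n * c
S-const n c = trans (∑-const (upTo n) c) (cong (λ l → + l * c) (length-upTo n))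

binom : ℕ → ℕ → ℕ
binom n       zero    = 1
binom zero    (suc k) = 0
binom (suc n) (suc k) = binom n k ℕ.+ binom n (suc k)

binom-> : ∀ {n k} → n ℕ.< k → binom n k ≡ 0
binom-> {zero}  (s≤s z≤n) = refl
binom-> {suc n} (s≤s l)   = cong₂ ℕ._+_ (binom-> l) (binom-> (ℕₚ.m<n⇒m<1+n l))

binom-diag : ∀ n → binom n n ≡ 1
binom-diag zero    = refl
binom-diag (suc n) = cong₂ ℕ._+_ (binom-diag n) (binom-> {n} ℕₚ.≤-refl)

binom-absorb : ∀ n k → suc k ℕ.* binom (suc n) (suc k) ≡ suc n ℕ.* binom n k
binom-absorb zero    zero    = refl
binom-absorb zero    (suc k) = ℕₚ.*-zeroʳ k
binom-absorb (suc n) zero    = trans (lem (binom (suc n) 1)) (cong (λ z → 1 ℕ.+ z) (binom-absorb n 0))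
  where
  lem : ∀ b → 1 ℕ.* (1 ℕ.+ b) ≡ 1 ℕ.+ 1 ℕ.* b
  lem = ℕ-solve-∀
binom-absorb (suc n) (suc k) = trans (lem₁ k (binom (suc n) (suc k)) (binom (suc n) (suc (suc k))))
  (trans (cong₂ (λ a b → (binom (suc n) (suc k) ℕ.+ a) ℕ.+ b) (binom-absorb n k) (binom-absorb n (suc k)))
         (lem₂ n (binom n k) (binom n (suc k))))
  where
  lem₁ : ∀ k a b → suc (suc k) ℕ.* (a ℕ.+ b) ≡ (a ℕ.+ suc k ℕ.* a) ℕ.+ suc (suc k) ℕ.* b
  lem₁ = ℕ-solve-∀
  lem₂ : ∀ n a b → ((a ℕ.+ b) ℕ.+ suc n ℕ.* a) ℕ.+ suc n ℕ.* b ≡ suc (suc n) ℕ.* (a ℕ.+ b)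
  lem₂ = ℕ-solve-∀

-- By absorption p divides (k + 1) times the binomial coefficient, and k + 1 < p.
prime∣binom : ∀ {q} → Prime (suc q) → ∀ {k} → k ℕ.< q → suc q ℕ∣.∣ binom (suc q) (suc k)
prime∣binom {q} pr {k} l with euclidsLemma (suc k) (binom (suc q) (suc k)) pr
  (subst (suc q ℕ∣.∣_) (sym (binom-absorb q k)) (ℕ∣.m∣m*n (binom q k)))
... | inj₁ d = contradiction (ℕ∣.∣⇒≤ d) (ℕₚ.<⇒≱ (s≤s l))
... | inj₂ d = d

-- On Σ f(j) ζʲ, with f periodic, this is multiplication by ζ⁻¹ - 1, a generator of the prime above
-- p.
Δ : (ℕ → ℤ) → ℕ → ℤ
Δ f j = f (suc j) - f j

Δ^ : ℕ → (ℕ → ℤ) → ℕ → ℤ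
Δ^ zero    f = f
Δ^ (suc k) f = Δ (Δ^ k f)

-- The n-th power of the shift 1 + Δ, expanded by the binomial theorem; the induction step is
-- Pascal's rule.
newton : ∀ f n j → f (j ℕ.+ n) ≡ S (suc n) (λ k → + binom n k * Δ^ k f j)
newton f zero    j = trans (cong f (ℕₚ.+-identityʳ j)) (lem (f j))
  where
  lem : ∀ a → a ≡ 1ℤ * a + 0ℤ
  lem = solve-∀
newton f (suc n) j = begin
  f (j ℕ.+ suc n)                                    ≡⟨ cong f (ℕₚ.+-suc j n) ⟩
  f (suc j ℕ.+ n)                                    ≡⟨ newton f n (suc j) ⟩
  S (suc n) (λ k → + binom n k * Δ^ k f (suc j))     ≡⟨ ∑-cong (upTo (suc n)) (λ k → step (+ binom n k) (Δ^ k f (suc j)) (Δ^ k f j)) ⟩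
  S (suc n) (λ k → u k + v k)                        ≡⟨ ∑-⊕ (upTo (suc n)) u v ⟩
  S (suc n) u + S (suc n) v                          ≡⟨ cong (_+ S (suc n) v) u-sum ⟩
  (u 0 + S (suc n) (u ∘ suc)) + S (suc n) v          ≡⟨ ℤₚ.+-assoc (u 0) _ _ ⟩
  u 0 + (S (suc n) (u ∘ suc) + S (suc n) v)          ≡⟨ cong (_+_ (u 0)) (∑-⊕ (upTo (suc n)) (u ∘ suc) v) ⟨
  u 0 + S (suc n) (λ k → u (suc k) + v k)            ≡⟨ cong (_+_ (u 0)) (∑-cong (upTo (suc n)) (λ k → pascal (+ binom n k) (+ binom n (suc k)) (Δ^ (suc k) f j))) ⟩
  u 0 + S (suc n) (w ∘ suc)                          ≡⟨ S-head (suc n) w ⟨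
  S (suc (suc n)) w                                  ∎
  where
  open ≡-Reasoning
  u v w : ℕ → ℤ
  u k = + binom n k * Δ^ k f j
  v k = + binom n k * Δ^ (suc k) f j
  w k = + binom (suc n) k * Δ^ k f j
  step : ∀ b x y → b * x ≡ b * y + b * (x - y)
  step = solve-∀
  pascal : ∀ a b x → b * x + a * x ≡ (a + b) * x
  pascal = solve-∀
  u-sum : S (suc n) u ≡ u 0 + S (suc n) (u ∘ suc)
  u-sum = begin
    S (suc n) u                ≡⟨ ℤₚ.+-identityʳ _ ⟨
    S (suc n) u + 0ℤ           ≡⟨ cong (_+_ (S (suc n) u)) (trans (cong (λ b → + b * Δ^ (suc n) f j) (binom-> {n} ℕₚ.≤-refl)) (ℤₚ.*-zeroˡ (Δ^ (suc n) f j))) ⟨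
    S (suc n) u + u (suc n)    ≡⟨ S-last (suc n) u ⟨
    S (suc (suc n)) u          ≡⟨ S-head (suc n) u ⟩
    u 0 + S (suc n) (u ∘ suc)  ∎

module Periodic (p : ℕ) where

  Per : (ℕ → ℤ) → Set
  Per f = ∀ j → f (j ℕ.+ p) ≡ f j

  Per-shift : ∀ {f} d → Per f → Per (λ j → f (j ℕ.+ d))
  Per-shift {f} d h j = trans (cong f (lem j p d)) (h (j ℕ.+ d))
    where
    lem : ∀ j p d → j ℕ.+ p ℕ.+ d ≡ j ℕ.+ d ℕ.+ p
    lem = ℕ-solve-∀

  Per-Δ : ∀ {f} → Per f → Per (Δ f)
  Per-Δ h j = cong₂ _-_ (h (suc j)) (h j)

  Per-Δ^ : ∀ {f} k → Per f → Per (Δ^ k f)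
  Per-Δ^ zero    h = h
  Per-Δ^ (suc k) h = Per-Δ (Per-Δ^ k h)

  S-suc : ∀ {f} → Per f → S p (f ∘ suc) ≡ S p f
  S-suc {f} h = ℤ+-cancelˡ (f 0) _ _ (begin
    f 0 + S p (f ∘ suc)  ≡⟨ S-head p f ⟨
    S (suc p) f          ≡⟨ S-last p f ⟩
    S p f + f p          ≡⟨ cong (_+_ (S p f)) (h 0) ⟩
    S p f + f 0          ≡⟨ ℤₚ.+-comm (S p f) (f 0) ⟩
    f 0 + S p f          ∎)
    where open ≡-Reasoning

  S-shift : ∀ {f} d → Per f → S p (λ j → f (j ℕ.+ d)) ≡ S p f
  S-shift {f} zero    h = ∑-cong (upTo p) (λ j → cong f (ℕₚ.+-identityʳ j))
  S-shift {f} (suc d) h = trans (∑-cong (upTo p) (λ j → cong f (ℕₚ.+-suc j d)))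
                         (trans (S-suc (Per-shift d h)) (S-shift d h))

  S-neg : ∀ {f} → Per f → S p (λ l → f (p ℕ.∸ l)) ≡ S p f
  S-neg {f} h = trans (S-reverse p f) (S-suc h)

  S-Δ : ∀ {f} → Per f → S p (Δ f) ≡ 0ℤ
  S-Δ {f} h = trans (∑-- (upTo p) (f ∘ suc) f) (trans (cong (_- S p f) (S-suc h)) (ℤₚ.+-inverseʳ (S p f)))

  -- For periodic sequences this depends on m - n only. Keeping two offsets avoids subtraction in ℕ.
  Corr : (ℕ → ℤ) → (ℕ → ℤ) → ℕ → ℕ → ℤ
  Corr f g m n = S p (λ j → f (j ℕ.+ m) * g (j ℕ.+ n))

  -- Taking differences in both arguments cancels the constant c. The conclusion keeps the shape of
  -- the hypothesis, with constant 0, so that the lemma can be iterated.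
  Corr-Δ : ∀ f c (d : ℤ) → (∀ m n → d ∣ Corr f f m n - c) → ∀ m n → d ∣ Corr (Δ f) (Δ f) m n - 0ℤ
  Corr-Δ f c d h m n = subst (d ∣_) (sym eq)
    (∣m∣n⇒∣m-n (∣m∣n⇒∣m-n (h (suc m) (suc n)) (h (suc m) n)) (∣m∣n⇒∣m-n (h m (suc n)) (h m n)))
    where
    F : ℕ → ℕ → ℕ → ℤ
    F m n j = f (j ℕ.+ m) * f (j ℕ.+ n)
    expand : ∀ a b c d → (a - b) * (c - d) ≡ (a * c - a * d) - (b * c - b * d)
    expand = solve-∀
    regroup : ∀ x y z w c → ((x - y) - (z - w)) - 0ℤ ≡ ((x - c) - (y - c)) - ((z - c) - (w - c))
    regroup = solve-∀
    pt : ∀ j → Δ f (j ℕ.+ m) * Δ f (j ℕ.+ n) ≡ (F (suc m) (suc n) j - F (suc m) n j) - (F m (suc n) j - F m n j)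
    pt j = trans (expand (f (suc (j ℕ.+ m))) (f (j ℕ.+ m)) (f (suc (j ℕ.+ n))) (f (j ℕ.+ n)))
                 (cong₂ (λ a b → (f a * f b - f a * f (j ℕ.+ n)) - (f (j ℕ.+ m) * f b - f (j ℕ.+ m) * f (j ℕ.+ n)))
                        (sym (ℕₚ.+-suc j m)) (sym (ℕₚ.+-suc j n)))
    eq : Corr (Δ f) (Δ f) m n - 0ℤ ≡ ((Corr f f (suc m) (suc n) - c) - (Corr f f (suc m) n - c)) - ((Corr f f m (suc n) - c) - (Corr f f m n - c))
    eq = trans (cong (_- 0ℤ) (trans (∑-cong (upTo p) pt)
           (trans (∑-- (upTo p) (λ j → F (suc m) (suc n) j - F (suc m) n j) (λ j → F m (suc n) j - F m n j))
                  (cong₂ _-_ (∑-- (upTo p) (F (suc m) (suc n)) (F (suc m) n)) (∑-- (upTo p) (F m (suc n)) (F m n))))))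
           (regroup (Corr f f (suc m) (suc n)) (Corr f f (suc m) n) (Corr f f m (suc n)) (Corr f f m n) c)

module PrimePeriod (p : ℕ) (pr : Prime p) where
  open Periodic p public

  instance
    p≢0 : ℕ.NonZero p
    p≢0 = prime⇒nonZero pr

  *-cancel-p : ∀ {a b} → + p * a ≡ + p * b → a ≡ b
  *-cancel-p {a} {b} = ℤₚ.*-cancelˡ-≡ (+ p) a b

  -- In the Newton expansion of f(j + p) = f(j) the middle binomial coefficients are divisible by p
  -- and the first term is f(j), so the last term, Δᵖf(j), is divisible by p.
  p∣Δ^p : ∀ {f} → Per f → ∀ j → + p ∣ Δ^ p f j
  p∣Δ^p = go p pr refl
    where
    go : ∀ r → Prime r → r ≡ p → ∀ {f} → Per f → ∀ j → + r ∣ Δ^ r f j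
    go zero    ()
    go (suc q) pq refl {f} h j = subst (+ suc q ∣_) (sym eq) (∣m⇒∣-m middle)
      where
      g : ℕ → ℤ
      g k = + binom (suc q) k * Δ^ k f j
      middle : + suc q ∣ S q (g ∘ suc)
      middle = S-∣< q (λ k l → ∣m⇒∣m*n (Δ^ (suc k) f j) (∣ᵤ⇒∣ {+ suc q} {+ binom (suc q) (suc k)} (prime∣binom pq l)))
      solve-top : ∀ a m t → a ≡ 1ℤ * a + (m + 1ℤ * t) → t ≡ - m
      solve-top a m t e = trans (lem₁ a m t) (trans (cong (λ z → (z - a) - m) (sym e)) (lem₂ a m))
        where
        lem₁ : ∀ a m t → t ≡ ((1ℤ * a + (m + 1ℤ * t)) - a) - m
        lem₁ = solve-∀
        lem₂ : ∀ a m → (a - a) - m ≡ - m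
        lem₂ = solve-∀
      eq : Δ^ (suc q) f j ≡ - S q (g ∘ suc)
      eq = solve-top (f j) (S q (g ∘ suc)) (Δ^ (suc q) f j) (begin
        f j                                    ≡⟨ h j ⟨
        f (j ℕ.+ suc q)                        ≡⟨ newton f (suc q) j ⟩
        S (suc (suc q)) g                      ≡⟨ S-head (suc q) g ⟩
        g 0 + S (suc q) (g ∘ suc)              ≡⟨ cong (_+_ (g 0)) (S-last q (g ∘ suc)) ⟩
        g 0 + (S q (g ∘ suc) + g (suc q))      ≡⟨ cong (λ b → g 0 + (S q (g ∘ suc) + + b * Δ^ (suc q) f j)) (binom-diag (suc q)) ⟩
        1ℤ * f j + (S q (g ∘ suc) + 1ℤ * Δ^ (suc q) f j) ∎)
        where open ≡-Reasoning

  Δ-const : ∀ (f : ℕ → ℤ) {d} → (∀ j → d ∣ Δ f j) → ∀ j → d ∣ f j - f 0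
  Δ-const f {d} h zero    = divides 0ℤ (trans (ℤₚ.+-inverseʳ (f 0)) (sym (ℤₚ.*-zeroˡ d)))
  Δ-const f {d} h (suc j) = subst (d ∣_) (lem (f (suc j)) (f j) (f 0)) (∣m∣n⇒∣m+n (h j) (Δ-const f h j))
    where
    lem : ∀ a b c → (a - b) + (b - c) ≡ a - c
    lem = solve-∀

  -- Writing f = c + pγ with Σ f = 0, the energy of f is -pc² modulo p².
  module _ (f γ : ℕ → ℤ) (c : ℤ) (fγ : ∀ j → f j ≡ c + + p * γ j) (Σf : S p f ≡ 0ℤ) where

    mean : c ≡ - S p γ
    mean = *-cancel-p (lem (+ p) c (S p γ) (trans (sym sumf) Σf))
      where
      sumf : S p f ≡ + p * c + + p * S p γ
      sumf = trans (∑-cong (upTo p) fγ) (trans (∑-⊕ (upTo p) (λ _ → c) (λ j → + p * γ j))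
               (cong₂ _+_ (S-const p c) (∑-*ˡ (upTo p) (+ p) γ)))
      lem : ∀ q c s → q * c + q * s ≡ 0ℤ → q * c ≡ q * (- s)
      lem q c s e = trans (lem₁ q c s) (trans (cong (_+ q * (- s)) e) (ℤₚ.+-identityˡ _))
        where
        lem₁ : ∀ q c s → q * c ≡ (q * c + q * s) + q * (- s)
        lem₁ = solve-∀

    energy : S p (λ j → f j * f j) ≡ + p * (+ p * S p (λ j → γ j * γ j) - c * c)
    energy = begin
      S p (λ j → f j * f j)                                          ≡⟨ ∑-cong (upTo p) (λ j → trans (cong₂ _*_ (fγ j) (fγ j)) (sq (+ p) c (γ j))) ⟩
      S p (λ j → (c * c + (+ 2 * + p * c) * γ j) + + p * + p * (γ j * γ j)) ≡⟨ ∑-⊕ (upTo p) (λ j → c * c + (+ 2 * + p * c) * γ j) (λ j → + p * + p * (γ j * γ j)) ⟩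
      S p (λ j → c * c + (+ 2 * + p * c) * γ j) + S p (λ j → + p * + p * (γ j * γ j))
        ≡⟨ cong₂ _+_ (trans (∑-⊕ (upTo p) (λ _ → c * c) (λ j → (+ 2 * + p * c) * γ j)) (cong₂ _+_ (S-const p (c * c)) (∑-*ˡ (upTo p) (+ 2 * + p * c) γ)))
                     (∑-*ˡ (upTo p) (+ p * + p) (λ j → γ j * γ j)) ⟩
      (+ p * (c * c) + (+ 2 * + p * c) * S p γ) + + p * + p * S p (λ j → γ j * γ j)
        ≡⟨ cong (λ z → (+ p * (c * c) + (+ 2 * + p * c) * z) + + p * + p * S p (λ j → γ j * γ j)) (trans (sym (ℤₚ.neg-involutive (S p γ))) (cong -_ (sym mean))) ⟩
      (+ p * (c * c) + (+ 2 * + p * c) * (- c)) + + p * + p * S p (λ j → γ j * γ j)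
        ≡⟨ fin (+ p) c (S p (λ j → γ j * γ j)) ⟩
      + p * (+ p * S p (λ j → γ j * γ j) - c * c) ∎
      where
      open ≡-Reasoning
      sq : ∀ q c g → (c + q * g) * (c + q * g) ≡ (c * c + (+ 2 * q * c) * g) + q * q * (g * g)
      sq = solve-∀
      fin : ∀ q c e → (q * (c * c) + (+ 2 * q * c) * (- c)) + q * q * e ≡ q * (q * e - c * c)
      fin = solve-∀

  private
    recover : ∀ x c q a → x - c ≡ q * a → x ≡ c + a * q
    recover x c q a e = trans (lem x c) (trans (cong (_+_ c) e) (cong (_+_ c) (ℤₚ.*-comm q a)))
      where
      lem : ∀ x c → x ≡ c + (x - c)
      lem = solve-∀

  -- Modulo p the sequence is a constant c. By `energy` the sum of squares is p(pE - c²) for an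
  -- integer E, so its divisibility by p² forces p | c², hence p | c.
  descend : ∀ (f : ℕ → ℤ) → S p f ≡ 0ℤ → + p * + p ∣ S p (λ j → f j * f j) →
            (∀ j → + p ∣ Δ f j) → ∀ j → + p ∣ f j
  descend f Σf e h j = subst (+ p ∣_) (sym (fγ j)) (∣m∣n⇒∣m+n {+ p} {f 0} {+ p * γ j} p∣c (∣m⇒∣m*n {+ p} {+ p} (γ j) ∣-refl))
    where
    γ : ℕ → ℤ
    γ j = _∣_.quotient (Δ-const f h j)
    fγ : ∀ j → f j ≡ f 0 + + p * γ j
    fγ j = recover (f j) (f 0) (γ j) (+ p) (_∣_.equality (Δ-const f h j))
    p∣e : + p ∣ + p * S p (λ j → γ j * γ j) - f 0 * f 0
    p∣e = *-cancelˡ-∣ (+ p) {+ p} {+ p * S p (λ j → γ j * γ j) - f 0 * f 0} (subst (+ p * + p ∣_) (energy f γ (f 0) fγ Σf) e)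
    p∣cc : + p ∣ f 0 * f 0
    p∣cc = ∣-minus (∣m⇒∣m*n {+ p} {+ p} (S p (λ j → γ j * γ j)) ∣-refl) p∣e
    p∣c : + p ∣ f 0
    p∣c = reduce (∣-prime pr {f 0} {f 0} p∣cc)

  -- In ℤ[ζₚ]: if p² divides t t̄, then p divides t. The start is p | Δᵖt; every Δᵏt with k ≥ 1 sums
  -- to 0 and has energy divisible by p², so `descend` lowers the exponent p - 1 times.
  flat-mod-p : ∀ t c → Per t → (∀ m n → + p * + p ∣ Corr t t m n - c) → ∀ j → + p ∣ Δ t j
  flat-mod-p t c per h = down (ℕ.pred p) (subst (λ r → ∀ j → + p ∣ Δ^ r t j) (sym (ℕₚ.suc-pred p)) (p∣Δ^p per))
    where
    corr : ∀ k m n → + p * + p ∣ Corr (Δ^ (suc k) t) (Δ^ (suc k) t) m n - 0ℤ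
    corr zero    = Corr-Δ t c (+ p * + p) h
    corr (suc k) = Corr-Δ (Δ^ (suc k) t) 0ℤ (+ p * + p) (corr k)
    square : ∀ k → Corr (Δ^ (suc k) t) (Δ^ (suc k) t) 0 0 - 0ℤ ≡ S p (λ j → Δ^ (suc k) t j * Δ^ (suc k) t j)
    square k = trans (ℤₚ.+-identityʳ _) (∑-cong (upTo p) (λ j → cong₂ (λ a b → Δ^ (suc k) t a * Δ^ (suc k) t b) (ℕₚ.+-identityʳ j) (ℕₚ.+-identityʳ j)))
    down : ∀ k → (∀ j → + p ∣ Δ^ (suc k) t j) → ∀ j → + p ∣ Δ t j
    down zero    d = d
    down (suc k) d = down k (descend (Δ^ (suc k) t) (S-Δ (Per-Δ^ k per)) (subst (+ p * + p ∣_) (square k) (corr k 0 0)) d)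

  private
    unit-sum : ∀ (g : ℕ → ℤ) → S p (λ j → g j * g j) ≡ 1ℤ → g 0 ≢ 0ℤ → S p g ≡ g 0 × (∀ j → 0 ℕ.< j → j ℕ.< p → g j ≡ 0ℤ)
    unit-sum g = go p
      where
      sq≥0 : ∀ z → 0ℤ ≤ z * z
      sq≥0 (+ n)    = subst (0ℤ ≤_) (ℤₚ.pos-* n n) (+≤+ z≤n)
      sq≥0 -[1+ n ] = +≤+ z≤n
      sq=0 : ∀ z → z * z ≡ 0ℤ → z ≡ 0ℤ
      sq=0 z e with ℤₚ.i*j≡0⇒i≡0∨j≡0 z e
      ... | inj₁ r = r
      ... | inj₂ r = r
      rest : ∀ z {s} → 0ℤ ≤ s → z ≢ 0ℤ → z * z + s ≡ 1ℤ → s ≡ 0ℤ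
      rest (+ zero)   _ n e = contradiction refl n
      rest (+ suc m) {+ s} _ n e = cong +_ (ℕₚ.m+n≡0⇒n≡0 (m ℕ.+ m ℕ.* suc m) (ℕₚ.suc-injective (ℤₚ.+-injective (trans (cong (_+ + s) (ℤₚ.pos-* (suc m) (suc m))) e))))
      rest -[1+ m ] {+ s} _ n e = cong +_ (ℕₚ.m+n≡0⇒n≡0 (m ℕ.+ m ℕ.* suc m) (ℕₚ.suc-injective (ℤₚ.+-injective e)))
      go : ∀ r → S r (λ j → g j * g j) ≡ 1ℤ → g 0 ≢ 0ℤ → S r g ≡ g 0 × (∀ j → 0 ℕ.< j → j ℕ.< r → g j ≡ 0ℤ)
      go (suc r) e n = trans (S-head r g) (trans (cong (_+_ (g 0)) (trans (S-cong< r (λ j l → zeros j l)) (trans (S-const r 0ℤ) (ℤₚ.*-zeroʳ (+ r))))) (ℤₚ.+-identityʳ (g 0)))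
                     , λ { zero () _ ; (suc j) _ (s≤s l) → zeros j l }
        where
        tail0 : S r (λ j → g (suc j) * g (suc j)) ≡ 0ℤ
        tail0 = rest (g 0) (∑-≥0 (upTo r) (λ j → sq≥0 (g (suc j)))) n (trans (sym (S-head r (λ j → g j * g j))) e)
        zeros : ∀ j → j ℕ.< r → g (suc j) ≡ 0ℤ
        zeros j l = sq=0 (g (suc j)) (∑-zero⁻ (λ j → sq≥0 (g (suc j))) tail0 (∈-upTo⁺ l))

  private
    2∤1 : ¬ (2 ℕ∣.∣ 1)
    2∤1 d = contradiction (ℕ∣.∣⇒≤ d) (λ { (s≤s ()) })

    -- Write t = -c + pγ. The vanishing sum of t gives Σγ = c and its energy gives Σγ² = 1, so γ has
    -- a single nonzero value.
    unit′ : ∀ {t c} → Per t → S p t ≡ 0ℤ →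
            (∀ m n → + p * + p ∣ Corr t t m n - (- + p)) → S p (λ j → t j * t j) ≡ + p * + p - + p → + 2 ∣ t 0 →
            c * c ≡ 1ℤ → ¬ (+ 2 ∣ - c) → + p ∣ t 0 - - c →
            t 0 ≡ c * (+ p - 1ℤ) × (∀ j → 0 ℕ.< j → j ℕ.< p → t j ≡ - c)
    unit′ {t} {c} per Σt h en even cc odd d =
      trans (tγ 0) (trans (cong (λ z → - c + + p * z) (trans (sym (proj₁ us)) (sym Σγ))) (lem₅ (+ p) c)) ,
      λ j a b → trans (tγ j) (trans (cong (λ z → - c + + p * z) (proj₂ us j a b)) (lem₆ (+ p) c))
      where
      lem₄ : ∀ a b c → (a - b) + (b - c) ≡ a - c
      lem₄ = solve-∀
      lem₅ : ∀ q c → - c + q * c ≡ c * (q - 1ℤ)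
      lem₅ = solve-∀
      lem₆ : ∀ q c → - c + q * 0ℤ ≡ - c
      lem₆ = solve-∀
      flat : ∀ j → + p ∣ t j - - c
      flat j = subst (+ p ∣_) (lem₄ (t j) (t 0) (- c)) (∣m∣n⇒∣m+n (Δ-const t (flat-mod-p t (- + p) per h) j) d)
      γ : ℕ → ℤ
      γ j = _∣_.quotient (flat j)
      tγ : ∀ j → t j ≡ - c + + p * γ j
      tγ j = recover (t j) (- c) (γ j) (+ p) (_∣_.equality (flat j))
      Σγ : c ≡ S p γ
      Σγ = ℤₚ.neg-injective (mean t γ (- c) tγ Σt)
      Eγ : S p (λ j → γ j * γ j) ≡ 1ℤ
      Eγ = *-cancel-p (lem₇ (+ p) (S p (λ j → γ j * γ j)) c cc (*-cancel-p (trans (sym (energy t γ (- c) tγ Σt)) (trans en (lem₈ (+ p))))))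
        where
        lem₈ : ∀ q → q * q - q ≡ q * (q - 1ℤ)
        lem₈ = solve-∀
        lem₇ : ∀ q e c → c * c ≡ 1ℤ → q * e - (- c) * (- c) ≡ q - 1ℤ → q * e ≡ q * 1ℤ
        lem₇ q e c cc eq = trans (lem₉ (q * e) c) (trans (cong₂ _+_ eq cc) (lem₁₀ q))
          where
          lem₉ : ∀ a c → a ≡ (a - (- c) * (- c)) + c * c
          lem₉ = solve-∀
          lem₁₀ : ∀ q → (q - 1ℤ) + 1ℤ ≡ q * 1ℤ
          lem₁₀ = solve-∀
      -- The position of the nonzero value of γ is the exponent of the root of unity. Were it not 0,
      -- then t 0 would be the odd number -c.
      γ0≢0 : γ 0 ≢ 0ℤ
      γ0≢0 e = odd (subst (+ 2 ∣_) (trans (tγ 0) (trans (cong (λ z → - c + + p * z) e) (lem₆ (+ p) c))) even)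
      us = unit-sum γ Eγ γ0≢0

  -- Modulo constants t is an element of ℤ[ζₚ] with t t̄ = p²; total ramification of p
  -- makes it p times a unit of absolute value 1, i.e. ± p times a root of unity.
  unit : ∀ {t} → Per t → S p t ≡ 0ℤ →
         (∀ m n → + p * + p ∣ Corr t t m n - (- + p)) → S p (λ j → t j * t j) ≡ + p * + p - + p → + 2 ∣ t 0 →
         ∃ λ c → (c ≡ 1ℤ ⊎ c ≡ -1ℤ) × t 0 ≡ c * (+ p - 1ℤ) × (∀ j → 0 ℕ.< j → j ℕ.< p → t j ≡ - c)
  unit {t} per Σt h en even = [ (λ d → -1ℤ , inj₂ refl , unit′ per Σt h en even refl (λ e → 2∤1 (∣⇒∣ᵤ e)) d)
                              , (λ d → 1ℤ , inj₁ refl , unit′ per Σt h en even refl (λ e → 2∤1 (∣⇒∣ᵤ e)) d) ]′ s²≡1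
    where
    flat : ∀ j → + p ∣ t j - t 0
    flat = Δ-const t (flat-mod-p t (- + p) per h)
    E : ℤ
    E = S p (λ j → _∣_.quotient (flat j) * _∣_.quotient (flat j))
    e₁ : + p * E - t 0 * t 0 ≡ + p - 1ℤ
    e₁ = *-cancel-p (trans (sym (energy t (λ j → _∣_.quotient (flat j)) (t 0) (λ j → recover (t j) (t 0) _ (+ p) (_∣_.equality (flat j))) Σt)) (trans en (lem (+ p))))
      where
      lem : ∀ q → q * q - q ≡ q * (q - 1ℤ)
      lem = solve-∀
    -- Modulo p the energy equation `e₁` says t(0)² ≡ 1; the sign obtained is -c.
    s²≡1 : + p ∣ t 0 - 1ℤ ⊎ + p ∣ t 0 - -1ℤ
    s²≡1 = ∣-prime pr (divides (E - 1ℤ) (trans (lem₁ (t 0) (+ p * E)) (trans (cong (λ z → (+ p * E - z) - 1ℤ) e₁) (lem₂ (+ p) E))))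
      where
      lem₁ : ∀ s a → (s - 1ℤ) * (s - -1ℤ) ≡ (a - (a - s * s)) - 1ℤ
      lem₁ = solve-∀
      lem₂ : ∀ q e → (q * e - (q - 1ℤ)) - 1ℤ ≡ (e - 1ℤ) * q
      lem₂ = solve-∀

private
  even⊎odd⁺ : ∀ n → + 2 ∣ + n ⊎ + 2 ∣ + n - 1ℤ
  even⊎odd⁺ zero  = inj₁ (divides 0ℤ refl)
  even⊎odd⁺ (suc n) = [ (λ e → inj₂ (subst (+ 2 ∣_) (lem₁ (+ n)) e)) , (λ o → inj₁ (subst (+ 2 ∣_) (lem₂ (+ n)) (∣m∣n⇒∣m+n o (divides 1ℤ refl)))) ]′ (even⊎odd⁺ n)
    where
    lem₁ : ∀ z → z ≡ (1ℤ + z) - 1ℤ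
    lem₁ = solve-∀
    lem₂ : ∀ z → (z - 1ℤ) + + 2 ≡ 1ℤ + z
    lem₂ = solve-∀

even⊎odd : ∀ z → + 2 ∣ z ⊎ + 2 ∣ z - 1ℤ
even⊎odd (+ n)    = even⊎odd⁺ n
even⊎odd -[1+ n ] = [ (λ e → inj₂ (subst (+ 2 ∣_) (lem₁ (+ n)) (∣m⇒∣-m (∣m∣n⇒∣m+n e (divides 1ℤ refl))))) , (λ o → inj₁ (subst (+ 2 ∣_) (lem₂ (+ n)) (∣m⇒∣-m (∣m∣n⇒∣m+n o (divides 1ℤ refl))))) ]′ (even⊎odd⁺ n)
  where
  lem₁ : ∀ z → - (z + + 2) ≡ - (1ℤ + z) - 1ℤ
  lem₁ = solve-∀
  lem₂ : ∀ z → - ((z - 1ℤ) + + 2) ≡ - (1ℤ + z)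
  lem₂ = solve-∀

2∣z²-z : ∀ z → + 2 ∣ z * z - z
2∣z²-z z = subst (+ 2 ∣_) (lem z) ([ (λ e → ∣m⇒∣m*n (z - 1ℤ) e) , (λ o → ∣n⇒∣m*n z o) ]′ (even⊎odd z))
  where
  lem : ∀ z → z * (z - 1ℤ) ≡ z * z - z
  lem = solve-∀

*-cancel-2 : ∀ {a b} → + 2 * a ≡ + 2 * b → a ≡ b
*-cancel-2 {a} {b} = ℤₚ.*-cancelˡ-≡ (+ 2) a b

-- The relations for A and σB in a cyclic quotient of order p

module Sequences (p : ℕ) (pr : Prime p) where
  open PrimePeriod p pr

  -- In the application a and b are the images of A and σB in P/⟨g⟩, and the two correlation
  -- hypotheses are the images of the two relations. The function ε is the indicator of m ≡ n modulo
  -- p; it is given by its properties because it arises there as a sum over a coset of ⟨g⟩.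
  module Pair
    (ε : ℕ → ℕ → ℤ)
    (ε-shift : ∀ d m n → ε (m ℕ.+ d) (n ℕ.+ d) ≡ ε m n)
    (ε-perˡ : ∀ m n → ε (m ℕ.+ p) n ≡ ε m n)
    (ε-perʳ : ∀ m n → ε m (n ℕ.+ p) ≡ ε m n)
    (ε-diag : ∀ m → ε m m ≡ 1ℤ)
    (ε-off : ∀ {m n} → m ℕ.< p → n ℕ.< p → m ≢ n → ε m n ≡ 0ℤ)
    (a b : ℕ → ℤ)
    (per-a : Per a) (per-b : Per b)
    (Σa : S p a ≡ + p) (Σb : S p b ≡ + p)
    (sum-corr : ∀ m n → Corr a a m n + Corr b b m n ≡ + 2 * + p * ε m n + (+ 2 * + p - + 2))
    (cross-corr : ∀ m n → Corr a b m n + Corr a b n m ≡ + 2 * + p)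
    where

    private
      P : ℤ
      P = + p
      x y : ℕ → ℤ
      x j = a j + b j
      y j = a j - b j
      per-x : Per x
      per-x j = cong₂ _+_ (per-a j) (per-b j)
      per-y : Per y
      per-y j = cong₂ _-_ (per-a j) (per-b j)
      Aa Bb Ab : ℕ → ℕ → ℤ
      Aa = Corr a a
      Bb = Corr b b
      Ab = Corr a b
      Ba : ∀ m n → Corr b a m n ≡ Ab n m
      Ba m n = ∑-cong (upTo p) (λ j → ℤₚ.*-comm (b (j ℕ.+ m)) (a (j ℕ.+ n)))

      Σ4 : ∀ (f g h k : ℕ → ℤ) → S p (λ j → (f j + g j) + (h j + k j)) ≡ (S p f + S p g) + (S p h + S p k)
      Σ4 f g h k = trans (∑-⊕ (upTo p) (λ j → f j + g j) (λ j → h j + k j)) (cong₂ _+_ (∑-⊕ (upTo p) f g) (∑-⊕ (upTo p) h k))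

      Σ4- : ∀ (f g h k : ℕ → ℤ) → S p (λ j → (f j - g j) + (h j - k j)) ≡ (S p f - S p g) + (S p h - S p k)
      Σ4- f g h k = trans (∑-⊕ (upTo p) (λ j → f j - g j) (λ j → h j - k j)) (cong₂ _+_ (∑-- (upTo p) f g) (∑-- (upTo p) h k))

      corr-x : ∀ m n → Corr x x m n ≡ + 2 * P * ε m n + (+ 4 * P - + 2)
      corr-x m n = begin
        Corr x x m n                                       ≡⟨ ∑-cong (upTo p) (λ j → expand (a (j ℕ.+ m)) (b (j ℕ.+ m)) (a (j ℕ.+ n)) (b (j ℕ.+ n))) ⟩
        _                                                  ≡⟨ Σ4 _ _ _ _ ⟩
        (Aa m n + Bb m n) + (Ab m n + Corr b a m n)        ≡⟨ cong₂ _+_ (sum-corr m n) (trans (cong (_+_ (Ab m n)) (Ba m n)) (cross-corr m n)) ⟩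
        (+ 2 * P * ε m n + (+ 2 * P - + 2)) + + 2 * P      ≡⟨ collect P (+ 2 * P * ε m n) ⟩
        + 2 * P * ε m n + (+ 4 * P - + 2)                  ∎
        where
        open ≡-Reasoning
        expand : ∀ a b c d → (a + b) * (c + d) ≡ (a * c + b * d) + (a * d + b * c)
        expand = solve-∀
        collect : ∀ q e → (e + (+ 2 * q - + 2)) + + 2 * q ≡ e + (+ 4 * q - + 2)
        collect = solve-∀

      corr-y : ∀ m n → Corr y y m n ≡ + 2 * P * ε m n - + 2
      corr-y m n = begin
        Corr y y m n                                       ≡⟨ ∑-cong (upTo p) (λ j → expand (a (j ℕ.+ m)) (b (j ℕ.+ m)) (a (j ℕ.+ n)) (b (j ℕ.+ n))) ⟩
        _                                                  ≡⟨ Σ4- _ _ _ _ ⟩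
        (Aa m n - Ab m n) + (Bb m n - Corr b a m n)        ≡⟨ regroup (Aa m n) (Ab m n) (Bb m n) (Corr b a m n) ⟩
        (Aa m n + Bb m n) - (Ab m n + Corr b a m n)        ≡⟨ cong₂ _-_ (sum-corr m n) (trans (cong (_+_ (Ab m n)) (Ba m n)) (cross-corr m n)) ⟩
        (+ 2 * P * ε m n + (+ 2 * P - + 2)) - + 2 * P      ≡⟨ collect P (+ 2 * P * ε m n) ⟩
        + 2 * P * ε m n - + 2                              ∎
        where
        open ≡-Reasoning
        expand : ∀ a b c d → (a - b) * (c - d) ≡ (a * c - a * d) + (b * d - b * c)
        expand = solve-∀
        regroup : ∀ a b c d → (a - b) + (c - d) ≡ (a + c) - (b + d)
        regroup = solve-∀
        collect : ∀ q e → (e + (+ 2 * q - + 2)) - + 2 * q ≡ e - + 2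
        collect = solve-∀

      -- Here q is x ȳ, of absolute value 2p at nontrivial characters. Eliminating b from it with
      -- the two relations leaves twice the integral expression t.
      q t : ℕ → ℤ
      q d = S p (λ j → x (j ℕ.+ d) * y j)
      t d = ((Aa d 0 - Ab d 0) + 1ℤ) - P * ε d 0

      q≡2t : ∀ d → q d ≡ + 2 * t d
      q≡2t d = begin
        q d                                               ≡⟨ ∑-cong (upTo p) (λ j → trans (cong (λ i → x (j ℕ.+ d) * y i) (sym (ℕₚ.+-identityʳ j)))
                                                                            (expand (a (j ℕ.+ d)) (b (j ℕ.+ d)) (a (j ℕ.+ 0)) (b (j ℕ.+ 0)))) ⟩
        _                                                 ≡⟨ Σ4- _ _ _ _ ⟩
        (Aa d 0 - Ab d 0) + (Corr b a d 0 - Bb d 0)       ≡⟨ cong (λ z → (Aa d 0 - Ab d 0) + (z - Bb d 0)) (Ba d 0) ⟩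
        (Aa d 0 - Ab d 0) + (Ab 0 d - Bb d 0)             ≡⟨ regroup (Aa d 0) (Ab d 0) (Ab 0 d) (Bb d 0) ⟩
        (+ 2 * Aa d 0 - + 2 * Ab d 0) + ((Ab d 0 + Ab 0 d) - (Aa d 0 + Bb d 0))
          ≡⟨ cong₂ (λ u v → (+ 2 * Aa d 0 - + 2 * Ab d 0) + (u - v)) (cross-corr d 0) (sum-corr d 0) ⟩
        (+ 2 * Aa d 0 - + 2 * Ab d 0) + (+ 2 * P - (+ 2 * P * ε d 0 + (+ 2 * P - + 2)))
          ≡⟨ collect (Aa d 0) (Ab d 0) P (ε d 0) ⟩
        + 2 * t d ∎
        where
        open ≡-Reasoning
        expand : ∀ a b c d → (a + b) * (c - d) ≡ (a * c - a * d) + (b * c - b * d)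
        expand = solve-∀
        regroup : ∀ a b c d → (a - b) + (c - d) ≡ (+ 2 * a - + 2 * b) + ((b + c) - (a + d))
        regroup = solve-∀
        collect : ∀ a b q e → (+ 2 * a - + 2 * b) + (+ 2 * q - (+ 2 * q * e + (+ 2 * q - + 2))) ≡ + 2 * (((a - b) + 1ℤ) - q * e)
        collect = solve-∀

      Σy : S p y ≡ 0ℤ
      Σy = trans (∑-- (upTo p) a b) (trans (cong₂ _-_ Σa Σb) (ℤₚ.+-inverseʳ P))

      Σt : S p t ≡ 0ℤ
      Σt = *-cancel-2 (begin
        + 2 * S p t                                   ≡⟨ ∑-*ˡ (upTo p) (+ 2) t ⟨
        S p (λ d → + 2 * t d)                         ≡⟨ ∑-cong (upTo p) (λ d → sym (q≡2t d)) ⟩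
        S p q                                         ≡⟨ ∑-swap (upTo p) (upTo p) (λ d j → x (j ℕ.+ d) * y j) ⟩
        S p (λ j → S p (λ d → x (j ℕ.+ d) * y j))     ≡⟨ ∑-cong (upTo p) (λ j → trans (∑-*ʳ (upTo p) (y j) (λ d → x (j ℕ.+ d)))
                                                           (cong (_* y j) (trans (∑-cong (upTo p) (λ d → cong x (ℕₚ.+-comm j d))) (S-shift j per-x)))) ⟩
        S p (λ j → S p x * y j)                       ≡⟨ ∑-*ˡ (upTo p) (S p x) y ⟩
        S p x * S p y                                 ≡⟨ cong (S p x *_) Σy ⟩
        S p x * 0ℤ                                    ≡⟨ ℤₚ.*-zeroʳ (S p x) ⟩
        0ℤ                                            ∎)
        where open ≡-Reasoning

      SS : (ℕ → ℕ → ℤ) → ℤ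
      SS f = S p (λ j → S p (f j))

      SS-cong : ∀ {f g : ℕ → ℕ → ℤ} → (∀ j l → f j l ≡ g j l) → SS f ≡ SS g
      SS-cong h = ∑-cong (upTo p) (λ j → ∑-cong (upTo p) (h j))

      -- The identity |x ȳ|² = |x|² |y|² in terms of correlations.
      corr-q : ∀ m n → Corr q q m n ≡ SS (λ j l → (y j * y l) * Corr x x (j ℕ.+ m) (l ℕ.+ n))
      corr-q m n = begin
        S p (λ d → q (d ℕ.+ m) * q (d ℕ.+ n))
          ≡⟨ ∑-cong (upTo p) (λ d → ∑-*-∑ (upTo p) (upTo p) (λ j → x (j ℕ.+ (d ℕ.+ m)) * y j) (λ l → x (l ℕ.+ (d ℕ.+ n)) * y l)) ⟩
        S p (λ d → SS (λ j l → (x (j ℕ.+ (d ℕ.+ m)) * y j) * (x (l ℕ.+ (d ℕ.+ n)) * y l)))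
          ≡⟨ ∑-cong (upTo p) (λ d → SS-cong (λ j l → trans (shuffle (x (j ℕ.+ (d ℕ.+ m))) (y j) (x (l ℕ.+ (d ℕ.+ n))) (y l))
               (cong₂ (λ u v → (y j * y l) * (x u * x v)) (exch j d m) (exch l d n)))) ⟩
        S p (λ d → SS (λ j l → F d j l))
          ≡⟨ ∑-swap (upTo p) (upTo p) (λ d j → S p (F d j)) ⟩
        S p (λ j → S p (λ d → S p (F d j)))
          ≡⟨ ∑-cong (upTo p) (λ j → ∑-swap (upTo p) (upTo p) (λ d l → F d j l)) ⟩
        SS (λ j l → S p (λ d → F d j l))
          ≡⟨ SS-cong (λ j l → ∑-*ˡ (upTo p) (y j * y l) (λ d → x (d ℕ.+ (j ℕ.+ m)) * x (d ℕ.+ (l ℕ.+ n)))) ⟩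
        SS (λ j l → (y j * y l) * Corr x x (j ℕ.+ m) (l ℕ.+ n)) ∎
        where
        open ≡-Reasoning
        F : ℕ → ℕ → ℕ → ℤ
        F d j l = (y j * y l) * (x (d ℕ.+ (j ℕ.+ m)) * x (d ℕ.+ (l ℕ.+ n)))
        shuffle : ∀ a b c d → (a * b) * (c * d) ≡ (b * d) * (a * c)
        shuffle = solve-∀
        exch : ∀ j d m → j ℕ.+ (d ℕ.+ m) ≡ d ℕ.+ (j ℕ.+ m)
        exch = ℕ-solve-∀

      ε-pick : ∀ (f : ℕ → ℤ) {j} → j ℕ.< p → S p (λ l → ε j l * f l) ≡ f j
      ε-pick f {j} j<p = trans (S-cong< p (λ l l<p → pick l l<p (l ℕₚ.≟ j)))
        (trans (∑-single {f = λ l → [ does (l ℕₚ.≟ j) ] * f l} (upTo⁺ p) (∈-upTo⁺ j<p)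
                 (λ l n → trans (cong (λ z → [ z ] * f l) (dec-false (l ℕₚ.≟ j) n)) (ℤₚ.*-zeroˡ (f l))))
               (trans (cong (λ z → [ z ] * f j) (dec-true (j ℕₚ.≟ j) refl)) (ℤₚ.*-identityˡ (f j))))
        where
        pick : ∀ l → l ℕ.< p → (d : Dec (l ≡ j)) → ε j l * f l ≡ [ does d ] * f l
        pick l l<p (yes refl) = cong (_* f l) (ε-diag l)
        pick l l<p (no n)     = cong (_* f l) (ε-off j<p l<p (n ∘ sym))

      corr-ε : ∀ m n → SS (λ j l → (y j * y l) * ε (j ℕ.+ m) (l ℕ.+ n)) ≡ Corr y y n m
      corr-ε m n = begin
        SS (λ j l → H j l)
          ≡⟨ S-shift n (λ j → ∑-cong (upTo p) (λ l → cong₂ (λ u v → (u * y l) * v) (per-y j) (trans (cong (λ i → ε i (l ℕ.+ n)) (swap j p m)) (ε-perˡ (j ℕ.+ m) (l ℕ.+ n))))) ⟨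
        SS (λ j l → H (j ℕ.+ n) l)
          ≡⟨ ∑-cong (upTo p) (λ j → S-shift m (λ l → cong₂ (λ u v → (y (j ℕ.+ n) * u) * v) (per-y l) (trans (cong (ε (j ℕ.+ n ℕ.+ m)) (swap l p n)) (ε-perʳ (j ℕ.+ n ℕ.+ m) (l ℕ.+ n))))) ⟨
        SS (λ j l → H (j ℕ.+ n) (l ℕ.+ m))
          ≡⟨ SS-cong (λ j l → trans (cong ((y (j ℕ.+ n) * y (l ℕ.+ m)) *_) (trans (cong₂ ε (ℕₚ.+-assoc j n m) (trans (ℕₚ.+-assoc l m n) (cong (l ℕ.+_) (ℕₚ.+-comm m n)))) (ε-shift (n ℕ.+ m) j l)))
               (shuffle (y (j ℕ.+ n)) (y (l ℕ.+ m)) (ε j l))) ⟩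
        S p (λ j → S p (λ l → y (j ℕ.+ n) * (ε j l * y (l ℕ.+ m))))
          ≡⟨ ∑-cong (upTo p) (λ j → ∑-*ˡ (upTo p) (y (j ℕ.+ n)) (λ l → ε j l * y (l ℕ.+ m))) ⟩
        S p (λ j → y (j ℕ.+ n) * S p (λ l → ε j l * y (l ℕ.+ m)))
          ≡⟨ S-cong< p (λ j j<p → cong (y (j ℕ.+ n) *_) (ε-pick (λ l → y (l ℕ.+ m)) j<p)) ⟩
        Corr y y n m ∎
        where
        open ≡-Reasoning
        H : ℕ → ℕ → ℤ
        H j l = (y j * y l) * ε (j ℕ.+ m) (l ℕ.+ n)
        swap : ∀ j p m → j ℕ.+ p ℕ.+ m ≡ j ℕ.+ m ℕ.+ p
        swap = ℕ-solve-∀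
        shuffle : ∀ a b e → (a * b) * e ≡ a * (e * b)
        shuffle = solve-∀

      -- Modulo constants, t t̄ = p². Inserting the correlation of x into `corr-q`, its constant
      -- part is killed by Σ y = 0 and its ε part reproduces the correlation of y.
      corr-t : ∀ m n → Corr t t m n ≡ P * P * ε n m - P
      corr-t m n = *-cancel-2 (*-cancel-2 (begin
        + 2 * (+ 2 * Corr t t m n)                                     ≡⟨ four (Corr t t m n) ⟩
        + 4 * Corr t t m n                                             ≡⟨ ∑-*ˡ (upTo p) (+ 4) (λ d → t (d ℕ.+ m) * t (d ℕ.+ n)) ⟨
        S p (λ d → + 4 * (t (d ℕ.+ m) * t (d ℕ.+ n)))                  ≡⟨ ∑-cong (upTo p) (λ d → trans (spread (t (d ℕ.+ m)) (t (d ℕ.+ n))) (sym (cong₂ _*_ (q≡2t (d ℕ.+ m)) (q≡2t (d ℕ.+ n))))) ⟩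
        Corr q q m n                                                   ≡⟨ corr-q m n ⟩
        SS (λ j l → (y j * y l) * Corr x x (j ℕ.+ m) (l ℕ.+ n))        ≡⟨ SS-cong (λ j l → trans (cong ((y j * y l) *_) (corr-x (j ℕ.+ m) (l ℕ.+ n))) (dist (y j) (y l) (+ 2 * P) (ε (j ℕ.+ m) (l ℕ.+ n)) (+ 4 * P - + 2))) ⟩
        SS (λ j l → (+ 2 * P) * E j l + (+ 4 * P - + 2) * (y j * y l)) ≡⟨ trans (∑-cong (upTo p) (λ j → ∑-⊕ (upTo p) (λ l → (+ 2 * P) * E j l) (λ l → (+ 4 * P - + 2) * (y j * y l))))
                                                                                (∑-⊕ (upTo p) (λ j → S p (λ l → (+ 2 * P) * E j l)) (λ j → S p (λ l → (+ 4 * P - + 2) * (y j * y l)))) ⟩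
        SS (λ j l → (+ 2 * P) * E j l) + SS (λ j l → (+ 4 * P - + 2) * (y j * y l)) ≡⟨ cong₂ _+_ (SS-*ˡ (+ 2 * P) E) (SS-*ˡ (+ 4 * P - + 2) (λ j l → y j * y l)) ⟩
        (+ 2 * P) * SS E + (+ 4 * P - + 2) * SS (λ j l → y j * y l)    ≡⟨ cong₂ (λ u v → (+ 2 * P) * u + (+ 4 * P - + 2) * v) (trans (corr-ε m n) (corr-y n m))
                                                                                (trans (sym (∑-*-∑ (upTo p) (upTo p) y y)) (trans (cong (_* S p y) Σy) (ℤₚ.*-zeroˡ (S p y)))) ⟩
        (+ 2 * P) * (+ 2 * P * ε n m - + 2) + (+ 4 * P - + 2) * 0ℤ     ≡⟨ fin P (ε n m) ⟩
        + 2 * (+ 2 * (P * P * ε n m - P))                              ∎))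
        where
        open ≡-Reasoning
        E : ℕ → ℕ → ℤ
        E j l = (y j * y l) * ε (j ℕ.+ m) (l ℕ.+ n)
        SS-*ˡ : ∀ c (f : ℕ → ℕ → ℤ) → SS (λ j l → c * f j l) ≡ c * SS f
        SS-*ˡ c f = trans (∑-cong (upTo p) (λ j → ∑-*ˡ (upTo p) c (f j))) (∑-*ˡ (upTo p) c (λ j → S p (f j)))
        four : ∀ z → + 2 * (+ 2 * z) ≡ + 4 * z
        four = solve-∀
        spread : ∀ a b → + 4 * (a * b) ≡ (+ 2 * a) * (+ 2 * b)
        spread = solve-∀
        dist : ∀ a b c e k → (a * b) * (c * e + k) ≡ c * ((a * b) * e) + k * (a * b)
        dist = solve-∀
        fin : ∀ q e → (+ 2 * q) * (+ 2 * q * e - + 2) + (+ 4 * q - + 2) * 0ℤ ≡ + 2 * (+ 2 * (q * q * e - q))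
        fin = solve-∀

      per-t : Per t
      per-t d = cong₂ _-_ (cong (_+ 1ℤ) (cong₂ _-_ (shiftˡ per-a a d) (shiftˡ per-a b d))) (cong (P *_) (ε-perˡ d 0))
        where
        shiftˡ : ∀ {f} → Per f → ∀ g d → Corr f g (d ℕ.+ p) 0 ≡ Corr f g d 0
        shiftˡ {f} pf g d = ∑-cong (upTo p) (λ j → cong (_* g (j ℕ.+ 0)) (trans (cong f (sym (ℕₚ.+-assoc j d p))) (pf (j ℕ.+ d))))

      Ab₀₀ : Ab 0 0 ≡ P
      Ab₀₀ = *-cancel-2 (trans (lem (Ab 0 0)) (cross-corr 0 0))
        where
        lem : ∀ z → + 2 * z ≡ z + z
        lem = solve-∀

      t₀ : t 0 ≡ (Aa 0 0 - + 2 * P) + 1ℤ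
      t₀ = trans (cong₂ (λ u v → ((Aa 0 0 - u) + 1ℤ) - P * v) Ab₀₀ (ε-diag 0)) (lem (Aa 0 0) P)
        where
        lem : ∀ u q → ((u - q) + 1ℤ) - q * 1ℤ ≡ (u - + 2 * q) + 1ℤ
        lem = solve-∀

      -- Since z² ≡ z modulo 2, the energy of a has the parity of Σ a = p. As p is odd, this makes t
      -- 0 even, which is what `unit` asks for.
      Aa₀₀-parity : + 2 ∣ Aa 0 0 - P
      Aa₀₀-parity = subst (+ 2 ∣_) eq (∑-∣ (upTo p) (λ j → 2∣z²-z (a j)))
        where
        eq : S p (λ j → a j * a j - a j) ≡ Aa 0 0 - P
        eq = trans (∑-- (upTo p) (λ j → a j * a j) a) (cong₂ _-_ (∑-cong (upTo p) (λ j → cong₂ (λ u v → a u * a v) (sym (ℕₚ.+-identityʳ j)) (sym (ℕₚ.+-identityʳ j)))) Σa)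

      unit-t : + 2 ∣ P - 1ℤ → ∃ λ c → (c ≡ 1ℤ ⊎ c ≡ -1ℤ) × t 0 ≡ c * (P - 1ℤ) × (∀ j → 0 ℕ.< j → j ℕ.< p → t j ≡ - c)
      unit-t odd = unit per-t Σt
        (λ m n → divides (ε n m) (trans (cong (_- - P) (corr-t m n)) (lem₁ P (ε n m))))
        (trans (∑-cong (upTo p) (λ j → cong₂ (λ u v → t u * t v) (sym (ℕₚ.+-identityʳ j)) (sym (ℕₚ.+-identityʳ j))))
               (trans (corr-t 0 0) (trans (cong (λ e → P * P * e - P) (ε-diag 0)) (lem₂ P))))
        (subst (+ 2 ∣_) (trans (lem₃ (Aa 0 0) P) (sym t₀)) (∣m∣n⇒∣m-n Aa₀₀-parity odd))
        where
        lem₁ : ∀ q e → (q * q * e - q) - - q ≡ e * (q * q)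
        lem₁ = solve-∀
        lem₂ : ∀ q → q * q * 1ℤ - q ≡ q * q - q
        lem₂ = solve-∀
        lem₃ : ∀ u q → (u - q) - (q - 1ℤ) ≡ (u - + 2 * q) + 1ℤ
        lem₃ = solve-∀

    -- By `t₀` the value is t(0) + 2p - 1, and t(0) = c(p - 1) with c = -1 or c = 1.
    autocorr-at-0 : + 2 ∣ + p - 1ℤ → Corr a a 0 0 ≡ + p ⊎ Corr a a 0 0 ≡ + 3 * + p - + 2
    autocorr-at-0 odd = go (unit-t odd)
      where
      from-t : ∀ c → t 0 ≡ c * (P - 1ℤ) → Aa 0 0 ≡ (c * (P - 1ℤ) + + 2 * P) - 1ℤ
      from-t c e = trans (lem (Aa 0 0) P) (cong (λ z → (z + + 2 * P) - 1ℤ) (trans (sym t₀) e))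
        where
        lem : ∀ u q → u ≡ (((u - + 2 * q) + 1ℤ) + + 2 * q) - 1ℤ
        lem = solve-∀
      plus : ∀ q → (1ℤ * (q - 1ℤ) + + 2 * q) - 1ℤ ≡ + 3 * q - + 2
      plus = solve-∀
      minus : ∀ q → (-1ℤ * (q - 1ℤ) + + 2 * q) - 1ℤ ≡ q
      minus = solve-∀
      go : (∃ λ c → (c ≡ 1ℤ ⊎ c ≡ -1ℤ) × t 0 ≡ c * (P - 1ℤ) × (∀ j → 0 ℕ.< j → j ℕ.< p → t j ≡ - c)) →
           Aa 0 0 ≡ P ⊎ Aa 0 0 ≡ + 3 * P - + 2
      go (c , inj₁ refl , e , _) = inj₂ (trans (from-t 1ℤ e) (plus P))
      go (c , inj₂ refl , e , _) = inj₁ (trans (from-t -1ℤ e) (minus P))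

    -- In t(d) + t(p - d) the cross terms add up to `Ab d 0 + Ab 0 d`, which is 2p. Both values of t
    -- are -c, so the difference in question is -c - 1, that is 0 or -2.
    autocorr-parity : + 2 ∣ + p - 1ℤ → ∀ d → 0 ℕ.< d → d ℕ.< p → + 2 ∣ Corr a a d 0 - + p
    autocorr-parity odd d 0<d d<p = go (unit-t odd)
      where
      d′ = p ℕ.∸ d
      corr-rev : ∀ {f g : ℕ → ℤ} → Per f → Per g → Corr f g d′ 0 ≡ Corr f g 0 d
      corr-rev {f} {g} pf pg = begin
        Corr f g d′ 0
          ≡⟨ S-shift {f = λ j → f (j ℕ.+ d′) * g (j ℕ.+ 0)} d (λ j → cong₂ _*_ (Per-shift d′ pf j) (Per-shift 0 pg j)) ⟨
        S p (λ j → f (j ℕ.+ d ℕ.+ d′) * g (j ℕ.+ d ℕ.+ 0))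
          ≡⟨ ∑-cong (upTo p) (λ j → cong₂ _*_ (trans (cong f (trans (ℕₚ.+-assoc j d d′) (cong (j ℕ.+_) (ℕₚ.m+[n∸m]≡n (ℕₚ.<⇒≤ d<p))))) (trans (pf j) (cong f (sym (ℕₚ.+-identityʳ j)))))
                                              (cong g (ℕₚ.+-identityʳ (j ℕ.+ d)))) ⟩
        Corr f g 0 d ∎
        where open ≡-Reasoning
      Aa-sym : Aa 0 d ≡ Aa d 0
      Aa-sym = ∑-cong (upTo p) (λ j → ℤₚ.*-comm (a (j ℕ.+ 0)) (a (j ℕ.+ d)))
      off : ∀ e → 0 ℕ.< e → e ℕ.< p → t e ≡ (Aa e 0 - Ab e 0) + 1ℤ
      off e 0<e e<p = trans (cong (λ z → ((Aa e 0 - Ab e 0) + 1ℤ) - P * z) (ε-off e<p (ℕₚ.<-trans 0<e e<p) (λ eq → ℕₚ.<⇒≢ 0<e (sym eq)))) (lem ((Aa e 0 - Ab e 0) + 1ℤ) P)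
        where
        lem : ∀ u q → u - q * 0ℤ ≡ u
        lem = solve-∀
      0<d′ : 0 ℕ.< d′
      0<d′ = ℕₚ.m<n⇒0<n∸m d<p
      d′<p : d′ ℕ.< p
      d′<p = ℕₚ.∸-monoʳ-< 0<d (ℕₚ.<⇒≤ d<p)
      pair : t d + t d′ ≡ + 2 * ((Aa d 0 - P) + 1ℤ)
      pair = begin
        t d + t d′
          ≡⟨ cong₂ _+_ (off d 0<d d<p) (off d′ 0<d′ d′<p) ⟩
        ((Aa d 0 - Ab d 0) + 1ℤ) + ((Aa d′ 0 - Ab d′ 0) + 1ℤ)
          ≡⟨ cong₂ (λ u v → ((Aa d 0 - Ab d 0) + 1ℤ) + ((u - v) + 1ℤ)) (trans (corr-rev per-a per-a) Aa-sym) (corr-rev per-a per-b) ⟩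
        ((Aa d 0 - Ab d 0) + 1ℤ) + ((Aa d 0 - Ab 0 d) + 1ℤ)
          ≡⟨ lem₁ (Aa d 0) (Ab d 0) (Ab 0 d) ⟩
        (+ 2 * Aa d 0 - (Ab d 0 + Ab 0 d)) + + 2
          ≡⟨ cong (λ z → (+ 2 * Aa d 0 - z) + + 2) (cross-corr d 0) ⟩
        (+ 2 * Aa d 0 - + 2 * P) + + 2
          ≡⟨ lem₂ (Aa d 0) P ⟩
        + 2 * ((Aa d 0 - P) + 1ℤ) ∎
        where
        open ≡-Reasoning
        lem₁ : ∀ a b c → ((a - b) + 1ℤ) + ((a - c) + 1ℤ) ≡ (+ 2 * a - (b + c)) + + 2
        lem₁ = solve-∀
        lem₂ : ∀ a q → (+ 2 * a - + 2 * q) + + 2 ≡ + 2 * ((a - q) + 1ℤ)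
        lem₂ = solve-∀
      solve-Aa : ∀ c → t d ≡ - c → t d′ ≡ - c → Aa d 0 - P ≡ - c - 1ℤ
      solve-Aa c e e′ = trans (lem₁ (Aa d 0 - P)) (cong (_- 1ℤ) (*-cancel-2 (trans (sym pair) (trans (cong₂ _+_ e e′) (lem₂ c)))))
        where
        lem₁ : ∀ z → z ≡ (z + 1ℤ) - 1ℤ
        lem₁ = solve-∀
        lem₂ : ∀ c → - c + - c ≡ + 2 * (- c)
        lem₂ = solve-∀
      go : (∃ λ c → (c ≡ 1ℤ ⊎ c ≡ -1ℤ) × t 0 ≡ c * (P - 1ℤ) × (∀ j → 0 ℕ.< j → j ℕ.< p → t j ≡ - c)) →
           + 2 ∣ Aa d 0 - P
      go (c , inj₁ refl , _ , f) = divides -1ℤ (solve-Aa 1ℤ (f d 0<d d<p) (f d′ 0<d′ d′<p))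
      go (c , inj₂ refl , _ , f) = divides 0ℤ (solve-Aa -1ℤ (f d 0<d d<p) (f d′ 0<d′ d′<p))

-- Group rings of finite abelian groups

module GroupSum {X : Set} (F : Finite X) {_∙_ : X → X → X} {ε : X} {_⁻¹ : X → X}
                (isGroup : IsGroup _≡_ _∙_ ε _⁻¹) where

  group : Group 0ℓ 0ℓ
  group = record { isGroup = isGroup }

  open FiniteSum F public
  open Group group public using (assoc; identityˡ; identityʳ; inverseˡ; inverseʳ)
  open GroupProperties group public using (ε⁻¹≈ε; ⁻¹-involutive; ⁻¹-anti-homo-∙; ∙-cancelˡ; ∙-cancelʳ; inverseˡ-unique; inverseʳ-unique)
    renaming (\\-leftDividesˡ to x∙x⁻¹y; \\-leftDividesʳ to x⁻¹∙xy; //-rightDividesˡ to yx⁻¹∙x; //-rightDividesʳ to yx∙x⁻¹)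

  infixr 9 _^_
  _^_ : X → ℕ → X
  x ^ n = Mult._×_ (Group.monoid group) n x

  ^-+ : ∀ x m n → x ^ (m ℕ.+ n) ≡ (x ^ m) ∙ (x ^ n)
  ^-+ = Mult.×-homo-+ (Group.monoid group)

  ^-* : ∀ x m n → (x ^ n) ^ m ≡ x ^ (m ℕ.* n)
  ^-* = Mult.×-assocˡ (Group.monoid group)

  ε^ : ∀ n → ε ^ n ≡ ε
  ε^ zero    = refl
  ε^ (suc n) = trans (identityˡ _) (ε^ n)

  Σ-transˡ : ∀ g (f : X → ℤ) → Σ* (λ x → f (g ∙ x)) ≡ Σ* f
  Σ-transˡ g = ∑-reindex F (g ∙_) ((g ⁻¹) ∙_) (x∙x⁻¹y g) (x⁻¹∙xy g)

  Σ-transʳ : ∀ g (f : X → ℤ) → Σ* (λ x → f (x ∙ g)) ≡ Σ* f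
  Σ-transʳ g = ∑-reindex F (_∙ g) (_∙ (g ⁻¹)) (yx⁻¹∙x g) (yx∙x⁻¹ g)

  Σ-inv : (f : X → ℤ) → Σ* (λ x → f (x ⁻¹)) ≡ Σ* f
  Σ-inv = ∑-reindex F _⁻¹ _⁻¹ ⁻¹-involutive ⁻¹-involutive

module AbelianSum {X : Set} (F : Finite X) {_∙_ : X → X → X} {ε : X} {_⁻¹ : X → X}
                  (isAbelianGroup : IsAbelianGroup _≡_ _∙_ ε _⁻¹) where

  abelianGroup : AbelianGroup 0ℓ 0ℓ
  abelianGroup = record { isAbelianGroup = isAbelianGroup }

  open GroupSum F (AbelianGroup.isGroup abelianGroup) public
  open AbelianGroup abelianGroup public using (comm)
  open AbelianGroupProperties abelianGroup public using (⁻¹-∙-comm)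

  ^-∙ : ∀ x y n → (x ∙ y) ^ n ≡ (x ^ n) ∙ (y ^ n)
  ^-∙ = CommMult.×-distrib-+ (AbelianGroup.commutativeMonoid abelianGroup)

  open import Algebra.Properties.CommutativeSemigroup (AbelianGroup.commutativeSemigroup abelianGroup) public
    using (interchange; x∙yz≈y∙xz)

  infixl 7 _⊛_
  _⊛_ : (X → ℤ) → (X → ℤ) → X → ℤ
  (f ⊛ h) x = Σ* (λ w → f w * h ((w ⁻¹) ∙ x))

  infix 10 _*ᵍ
  _*ᵍ : (X → ℤ) → X → ℤ
  (f *ᵍ) x = f (x ⁻¹)

  𝟙 : X → ℤ
  𝟙 x = δ x ε

  private
    E : List X
    E = elems F

  xy⁻¹-reindex : ∀ x (f : X → ℤ) → Σ* (λ w → f (x ∙ (w ⁻¹))) ≡ Σ* f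
  xy⁻¹-reindex x f = trans (Σ-inv (λ w → f (x ∙ w))) (Σ-transˡ x f)

  [xy]⁻¹x : ∀ x y → ((x ∙ y) ⁻¹) ∙ x ≡ y ⁻¹
  [xy]⁻¹x x y = trans (cong (_∙ x) (⁻¹-anti-homo-∙ x y)) (yx⁻¹∙x x (y ⁻¹))

  ⊛-comm : ∀ f h x → (f ⊛ h) x ≡ (h ⊛ f) x
  ⊛-comm f h x = begin
    Σ* (λ w → f w * h ((w ⁻¹) ∙ x))                            ≡⟨ xy⁻¹-reindex x (λ w → f w * h ((w ⁻¹) ∙ x)) ⟨
    Σ* (λ w → f (x ∙ (w ⁻¹)) * h (((x ∙ (w ⁻¹)) ⁻¹) ∙ x))      ≡⟨ ∑-cong E (λ w → trans (ℤₚ.*-comm (f (x ∙ (w ⁻¹))) _)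
                                                                    (cong₂ _*_ (cong h (trans ([xy]⁻¹x x (w ⁻¹)) (⁻¹-involutive w))) (cong f (comm x (w ⁻¹))))) ⟩
    Σ* (λ w → h w * f ((w ⁻¹) ∙ x))                            ∎
    where open ≡-Reasoning

  ⊛-assoc : ∀ f g h x → ((f ⊛ g) ⊛ h) x ≡ (f ⊛ (g ⊛ h)) x
  ⊛-assoc f g h x = begin
    Σ* (λ w → (f ⊛ g) w * h ((w ⁻¹) ∙ x))
      ≡⟨ ∑-cong E (λ w → sym (∑-*ʳ E (h ((w ⁻¹) ∙ x)) (λ v → f v * g ((v ⁻¹) ∙ w)))) ⟩
    Σ* (λ w → Σ* (λ v → (f v * g ((v ⁻¹) ∙ w)) * h ((w ⁻¹) ∙ x)))
      ≡⟨ ∑-swap E E (λ w v → (f v * g ((v ⁻¹) ∙ w)) * h ((w ⁻¹) ∙ x)) ⟩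
    Σ* (λ v → Σ* (λ w → (f v * g ((v ⁻¹) ∙ w)) * h ((w ⁻¹) ∙ x)))
      ≡⟨ ∑-cong E (λ v → sym (Σ-transˡ v (λ w → (f v * g ((v ⁻¹) ∙ w)) * h ((w ⁻¹) ∙ x)))) ⟩
    Σ* (λ v → Σ* (λ w → (f v * g ((v ⁻¹) ∙ (v ∙ w))) * h (((v ∙ w) ⁻¹) ∙ x)))
      ≡⟨ ∑-cong E (λ v → trans (∑-cong E (λ w → trans (ℤₚ.*-assoc (f v) _ _)
           (cong (f v *_) (cong₂ _*_ (cong g (x⁻¹∙xy v w)) (cong h (trans (cong (_∙ x) (⁻¹-anti-homo-∙ v w)) (assoc (w ⁻¹) (v ⁻¹) x)))))))
           (∑-*ˡ E (f v) (λ w → g w * h ((w ⁻¹) ∙ ((v ⁻¹) ∙ x))))) ⟩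
    Σ* (λ v → f v * (g ⊛ h) ((v ⁻¹) ∙ x)) ∎
    where open ≡-Reasoning

  ⊛-identityˡ : ∀ f x → (𝟙 ⊛ f) x ≡ f x
  ⊛-identityˡ f x = trans (Σ-δ ε (λ w → f ((w ⁻¹) ∙ x))) (cong f (trans (cong (_∙ x) ε⁻¹≈ε) (identityˡ x)))

  ⊛-const : ∀ f c x → (f ⊛ (λ _ → c)) x ≡ Σ* f * c
  ⊛-const f c x = ∑-*ʳ E c f

  -- Packaged as a commutative ring with pointwise equality, so that the ring solver can prove
  -- identities between convolutions.
  groupRing : CommutativeRing 0ℓ 0ℓ
  groupRing = record
    { Carrier = X → ℤ ; _≈_ = λ f h → ∀ x → f x ≡ h x
    ; _+_ = λ f h x → f x + h x ; _*_ = _⊛_ ; -_ = λ f x → - f x ; 0# = λ _ → 0ℤ ; 1# = 𝟙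
    ; isCommutativeRing = record
      { isRing = record
        { +-isAbelianGroup = record
          { isGroup = record
            { isMonoid = record
              { isSemigroup = record
                { isMagma = record
                  { isEquivalence = record { refl = λ x → refl ; sym = λ e x → sym (e x) ; trans = λ e e′ x → trans (e x) (e′ x) }
                  ; ∙-cong = λ e e′ x → cong₂ _+_ (e x) (e′ x) }
                ; assoc = λ f g h x → ℤₚ.+-assoc (f x) (g x) (h x) }
              ; identity = (λ f x → ℤₚ.+-identityˡ (f x)) , (λ f x → ℤₚ.+-identityʳ (f x)) }
            ; inverse = (λ f x → ℤₚ.+-inverseˡ (f x)) , (λ f x → ℤₚ.+-inverseʳ (f x))
            ; ⁻¹-cong = λ e x → cong -_ (e x) }
          ; comm = λ f g x → ℤₚ.+-comm (f x) (g x) }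
        ; *-cong = λ e e′ x → ∑-cong E (λ w → cong₂ _*_ (e w) (e′ _))
        ; *-assoc = ⊛-assoc
        ; *-identity = ⊛-identityˡ , (λ f x → trans (⊛-comm f 𝟙 x) (⊛-identityˡ f x))
        ; distrib = distribˡ , (λ f g h x → trans (⊛-comm (λ w → g w + h w) f x) (trans (distribˡ f g h x) (cong₂ _+_ (⊛-comm f g x) (⊛-comm f h x)))) }
      ; *-comm = ⊛-comm } }
    where
    distribˡ : ∀ f g h x → (f ⊛ (λ w → g w + h w)) x ≡ (f ⊛ g) x + (f ⊛ h) x
    distribˡ f g h x = trans (∑-cong E (λ w → ℤₚ.*-distribˡ-+ (f w) _ _)) (∑-⊕ E _ _)

  -- For indicator functions this counts the ways to write x as an element of the first set divided
  -- by an element of the second.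
  corr : (X → ℤ) → (X → ℤ) → X → ℤ
  corr f h x = Σ* (λ w → f (x ∙ w) * h w)

  corr-⊛ : ∀ f h x → corr f h x ≡ (f ⊛ h *ᵍ) x
  corr-⊛ f h x = sym (trans (sym (Σ-transˡ x (λ w → f w * h (((w ⁻¹) ∙ x) ⁻¹))))
    (∑-cong E (λ w → cong (λ z → f (x ∙ w) * h z) (trans (cong _⁻¹ ([xy]⁻¹x x w)) (⁻¹-involutive w)))))

  corr-inv : ∀ f h x → corr f h (x ⁻¹) ≡ corr h f x
  corr-inv f h x = trans (sym (Σ-transˡ x (λ w → f ((x ⁻¹) ∙ w) * h w)))
    (∑-cong E (λ w → trans (cong (λ z → f z * h (x ∙ w)) (x⁻¹∙xy x w)) (ℤₚ.*-comm (f w) (h (x ∙ w)))))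

length-× : {A B : Set} (xs : List A) (ys : List B) → length (cartesianProduct xs ys) ≡ length xs ℕ.* length ys
length-× []       ys = refl
length-× (x ∷ xs) ys = trans (length-++ (map (x ,_) ys)) (cong₂ ℕ._+_ (length-map (x ,_) ys) (length-× xs ys))

∑-allFin : ∀ n (f : ℕ → ℤ) → ∑ (allFin n) (f ∘ toℕ) ≡ S n f
∑-allFin n f = go n id toℕ-shift
  where
  toℕ-shift : ∀ (i : Fin n) → f (toℕ i) ≡ f (toℕ i)
  toℕ-shift _ = refl
  go : ∀ m {k} (h : Fin m → Fin k) {g : Fin k → ℤ} {f : ℕ → ℤ} → (∀ i → g (h i) ≡ f (toℕ i)) → ∑ (tabulate h) g ≡ S m f
  go zero    h e = refl
  go (suc m) h {g} {f} e = trans (cong₂ _+_ (e Fin.zero) (go m (h ∘ Fin.suc) {g} {f ∘ suc} (λ i → e (Fin.suc i)))) (sym (S-head m f))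

-- Elementary abelian p-groups

module Elementary {X : Set} (F : Finite X) {_∙_ : X → X → X} {ε : X} {_⁻¹ : X → X}
                  (isAbelianGroup : IsAbelianGroup _≡_ _∙_ ε _⁻¹)
                  (p : ℕ) (pr : Prime p) (exponent : ∀ x → GroupSum._^_ F (IsAbelianGroup.isGroup isAbelianGroup) x p ≡ ε) where

  open AbelianSum F isAbelianGroup
  open PrimePeriod p pr

  ^-per : ∀ g l → g ^ (l ℕ.+ p) ≡ g ^ l
  ^-per g l = trans (^-+ g l p) (trans (cong ((g ^ l) ∙_) (exponent g)) (identityʳ _))

  ^-p* : ∀ g m → g ^ (m ℕ.* p) ≡ ε
  ^-p* g m = trans (sym (^-* g m p)) (trans (cong (_^ m) (exponent g)) (ε^ m))

  _∈⟨_⟩ : X → X → Set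
  x ∈⟨ g ⟩ = ∃ λ l → x ≡ g ^ l

  ∈⟨⟩-bounded : ∀ {x g} → x ∈⟨ g ⟩ → ∃ λ l → l ℕ.< p × x ≡ g ^ l
  ∈⟨⟩-bounded {x} {g} (l , e) = l ℕ/.% p , ℕ/.m%n<n l p ,
    trans e (trans (cong (g ^_) (ℕ/.m≡m%n+[m/n]*n l p))
            (trans (^-+ g (l ℕ/.% p) (l ℕ/./ p ℕ.* p)) (trans (cong ((g ^ (l ℕ/.% p)) ∙_) (^-p* g (l ℕ/./ p))) (identityʳ _))))

  _∈⟨_⟩? : ∀ x g → Dec (x ∈⟨ g ⟩)
  x ∈⟨ g ⟩? = map′ (λ { (l , _ , e) → l , e }) ∈⟨⟩-bounded (ℕₚ.anyUpTo? (λ l → x ≟ (g ^ l)) p)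

  ⁻¹-^ : ∀ g l → (g ^ l) ⁻¹ ≡ g ^ (l ℕ.* ℕ.pred p)
  ⁻¹-^ g l = sym (inverseʳ-unique (g ^ l) _ (trans (sym (^-+ g l (l ℕ.* ℕ.pred p)))
    (trans (cong (g ^_) (trans (sym (ℕₚ.*-suc l (ℕ.pred p))) (cong (l ℕ.*_) (ℕₚ.suc-pred p)))) (^-p* g l))))

  ∈⟨⟩-∙ : ∀ {x y g} → x ∈⟨ g ⟩ → y ∈⟨ g ⟩ → (x ∙ y) ∈⟨ g ⟩
  ∈⟨⟩-∙ {g = g} (l , refl) (m , refl) = l ℕ.+ m , sym (^-+ g l m)

  ∈⟨⟩-⁻¹ : ∀ {x g} → x ∈⟨ g ⟩ → (x ⁻¹) ∈⟨ g ⟩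
  ∈⟨⟩-⁻¹ {g = g} (l , refl) = l ℕ.* ℕ.pred p , ⁻¹-^ g l

  record Subgroup (H : X → Set) : Set where
    field
      H-ε  : H ε
      H-∙  : ∀ {x y} → H x → H y → H (x ∙ y)
      H-⁻¹ : ∀ {x} → H x → H (x ⁻¹)

    H-^ : ∀ {x} n → H x → H (x ^ n)
    H-^ zero    h = H-ε
    H-^ (suc n) h = H-∙ h (H-^ n h)

    -- The exponent l is invertible modulo p; Bézout presents g as a power of gˡ or as the inverse
    -- of one.
    H-root : ∀ {g l} → 0 ℕ.< l → l ℕ.< p → H (g ^ l) → H g
    H-root {g} {l@(suc _)} (s≤s z≤n) l<p h with coprime-Bézout (prime⇒coprime pr l<p)
    ... | Bézout.-+ x y eq = subst H (trans (^-* g y l) (trans (cong (g ^_) (sym eq)) (trans (cong (g ∙_) (^-p* g x)) (identityʳ g)))) (H-^ y h)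
    ... | Bézout.+- x y eq = subst H (trans (cong _⁻¹ (^-* g y l)) (sym (inverseˡ-unique g (g ^ (y ℕ.* l)) (trans (cong (g ^_) eq) (^-p* g x))))) (H-⁻¹ (H-^ y h))

  open Subgroup

  cyclic : ∀ g → Subgroup (_∈⟨ g ⟩)
  cyclic g = record { H-ε = 0 , refl ; H-∙ = ∈⟨⟩-∙ ; H-⁻¹ = ∈⟨⟩-⁻¹ }

  trivial : Subgroup (_≡ ε)
  trivial = record { H-ε = refl ; H-∙ = λ { refl refl → identityˡ ε } ; H-⁻¹ = λ { refl → ε⁻¹≈ε } }

  S-⟨⟩-shift : ∀ g (f : X → ℤ) s → S p (λ l → f ((g ^ l) ∙ (g ^ s))) ≡ S p (λ l → f (g ^ l))
  S-⟨⟩-shift g f s = trans (∑-cong (upTo p) (λ l → cong f (sym (^-+ g l s)))) (S-shift s (λ l → cong f (^-per g l)))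

  S-⟨⟩-inv : ∀ g (f : X → ℤ) → S p (λ l → f ((g ^ l) ⁻¹)) ≡ S p (λ l → f (g ^ l))
  S-⟨⟩-inv g f = trans (S-cong< p (λ l l<p → cong f (sym (inverseʳ-unique (g ^ l) (g ^ (p ℕ.∸ l))
      (trans (sym (^-+ g l (p ℕ.∸ l))) (trans (cong (g ^_) (ℕₚ.m+[n∸m]≡n (ℕₚ.<⇒≤ l<p))) (exponent g)))))))
    (S-neg {f = λ l → f (g ^ l)} (λ l → cong f (^-per g l)))

  private
    gap : ∀ {H} → Subgroup H → ∀ {y} → ¬ H y → ∀ {i j u v} → i ℕ.< j → j ℕ.< p → H u → H v →
          (y ^ i) ∙ u ≢ (y ^ j) ∙ v
    gap {H} sub {y} y∉H {i} {j} {u} {v} l j<p hu hv e =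
      y∉H (H-root sub (ℕₚ.m<n⇒0<n∸m l) (ℕₚ.≤-<-trans (ℕₚ.m∸n≤m j i) j<p) (subst H eq (H-∙ sub hu (H-⁻¹ sub hv))))
      where
      e′ : u ≡ (y ^ (j ℕ.∸ i)) ∙ v
      e′ = ∙-cancelˡ (y ^ i) u _ (trans e (trans (cong (λ k → (y ^ k) ∙ v) (sym (ℕₚ.m+[n∸m]≡n (ℕₚ.<⇒≤ l)))) (trans (cong (_∙ v) (^-+ y i (j ℕ.∸ i))) (assoc _ _ _))))
      eq : u ∙ (v ⁻¹) ≡ y ^ (j ℕ.∸ i)
      eq = trans (cong (_∙ (v ⁻¹)) e′) (yx∙x⁻¹ v (y ^ (j ℕ.∸ i)))

  ^-injective : ∀ {H} → Subgroup H → ∀ {y} → ¬ H y → ∀ {i j u v} → i ℕ.< p → j ℕ.< p → H u → H v →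
                (y ^ i) ∙ u ≡ (y ^ j) ∙ v → i ≡ j
  ^-injective sub y∉H {i} {j} i<p j<p hu hv e with ℕₚ.<-cmp i j
  ... | tri≈ _ eq _ = eq
  ... | tri< l _ _ = contradiction e (gap sub y∉H l j<p hu hv)
  ... | tri> _ _ l = contradiction (sym e) (gap sub y∉H l i<p hv hu)

  -- The p² products yʲgⁱ with i, j < p are distinct, so in a group of order p² they are all the
  -- elements.
  module Coordinates (size² : length (elems F) ≡ p ℕ.* p) {y g : X} (y∉⟨g⟩ : ¬ (y ∈⟨ g ⟩)) (g≢ε : g ≢ ε) where

    private
      φ : Fin p × Fin p → X
      φ (j , i) = (y ^ toℕ j) ∙ (g ^ toℕ i)

    coord-injˡ : ∀ {j j′ i i′} → j ℕ.< p → j′ ℕ.< p → (y ^ j) ∙ (g ^ i) ≡ (y ^ j′) ∙ (g ^ i′) → j ≡ j′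
    coord-injˡ {i = i} {i′} j<p j′<p = ^-injective (cyclic g) y∉⟨g⟩ j<p j′<p (i , refl) (i′ , refl)

    coord-injʳ : ∀ {i i′} → i ℕ.< p → i′ ℕ.< p → g ^ i ≡ g ^ i′ → i ≡ i′
    coord-injʳ i<p i′<p e = ^-injective trivial g≢ε i<p i′<p refl refl (cong (_∙ ε) e)

    private
      φ-inj : ∀ {u v} → φ u ≡ φ v → u ≡ v
      φ-inj {j , i} {j′ , i′} e with Finₚ.toℕ-injective (coord-injˡ {i = toℕ i} {toℕ i′} (Finₚ.toℕ<n j) (Finₚ.toℕ<n j′) e)
      ... | refl = cong (j ,_) (Finₚ.toℕ-injective (coord-injʳ (Finₚ.toℕ<n i) (Finₚ.toℕ<n i′) (∙-cancelˡ (y ^ toℕ j) _ _ e)))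
      ys : List X
      ys = map φ (cartesianProduct (allFin p) (allFin p))
      ys-unique : Unique ys
      ys-unique = map⁺ φ-inj (cartesianProduct⁺ (allFin⁺ p) (allFin⁺ p))
      ys-length : length ys ≡ length (elems F)
      ys-length = trans (length-map φ (cartesianProduct (allFin p) (allFin p))) (trans (length-× (allFin p) (allFin p))
        (trans (cong₂ ℕ._*_ (length-tabulate {n = p} id) (length-tabulate {n = p} id)) (sym size²)))

    Σ-coord : (f : X → ℤ) → Σ* f ≡ S p (λ j → S p (λ i → f ((y ^ j) ∙ (g ^ i))))
    Σ-coord f = begin
      Σ* f                                                    ≡⟨ ∑-relist ys-unique ys-length f ⟨
      ∑ ys f                                                  ≡⟨ ∑-map φ (cartesianProduct (allFin p) (allFin p)) f ⟩
      ∑ (cartesianProduct (allFin p) (allFin p)) (f ∘ φ)      ≡⟨ ∑-× (allFin p) (allFin p) (f ∘ φ) ⟩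
      ∑ (allFin p) (λ j → ∑ (allFin p) (λ i → f (φ (j , i)))) ≡⟨ ∑-cong (allFin p) (λ j → ∑-allFin p (λ i → f ((y ^ toℕ j) ∙ (g ^ i)))) ⟩
      ∑ (allFin p) (λ j → S p (λ i → f ((y ^ toℕ j) ∙ (g ^ i)))) ≡⟨ ∑-allFin p (λ j → S p (λ i → f ((y ^ j) ∙ (g ^ i)))) ⟩
      S p (λ j → S p (λ i → f ((y ^ j) ∙ (g ^ i))))           ∎
      where open ≡-Reasoning

    coord : ∀ x → ∃₂ λ j i → j ℕ.< p × i ℕ.< p × x ≡ (y ^ j) ∙ (g ^ i)
    coord x with ∈-map⁻ φ (relist-∈ ys-unique ys-length x)
    ... | (j , i) , _ , e = toℕ j , toℕ i , Finₚ.toℕ<n j , Finₚ.toℕ<n i , e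

    -- The push-forward of f to the quotient by ⟨g⟩, which is generated by y.
    project : (X → ℤ) → ℕ → ℤ
    project f j = S p (λ i → f ((y ^ j) ∙ (g ^ i)))

    project-per : ∀ f → Per (project f)
    project-per f j = ∑-cong (upTo p) (λ i → cong (λ z → f (z ∙ (g ^ i))) (^-per y j))

    Σ-project : ∀ f → S p (project f) ≡ Σ* f
    Σ-project f = sym (Σ-coord f)

    -- Passing to the quotient by ⟨g⟩ is a ring homomorphism on group rings; this is its form for
    -- correlations.
    project-corr : ∀ f h m n → Corr (project f) (project h) m n ≡ S p (λ l → corr f h (((y ^ m) ∙ ((y ^ n) ⁻¹)) ∙ (g ^ l)))
    project-corr f h m n = begin
      S p (λ j → project f (j ℕ.+ m) * project h (j ℕ.+ n))
        ≡⟨ ∑-cong (upTo p) (λ j → ∑-*-∑ (upTo p) (upTo p) (λ l → f ((y ^ (j ℕ.+ m)) ∙ (g ^ l))) (λ i → h ((y ^ (j ℕ.+ n)) ∙ (g ^ i)))) ⟩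
      S p (λ j → S p (λ l → S p (λ i → f ((y ^ (j ℕ.+ m)) ∙ (g ^ l)) * h ((y ^ (j ℕ.+ n)) ∙ (g ^ i)))))
        ≡⟨ ∑-cong (upTo p) (λ j → ∑-swap (upTo p) (upTo p) _) ⟩
      S p (λ j → S p (λ i → S p (λ l → f ((y ^ (j ℕ.+ m)) ∙ (g ^ l)) * h ((y ^ (j ℕ.+ n)) ∙ (g ^ i)))))
        ≡⟨ ∑-cong (upTo p) (λ j → ∑-cong (upTo p) (λ i → S-⟨⟩-shift g (λ z → f ((y ^ (j ℕ.+ m)) ∙ z) * h ((y ^ (j ℕ.+ n)) ∙ (g ^ i))) i)) ⟨
      S p (λ j → S p (λ i → S p (λ l → f ((y ^ (j ℕ.+ m)) ∙ ((g ^ l) ∙ (g ^ i))) * h ((y ^ (j ℕ.+ n)) ∙ (g ^ i)))))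
        ≡⟨ ∑-cong (upTo p) (λ j → ∑-cong (upTo p) (λ i → ∑-cong (upTo p) (λ l → cong₂ (λ u v → f u * h v) (arrange j l i) (arrange′ j i)))) ⟩
      S p (λ j → S p (λ i → S p (λ l → f (((y ^ m) ∙ (g ^ l)) ∙ ((y ^ j) ∙ (g ^ i))) * h ((y ^ n) ∙ ((y ^ j) ∙ (g ^ i))))))
        ≡⟨ Σ-coord (λ w → S p (λ l → f (((y ^ m) ∙ (g ^ l)) ∙ w) * h ((y ^ n) ∙ w))) ⟨
      Σ* (λ w → S p (λ l → f (((y ^ m) ∙ (g ^ l)) ∙ w) * h ((y ^ n) ∙ w)))
        ≡⟨ ∑-swap (elems F) (upTo p) _ ⟩
      S p (λ l → Σ* (λ w → f (((y ^ m) ∙ (g ^ l)) ∙ w) * h ((y ^ n) ∙ w)))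
        ≡⟨ ∑-cong (upTo p) (λ l → trans (∑-cong (elems F) (λ w → cong (λ z → f z * h ((y ^ n) ∙ w)) (reposition l w))) (Σ-transˡ (y ^ n) (λ w → f ((((y ^ m) ∙ ((y ^ n) ⁻¹)) ∙ (g ^ l)) ∙ w) * h w))) ⟩
      S p (λ l → corr f h (((y ^ m) ∙ ((y ^ n) ⁻¹)) ∙ (g ^ l))) ∎
      where
      open ≡-Reasoning
      arrange : ∀ j l i → (y ^ (j ℕ.+ m)) ∙ ((g ^ l) ∙ (g ^ i)) ≡ ((y ^ m) ∙ (g ^ l)) ∙ ((y ^ j) ∙ (g ^ i))
      arrange j l i = trans (cong (_∙ ((g ^ l) ∙ (g ^ i))) (trans (^-+ y j m) (comm _ _))) (interchange (y ^ m) (y ^ j) (g ^ l) (g ^ i))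
      arrange′ : ∀ j i → (y ^ (j ℕ.+ n)) ∙ (g ^ i) ≡ (y ^ n) ∙ ((y ^ j) ∙ (g ^ i))
      arrange′ j i = trans (cong (_∙ (g ^ i)) (trans (^-+ y j n) (comm _ _))) (assoc _ _ _)
      reposition : ∀ l w → ((y ^ m) ∙ (g ^ l)) ∙ w ≡ (((y ^ m) ∙ ((y ^ n) ⁻¹)) ∙ (g ^ l)) ∙ ((y ^ n) ∙ w)
      reposition l w = sym (begin
        (((y ^ m) ∙ ((y ^ n) ⁻¹)) ∙ (g ^ l)) ∙ ((y ^ n) ∙ w)   ≡⟨ cong (_∙ ((y ^ n) ∙ w)) (trans (assoc _ _ _) (trans (cong ((y ^ m) ∙_) (comm _ _)) (sym (assoc _ _ _)))) ⟩
        (((y ^ m) ∙ (g ^ l)) ∙ ((y ^ n) ⁻¹)) ∙ ((y ^ n) ∙ w)   ≡⟨ assoc _ _ _ ⟩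
        ((y ^ m) ∙ (g ^ l)) ∙ (((y ^ n) ⁻¹) ∙ ((y ^ n) ∙ w))   ≡⟨ cong (((y ^ m) ∙ (g ^ l)) ∙_) (x⁻¹∙xy (y ^ n) w) ⟩
        ((y ^ m) ∙ (g ^ l)) ∙ w                                ∎)

-- The abelian group P of order p²

[]-∧ : ∀ b c → [ b ∧ c ] ≡ [ b ] * [ c ]
[]-∧ true  c = sym (ℤₚ.*-identityˡ [ c ])
[]-∧ false c = refl

z²≡z⇒z≤1 : ∀ z → z * z ≡ z → z ≤ 1ℤ
z²≡z⇒z≤1 z e = [ (λ r → subst (_≤ 1ℤ) (sym r) (+≤+ z≤n)) , (λ r → ℤₚ.≤-reflexive (ℤₚ.i-j≡0⇒i≡j z 1ℤ r)) ]′
  (ℤₚ.i*j≡0⇒i≡0∨j≡0 z (trans (lem z) (trans (cong (_- z) e) (ℤₚ.+-inverseʳ z))))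
  where
  lem : ∀ z → z * (z - 1ℤ) ≡ z * z - z
  lem = solve-∀

*-≥0 : ∀ {a b} → 0ℤ ≤ a → 0ℤ ≤ b → 0ℤ ≤ a * b
*-≥0 {+ a} {+ b} _ _ = subst (0ℤ ≤_) (ℤₚ.pos-* a b) (+≤+ z≤n)

module Setup {X : Set} (F : Finite X) {_∙_ : X → X → X} {ε : X} {_⁻¹ : X → X}
  (isAbelianGroup : IsAbelianGroup _≡_ _∙_ ε _⁻¹)
  (p : ℕ) (pr : Prime p) (m : ℕ) (p-odd : p ≡ 1 ℕ.+ 2 ℕ.* m)
  (size² : length (elems F) ≡ p ℕ.* p)
  (N : X → Bool) (N-ε : N ε ≡ true)
  (N-∙ : ∀ {x y} → N x ≡ true → N y ≡ true → N (x ∙ y) ≡ true)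
  (N-⁻¹ : ∀ {x} → N x ≡ true → N (x ⁻¹) ≡ true)
  (ΣN : FiniteSum.Σ* F (λ x → [ N x ]) ≡ + p)
  where

  open AbelianSum F isAbelianGroup
  open PrimePeriod p pr using (*-cancel-p)

  private
    E : List X
    E = elems F

  -- The coefficients of the prescribed value of U + V; the summand 2 - 2 at the identity leaves 2p
  -- there.
  κ : X → ℤ
  κ x = (+ 2 * + p * δ x ε + + 2) - + 2 * [ N x ]

  N-inv : ∀ x → N (x ⁻¹) ≡ N x
  N-inv x with N x in eq | N (x ⁻¹) in eq′
  ... | true  | true  = refl
  ... | false | false = refl
  ... | true  | false = trans (sym eq′) (N-⁻¹ eq)
  ... | false | true  = sym (trans (sym eq) (trans (cong N (sym (⁻¹-involutive x))) (N-⁻¹ eq′)))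

  module Transversal (A : X → Bool)
    (off-N : ∀ n → N n ≡ true → n ≢ ε → corr ([_] ∘ A) ([_] ∘ A) n ≡ 0ℤ) where

    private
      a : X → ℤ
      a x = [ A x ]

    AN : X → ℤ
    AN x = Σ* (λ n → [ N n ] * a (x ∙ n))

    private
      apart : ∀ x n k → n ≢ k → N n ≡ true → N k ≡ true → a (x ∙ n) * a (x ∙ k) ≡ 0ℤ
      apart x n k n≢k n∈N k∈N = trans (cong (λ z → a z * a (x ∙ k)) (sym eq))
        (∑-zero⁻ (λ w → *-≥0 (0≤[] (A ((n ∙ (k ⁻¹)) ∙ w))) (0≤[] (A w)))
                 (off-N (n ∙ (k ⁻¹)) (N-∙ n∈N (N-⁻¹ k∈N)) (λ e → n≢k (trans (inverseˡ-unique n (k ⁻¹) e) (⁻¹-involutive k))))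
                 (complete (x ∙ k)))
        where
        eq : (n ∙ (k ⁻¹)) ∙ (x ∙ k) ≡ x ∙ n
        eq = trans (cong ((n ∙ (k ⁻¹)) ∙_) (comm x k)) (trans (assoc n (k ⁻¹) (k ∙ x)) (trans (cong (n ∙_) (x⁻¹∙xy k x)) (comm n x)))

      cross : ∀ x n k → k ≢ n → ([ N n ] * a (x ∙ n)) * ([ N k ] * a (x ∙ k)) ≡ 0ℤ
      cross x n k k≢n = go (N n) (N k) refl refl
        where
        shuffle : ∀ u v → (1ℤ * u) * (1ℤ * v) ≡ u * v
        shuffle = solve-∀
        z₁ : ∀ u v w → (0ℤ * u) * (v * w) ≡ 0ℤ
        z₁ = solve-∀
        z₂ : ∀ u v w → (v * u) * (0ℤ * w) ≡ 0ℤ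
        z₂ = solve-∀
        go : ∀ b c → N n ≡ b → N k ≡ c → ([ b ] * a (x ∙ n)) * ([ c ] * a (x ∙ k)) ≡ 0ℤ
        go false c _ _ = z₁ (a (x ∙ n)) [ c ] (a (x ∙ k))
        go true false _ _ = z₂ (a (x ∙ n)) 1ℤ (a (x ∙ k))
        go true true n∈N k∈N = trans (shuffle (a (x ∙ n)) (a (x ∙ k))) (apart x n k (k≢n ∘ sym) n∈N k∈N)

      -- If xn and xk with n ≠ k in N both lay in A, then nk⁻¹ would be a quotient of elements of A
      -- inside N, against `off-N`. So only diagonal terms survive in the square, and a coset of N
      -- contains at most one element of A.
      AN² : ∀ x → AN x * AN x ≡ AN x
      AN² x = trans (∑-*-∑ E E _ _) (∑-cong E (λ n → trans (∑-at F n (λ k k≢n → cross x n k k≢n)) (idem (N n) (A (x ∙ n)))))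
        where
        idem : ∀ b c → ([ b ] * [ c ]) * ([ b ] * [ c ]) ≡ [ b ] * [ c ]
        idem b c = subst (λ z → z * z ≡ z) ([]-∧ b c) ([]-idem (b ∧ c))

    AN≤1 : ∀ x → AN x ≤ 1ℤ
    AN≤1 x = z²≡z⇒z≤1 (AN x) (AN² x)

    ΣAN : Σ* AN ≡ + p * Σ* a
    ΣAN = begin
      Σ* AN                                              ≡⟨ ∑-swap E E (λ x n → [ N n ] * a (x ∙ n)) ⟩
      Σ* (λ n → Σ* (λ x → [ N n ] * a (x ∙ n)))          ≡⟨ ∑-cong E (λ n → trans (∑-*ˡ E [ N n ] (λ x → a (x ∙ n))) (cong ([ N n ] *_) (Σ-transʳ n a))) ⟩
      Σ* (λ n → [ N n ] * Σ* a)                          ≡⟨ ∑-*ʳ E (Σ* a) (λ n → [ N n ]) ⟩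
      Σ* (λ n → [ N n ]) * Σ* a                          ≡⟨ cong (_* Σ* a) ΣN ⟩
      + p * Σ* a                                         ∎
      where open ≡-Reasoning

  -- Products of group elements and the exponent of P

  module Products where
    open ListSum (AbelianGroup.isCommutativeMonoid abelianGroup) public using ()
      renaming (∑ to ∏; ∑-cong to ∏-cong; ∑-zero to ∏-ε; ∑-⊕ to ∏-∙; ∑-swap to ∏-swap; ∑-reindex to ∏-reindex)

    sel : Bool → X → X
    sel true  x = x
    sel false x = ε

    sel-∙ : ∀ b x y → sel b (x ∙ y) ≡ sel b x ∙ sel b y
    sel-∙ true  x y = refl
    sel-∙ false x y = sym (identityˡ ε)

    cnt : List X → (X → Bool) → ℕ
    cnt []       b = 0
    cnt (x ∷ xs) b with b x
    ... | true  = suc (cnt xs b)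
    ... | false = cnt xs b

    +cnt : ∀ xs b → + cnt xs b ≡ ∑ xs (λ x → [ b x ])
    +cnt []       b = refl
    +cnt (x ∷ xs) b with b x
    ... | true  = cong (_+_ 1ℤ) (+cnt xs b)
    ... | false = trans (+cnt xs b) (sym (ℤₚ.+-identityˡ _))

    ∏-sel : ∀ xs b z → ∏ xs (λ x → sel (b x) z) ≡ z ^ cnt xs b
    ∏-sel []       b z = refl
    ∏-sel (x ∷ xs) b z with b x
    ... | true  = cong (z ∙_) (∏-sel xs b z)
    ... | false = trans (identityˡ _) (∏-sel xs b z)

    ∏-translate : ∀ g (f : X → X) → ∏ E (λ x → f (g ∙ x)) ≡ ∏ E f
    ∏-translate g = ∏-reindex F (g ∙_) ((g ⁻¹) ∙_) (x∙x⁻¹y g) (x⁻¹∙xy g)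

    -- Translation by g permutes P, so the product of all elements is unchanged when each is
    -- multiplied by g.
    ^-size : ∀ g → g ^ length E ≡ ε
    ^-size g = ∙-cancelʳ (∏ E id) _ _ (trans (sym (trans (∏-∙ E (λ _ → g) id) (cong (_∙ ∏ E id) (const E)))) (trans (∏-translate g id) (sym (identityˡ _))))
      where
      const : ∀ xs → ∏ xs (λ _ → g) ≡ g ^ length xs
      const []       = refl
      const (x ∷ xs) = cong (g ∙_) (const xs)

    cnt≡ : ∀ b k → Σ* (λ x → [ b x ]) ≡ + k → cnt E b ≡ k
    cnt≡ b k e = ℤₚ.+-injective (trans (+cnt E b) e)

    sel-^ : ∀ b z k → + k ≡ [ b ] → z ^ k ≡ sel b z
    sel-^ true  z (suc zero) e = identityʳ z
    sel-^ false z zero       e = refl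

    ∏N : X
    ∏N = ∏ E (λ n → sel (N n) n)

    -- Inversion permutes N, so one of the two factors may be replaced by the product of the
    -- inverses.
    ∏N² : ∏N ∙ ∏N ≡ ε
    ∏N² = trans (cong (∏N ∙_) (trans (sym (∏-reindex F _⁻¹ _⁻¹ ⁻¹-involutive ⁻¹-involutive (λ n → sel (N n) n)))
                                     (∏-cong E (λ n → cong (λ b → sel b (n ⁻¹)) (N-inv n)))))
          (trans (sym (∏-∙ E (λ n → sel (N n) n) (λ n → sel (N n) (n ⁻¹))))
                 (∏-ε E (λ n → trans (sym (sel-∙ (N n) n (n ⁻¹))) (sel-inv (N n) n))))
      where
      sel-inv : ∀ b n → sel b (n ∙ (n ⁻¹)) ≡ ε
      sel-inv true  n = inverseʳ n
      sel-inv false n = refl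

    ∏-coset : ∀ g → ∏ E (λ z → sel (N ((g ⁻¹) ∙ z)) z) ≡ (g ^ p) ∙ ∏N
    ∏-coset g = begin
      ∏ E (λ z → sel (N ((g ⁻¹) ∙ z)) z)              ≡⟨ ∏-translate g (λ z → sel (N ((g ⁻¹) ∙ z)) z) ⟨
      ∏ E (λ n → sel (N ((g ⁻¹) ∙ (g ∙ n))) (g ∙ n))  ≡⟨ ∏-cong E (λ n → trans (cong (λ z → sel (N z) (g ∙ n)) (x⁻¹∙xy g n)) (sel-∙ (N n) g n)) ⟩
      ∏ E (λ n → sel (N n) g ∙ sel (N n) n)           ≡⟨ ∏-∙ E (λ n → sel (N n) g) (λ n → sel (N n) n) ⟩
      ∏ E (λ n → sel (N n) g) ∙ ∏N                    ≡⟨ cong (_∙ ∏N) (trans (∏-sel E N g) (cong (g ^_) (cnt≡ N p ΣN))) ⟩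
      (g ^ p) ∙ ∏N                                    ∎
      where open ≡-Reasoning

    -- For g in N the coset gN is N, and `∏-coset` compares the two products.
    N-exponent : ∀ g → N g ≡ true → g ^ p ≡ ε
    N-exponent g g∈N = ∙-cancelʳ ∏N _ _ (trans (sym (∏-coset g)) (trans (∏-cong E (λ z → cong (λ b → sel b z) (same z))) (sym (identityˡ ∏N))))
      where
      same : ∀ z → N ((g ⁻¹) ∙ z) ≡ N z
      same z with N z in eq | N ((g ⁻¹) ∙ z) in eq′
      ... | true  | true  = refl
      ... | false | false = refl
      ... | true  | false = trans (sym eq′) (N-∙ (N-⁻¹ g∈N) eq)
      ... | false | true  = sym (trans (sym eq) (trans (cong N (sym (x∙x⁻¹y g z))) (N-∙ g∈N eq′)))

    -- The quotients a b⁻¹ ∈ gN of elements a, b of a transversal of N are counted by the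
    -- correlation; each element occurs once as numerator and once as denominator.
    module Quotients (A : X → Bool) (AN≡1 : ∀ x → Σ* (λ n → [ N n ] * [ A (x ∙ n) ]) ≡ 1ℤ) (g : X) where

      C : X → Bool
      C z = N ((g ⁻¹) ∙ z)

      c : X → ℕ
      c z = cnt E (λ y → A (z ∙ y) ∧ (A y ∧ C z))

      +c : ∀ z → + c z ≡ [ C z ] * corr ([_] ∘ A) ([_] ∘ A) z
      +c z = trans (+cnt E _) (trans (∑-cong E (λ y → trans ([]-∧ (A (z ∙ y)) _) (trans (cong ([ A (z ∙ y) ] *_) ([]-∧ (A y) (C z))) (lem [ A (z ∙ y) ] [ A y ] [ C z ]))))
             (∑-*ˡ E [ C z ] (λ y → [ A (z ∙ y) ] * [ A y ])))
        where
        lem : ∀ u v w → u * (v * w) ≡ w * (u * v)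
        lem = solve-∀

      private
        w : X → X → Bool
        w x y = A x ∧ (A y ∧ C (x ∙ (y ⁻¹)))

        [w] : ∀ x y → [ w x y ] ≡ [ A x ] * ([ A y ] * [ C (x ∙ (y ⁻¹)) ])
        [w] x y = trans ([]-∧ (A x) _) (cong ([ A x ] *_) ([]-∧ (A y) _))

        row : ∀ x → Σ* (λ y → [ w x y ]) ≡ [ A x ]
        row x = begin
          Σ* (λ y → [ w x y ])                                        ≡⟨ ∑-cong E ([w] x) ⟩
          Σ* (λ y → [ A x ] * ([ A y ] * [ C (x ∙ (y ⁻¹)) ]))         ≡⟨ ∑-*ˡ E [ A x ] _ ⟩
          [ A x ] * Σ* (λ y → [ A y ] * [ C (x ∙ (y ⁻¹)) ])           ≡⟨ cong ([ A x ] *_) (sym (Σ-transˡ ((g ⁻¹) ∙ x) (λ y → [ A y ] * [ C (x ∙ (y ⁻¹)) ]))) ⟩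
          [ A x ] * Σ* (λ n → [ A (((g ⁻¹) ∙ x) ∙ n) ] * [ C (x ∙ ((((g ⁻¹) ∙ x) ∙ n) ⁻¹)) ]) ≡⟨ cong ([ A x ] *_) (∑-cong E (λ n → trans (ℤₚ.*-comm [ A (((g ⁻¹) ∙ x) ∙ n) ] _) (cong (λ b → [ b ] * [ A (((g ⁻¹) ∙ x) ∙ n) ]) (trans (cong N (eq n)) (N-inv n))))) ⟩
          [ A x ] * Σ* (λ n → [ N n ] * [ A (((g ⁻¹) ∙ x) ∙ n) ])     ≡⟨ cong ([ A x ] *_) (AN≡1 ((g ⁻¹) ∙ x)) ⟩
          [ A x ] * 1ℤ                                                ≡⟨ ℤₚ.*-identityʳ [ A x ] ⟩
          [ A x ]                                                     ∎
          where
          open ≡-Reasoning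
          eq : ∀ n → (g ⁻¹) ∙ (x ∙ ((((g ⁻¹) ∙ x) ∙ n) ⁻¹)) ≡ n ⁻¹
          eq n = trans (sym (assoc _ _ _)) (trans (comm _ _) ([xy]⁻¹x ((g ⁻¹) ∙ x) n))

        column : ∀ y → Σ* (λ x → [ w x y ]) ≡ [ A y ]
        column y = begin
          Σ* (λ x → [ w x y ])                                        ≡⟨ ∑-cong E (λ x → trans ([w] x y) (lem [ A x ] [ A y ] [ C (x ∙ (y ⁻¹)) ])) ⟩
          Σ* (λ x → [ A y ] * ([ C (x ∙ (y ⁻¹)) ] * [ A x ]))         ≡⟨ ∑-*ˡ E [ A y ] _ ⟩
          [ A y ] * Σ* (λ x → [ C (x ∙ (y ⁻¹)) ] * [ A x ])           ≡⟨ cong ([ A y ] *_) (sym (Σ-transˡ (g ∙ y) (λ x → [ C (x ∙ (y ⁻¹)) ] * [ A x ]))) ⟩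
          [ A y ] * Σ* (λ n → [ C (((g ∙ y) ∙ n) ∙ (y ⁻¹)) ] * [ A ((g ∙ y) ∙ n) ]) ≡⟨ cong ([ A y ] *_) (∑-cong E (λ n → cong (λ z → [ N z ] * [ A ((g ∙ y) ∙ n) ]) (eq n))) ⟩
          [ A y ] * Σ* (λ n → [ N n ] * [ A ((g ∙ y) ∙ n) ])          ≡⟨ cong ([ A y ] *_) (AN≡1 (g ∙ y)) ⟩
          [ A y ] * 1ℤ                                                ≡⟨ ℤₚ.*-identityʳ [ A y ] ⟩
          [ A y ]                                                     ∎
          where
          open ≡-Reasoning
          lem : ∀ u v w → u * (v * w) ≡ v * (w * u)
          lem = solve-∀
          eq : ∀ n → (g ⁻¹) ∙ (((g ∙ y) ∙ n) ∙ (y ⁻¹)) ≡ n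
          eq n = trans (cong (λ z → (g ⁻¹) ∙ (z ∙ (y ⁻¹))) (trans (assoc g y n) (trans (cong (g ∙_) (comm y n)) (sym (assoc g n y)))))
                       (trans (cong ((g ⁻¹) ∙_) (yx∙x⁻¹ y (g ∙ n))) (x⁻¹∙xy g n))

      ∏-quotients : ∏ E (λ z → z ^ c z) ≡ ε
      ∏-quotients = begin
        ∏ E (λ z → z ^ c z)                                                 ≡⟨ ∏-cong E (λ z → sym (∏-sel E (λ y → A (z ∙ y) ∧ (A y ∧ C z)) z)) ⟩
        ∏ E (λ z → ∏ E (λ y → sel (A (z ∙ y) ∧ (A y ∧ C z)) z))             ≡⟨ ∏-swap E E _ ⟩
        ∏ E (λ y → ∏ E (λ z → sel (A (z ∙ y) ∧ (A y ∧ C z)) z))             ≡⟨ ∏-cong E (λ y → ∏-cong E (λ z → cong (λ u → sel (A (z ∙ y) ∧ (A y ∧ C u)) u) (sym (yx∙x⁻¹ y z)))) ⟩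
        ∏ E (λ y → ∏ E (λ z → sel (w (z ∙ y) y) ((z ∙ y) ∙ (y ⁻¹))))        ≡⟨ ∏-cong E (λ y → ∏-reindex F (_∙ y) (_∙ (y ⁻¹)) (yx⁻¹∙x y) (yx∙x⁻¹ y) (λ x → sel (w x y) (x ∙ (y ⁻¹)))) ⟩
        ∏ E (λ y → ∏ E (λ x → sel (w x y) (x ∙ (y ⁻¹))))                    ≡⟨ ∏-cong E (λ y → trans (∏-cong E (λ x → sel-∙ (w x y) x (y ⁻¹))) (∏-∙ E (λ x → sel (w x y) x) (λ x → sel (w x y) (y ⁻¹)))) ⟩
        ∏ E (λ y → ∏ E (λ x → sel (w x y) x) ∙ ∏ E (λ x → sel (w x y) (y ⁻¹))) ≡⟨ ∏-∙ E (λ y → ∏ E (λ x → sel (w x y) x)) (λ y → ∏ E (λ x → sel (w x y) (y ⁻¹))) ⟩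
        ∏ E (λ y → ∏ E (λ x → sel (w x y) x)) ∙ ∏ E (λ y → ∏ E (λ x → sel (w x y) (y ⁻¹)))
          ≡⟨ cong₂ _∙_ (trans (∏-swap E E (λ y x → sel (w x y) x)) (∏-cong E (λ x → trans (∏-sel E (w x) x) (sel-^ (A x) x _ (trans (+cnt E (w x)) (row x))))))
                       (∏-cong E (λ y → trans (∏-sel E (λ x → w x y) (y ⁻¹)) (sel-^ (A y) (y ⁻¹) _ (trans (+cnt E (λ x → w x y)) (column y))))) ⟩
        ∏ E (λ x → sel (A x) x) ∙ ∏ E (λ x → sel (A x) (x ⁻¹))              ≡⟨ ∏-∙ E (λ x → sel (A x) x) (λ x → sel (A x) (x ⁻¹)) ⟨
        ∏ E (λ x → sel (A x) x ∙ sel (A x) (x ⁻¹))                          ≡⟨ ∏-ε E (λ x → inv (A x) x) ⟩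
        ε                                                                   ∎
        where
        open ≡-Reasoning
        inv : ∀ b x → sel b x ∙ sel b (x ⁻¹) ≡ ε
        inv true  x = inverseʳ x
        inv false x = identityˡ ε

  module Raw (A B : X → Bool)
    (autocorr : ∀ x → corr ([_] ∘ A) ([_] ∘ A) x + corr ([_] ∘ B) ([_] ∘ B) x ≡ κ x)
    (total : Σ* ([_] ∘ A) + Σ* ([_] ∘ B) ≡ + 2 * + p) where

    a b U V : X → ℤ
    a x = [ A x ]
    b x = [ B x ]
    U = corr a a
    V = corr b b

    U≥0 : ∀ x → 0ℤ ≤ U x
    U≥0 x = ∑-≥0 E (λ w → *-≥0 (0≤[] (A (x ∙ w))) (0≤[] (A w)))

    V≥0 : ∀ x → 0ℤ ≤ V x
    V≥0 x = ∑-≥0 E (λ w → *-≥0 (0≤[] (B (x ∙ w))) (0≤[] (B w)))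

    κ-N : ∀ {x} → N x ≡ true → x ≢ ε → κ x ≡ 0ℤ
    κ-N {x} n x≢ε = trans (cong₂ (λ d b → (+ 2 * + p * d + + 2) - + 2 * [ b ]) (δ-≢ x≢ε) n) (lem (+ p))
      where
      lem : ∀ q → (+ 2 * q * 0ℤ + + 2) - + 2 * 1ℤ ≡ 0ℤ
      lem = solve-∀

    κ-∉N : ∀ {x} → N x ≡ false → κ x ≡ + 2
    κ-∉N {x} n = trans (cong₂ (λ d b → (+ 2 * + p * d + + 2) - + 2 * [ b ]) (δ-≢ x≢ε) n) (lem (+ p))
      where
      x≢ε : x ≢ ε
      x≢ε refl with () ← trans (sym n) N-ε
      lem : ∀ q → (+ 2 * q * 0ℤ + + 2) - + 2 * 0ℤ ≡ + 2
      lem = solve-∀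

    U-N : ∀ n → N n ≡ true → n ≢ ε → U n ≡ 0ℤ
    U-N n n∈N n≢ε = proj₁ (0≤+⇒ (U≥0 n) (V≥0 n) (trans (autocorr n) (κ-N n∈N n≢ε)))

    V-N : ∀ n → N n ≡ true → n ≢ ε → V n ≡ 0ℤ
    V-N n n∈N n≢ε = proj₂ (0≤+⇒ (U≥0 n) (V≥0 n) (trans (autocorr n) (κ-N n∈N n≢ε)))

    private
      module TA = Transversal A U-N
      module TB = Transversal B V-N

      -- A coset of N contains at most one element of A and at most one of B. Summed over P the two
      -- counts give p(|A| + |B|) = 2p², so both bounds are attained everywhere.
      both : ∀ x → TA.AN x + TB.AN x ≡ + 2
      both x = ∑-tight {g = λ _ → + 2} (λ x → ℤₚ.+-mono-≤ (TA.AN≤1 x) (TB.AN≤1 x)) (begin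
        Σ* (λ x → TA.AN x + TB.AN x)        ≡⟨ ∑-⊕ E TA.AN TB.AN ⟩
        Σ* TA.AN + Σ* TB.AN                 ≡⟨ cong₂ _+_ TA.ΣAN TB.ΣAN ⟩
        + p * Σ* a + + p * Σ* b             ≡⟨ ℤₚ.*-distribˡ-+ (+ p) (Σ* a) (Σ* b) ⟨
        + p * (Σ* a + Σ* b)                 ≡⟨ cong (+ p *_) total ⟩
        + p * (+ 2 * + p)                   ≡⟨ lem (+ p) ⟩
        (+ p * + p) * + 2                   ≡⟨ cong (_* + 2) (trans (sym (ℤₚ.pos-* p p)) (cong +_ (sym size²))) ⟩
        size * + 2                          ≡⟨ ∑-const E (+ 2) ⟨
        Σ* (λ _ → + 2)                      ∎) (complete x)
        where
        open ≡-Reasoning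
        lem : ∀ q → q * (+ 2 * q) ≡ (q * q) * + 2
        lem = solve-∀

      extremal : ∀ {u v} → u ≤ 1ℤ → v ≤ 1ℤ → u + v ≡ + 2 → u ≡ 1ℤ
      extremal {u} {v} u≤1 v≤1 e = ℤₚ.≤-antisym u≤1 (subst (1ℤ ≤_) (trans (cong (_- v) (sym e)) (lem u v))
        (ℤₚ.+-monoʳ-≤ (+ 2) (ℤₚ.neg-mono-≤ v≤1)))
        where
        lem : ∀ u v → (u + v) - v ≡ u
        lem = solve-∀

    A-transversal : ∀ x → Σ* (λ n → [ N n ] * a (x ∙ n)) ≡ 1ℤ
    A-transversal x = extremal (TA.AN≤1 x) (TB.AN≤1 x) (both x)

    B-transversal : ∀ x → Σ* (λ n → [ N n ] * b (x ∙ n)) ≡ 1ℤ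
    B-transversal x = extremal (TB.AN≤1 x) (TA.AN≤1 x) (trans (ℤₚ.+-comm (TB.AN x) (TA.AN x)) (both x))

    Σa : Σ* a ≡ + p
    Σa = *-cancel-p (trans (sym TA.ΣAN) (trans (∑-cong E A-transversal) (trans Σ-one (trans (cong +_ size²) (ℤₚ.pos-* p p)))))

    Σb : Σ* b ≡ + p
    Σb = *-cancel-p (trans (sym TB.ΣAN) (trans (∑-cong E B-transversal) (trans Σ-one (trans (cong +_ size²) (ℤₚ.pos-* p p)))))

    open Products

    private
      -- Every z in gN is a quotient U z + V z = 2 times in all, so the product of all these
      -- quotients is the square of the product over gN, namely (gᵖ ∏N)² = g²ᵖ. By `∏-quotients` it
      -- is trivial.
      double : ∀ g → N g ≡ false → (g ^ p) ∙ (g ^ p) ≡ ε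
      double g g∉N = begin
        (g ^ p) ∙ (g ^ p)                               ≡⟨ identityʳ _ ⟨
        ((g ^ p) ∙ (g ^ p)) ∙ ε                         ≡⟨ cong (((g ^ p) ∙ (g ^ p)) ∙_) (sym ∏N²) ⟩
        ((g ^ p) ∙ (g ^ p)) ∙ (∏N ∙ ∏N)                 ≡⟨ interchange (g ^ p) (g ^ p) ∏N ∏N ⟩
        ((g ^ p) ∙ ∏N) ∙ ((g ^ p) ∙ ∏N)                 ≡⟨ cong₂ _∙_ (∏-coset g) (∏-coset g) ⟨
        ∏ E (λ z → sel (QA.C z) z) ∙ ∏ E (λ z → sel (QA.C z) z)     ≡⟨ ∏-∙ E (λ z → sel (QA.C z) z) (λ z → sel (QA.C z) z) ⟨
        ∏ E (λ z → sel (QA.C z) z ∙ sel (QA.C z) z)     ≡⟨ ∏-cong E (λ z → trans (sq (QA.C z) z (QA.c z ℕ.+ QB.c z) (c+c z)) (^-+ z (QA.c z) (QB.c z))) ⟩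
        ∏ E (λ z → (z ^ QA.c z) ∙ (z ^ QB.c z))         ≡⟨ ∏-∙ E (λ z → z ^ QA.c z) (λ z → z ^ QB.c z) ⟩
        ∏ E (λ z → z ^ QA.c z) ∙ ∏ E (λ z → z ^ QB.c z) ≡⟨ cong₂ _∙_ QA.∏-quotients QB.∏-quotients ⟩
        ε ∙ ε                                           ≡⟨ identityˡ ε ⟩
        ε                                               ∎
        where
        open ≡-Reasoning
        module QA = Quotients A A-transversal g
        module QB = Quotients B B-transversal g
        sq : ∀ b z k → + k ≡ [ b ] * + 2 → sel b z ∙ sel b z ≡ z ^ k
        sq true  z (suc (suc zero)) e = cong (z ∙_) (sym (identityʳ z))
        sq false z zero e = identityˡ ε
        c+c : ∀ z → + (QA.c z ℕ.+ QB.c z) ≡ [ QA.C z ] * + 2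
        c+c z = trans (cong₂ _+_ (QA.+c z) (QB.+c z)) (trans (sym (ℤₚ.*-distribˡ-+ [ QA.C z ] (U z) (V z))) (trans (cong ([ QA.C z ] *_) (autocorr z)) (on-coset (QA.C z) refl)))
          where
          on-coset : ∀ b → QA.C z ≡ b → [ b ] * κ z ≡ [ b ] * + 2
          on-coset false _ = trans (ℤₚ.*-zeroˡ (κ z)) refl
          on-coset true  e = cong (1ℤ *_) (κ-∉N (z∉N (N z) refl))
            where
            z∉N : ∀ c → N z ≡ c → N z ≡ false
            z∉N false eq = eq
            z∉N true  eq with () ← trans (sym (trans (cong N (trans (sym (⁻¹-involutive g)) (cong _⁻¹ (sym (yx∙x⁻¹ z (g ⁻¹)))))) (N-⁻¹ (N-∙ e (N-⁻¹ eq))))) g∉N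

    -- Outside N the order of g divides both 2p and p² = 2pm + p, hence p.
    exponent : ∀ g → g ^ p ≡ ε
    exponent g = go (N g) refl
      where
      open ≡-Reasoning
      go : ∀ b → N g ≡ b → g ^ p ≡ ε
      go true  n = N-exponent g n
      go false n = begin
        g ^ p                                ≡⟨ identityˡ (g ^ p) ⟨
        ε ∙ (g ^ p)                          ≡⟨ cong (_∙ (g ^ p)) (sym (trans (cong (_^ m) (trans (^-+ g p p) (double g n))) (ε^ m))) ⟩
        ((g ^ (p ℕ.+ p)) ^ m) ∙ (g ^ p)      ≡⟨ cong (_∙ (g ^ p)) (^-* g m (p ℕ.+ p)) ⟩
        (g ^ (m ℕ.* (p ℕ.+ p))) ∙ (g ^ p)    ≡⟨ ^-+ g (m ℕ.* (p ℕ.+ p)) p ⟨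
        g ^ (m ℕ.* (p ℕ.+ p) ℕ.+ p)          ≡⟨ cong (g ^_) (trans (lem m p) (trans (cong (ℕ._* p) (sym p-odd)) (sym size²))) ⟩
        g ^ length E                         ≡⟨ ^-size g ⟩
        ε                                    ∎
        where
        lem : ∀ m p → m ℕ.* (p ℕ.+ p) ℕ.+ p ≡ (1 ℕ.+ 2 ℕ.* m) ℕ.* p
        lem = ℕ-solve-∀

-- Identities in the group ring and the energy of correlations

module RingIdentities (R : CommutativeRing 0ℓ 0ℓ) where

  private
    ring : ACR.AlmostCommutativeRing 0ℓ 0ℓ
    ring = ACR.fromCommutativeRing R (λ _ → nothing)
  open ACR.AlmostCommutativeRing ring using (_≈_) renaming (_+_ to _⊞_; _*_ to _⊠_)

  four-fold : ∀ a a′ b b′ → (a ⊠ b′) ⊠ (a′ ⊠ b) ≈ (a ⊠ a′) ⊠ (b ⊠ b′)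
  four-fold = RingTactic.solve-∀ ring

  -- Read * as inversion and the hat as σ. The four bracketed sums are the P-part and the t-part of
  -- RR⁻¹ and their σ-images, hence known; the factors b̂*â and a*b on the left make up the t-part
  -- of R⁻¹R.
  cross-identity : ∀ a a* â â* b b* b̂ b̂* →
    (b̂* ⊠ â) ⊠ ((a ⊠ a*) ⊞ (b ⊠ b*)) ⊞ (a* ⊠ b) ⊠ ((â ⊠ â*) ⊞ (b̂ ⊠ b̂*))
      ≈ (â ⊠ a*) ⊠ ((a ⊠ b̂*) ⊞ (b ⊠ â*)) ⊞ (b ⊠ b̂*) ⊠ ((b* ⊠ â) ⊞ (a* ⊠ b̂))
  cross-identity = RingTactic.solve-∀ ring

search : {X : Set} (F : Finite X) (q : X → Bool) → (∃ λ x → q x ≡ true) ⊎ (∀ x → q x ≡ false)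
search F q = [ inj₁ , (λ h → inj₂ (λ x → h (Finite.complete F x))) ]′ (go (elems F))
  where
  go : ∀ xs → (∃ λ x → q x ≡ true) ⊎ (∀ {x} → x ∈ xs → q x ≡ false)
  go []       = inj₂ λ ()
  go (x ∷ xs) with q x in eq
  ... | true  = inj₁ (x , eq)
  ... | false = [ inj₁ , (λ h → inj₂ λ { (here refl) → eq ; (there i) → h i }) ]′ (go xs)

S-≥0< : ∀ n {f : ℕ → ℤ} → (∀ j → j ℕ.< n → 0ℤ ≤ f j) → 0ℤ ≤ S n f
S-≥0< zero    h = +≤+ z≤n
S-≥0< (suc n) {f} h = subst (0ℤ ≤_) (sym (S-last n f)) (ℤₚ.+-mono-≤ (S-≥0< n (λ j l → h j (ℕₚ.m<n⇒m<1+n l))) (h n ℕₚ.≤-refl))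

S-zero⁻ : ∀ n {f : ℕ → ℤ} → (∀ j → j ℕ.< n → 0ℤ ≤ f j) → S n f ≡ 0ℤ → ∀ j → j ℕ.< n → f j ≡ 0ℤ
S-zero⁻ (suc n) {f} h e j j<1+n with ℕₚ.m≤n⇒m<n∨m≡n (ℕ.s≤s⁻¹ j<1+n)
... | inj₁ j<n  = S-zero⁻ n (λ j l → h j (ℕₚ.m<n⇒m<1+n l)) (proj₁ (0≤+⇒ (S-≥0< n (λ j l → h j (ℕₚ.m<n⇒m<1+n l))) (h n ℕₚ.≤-refl) (trans (sym (S-last n f)) e))) j j<n
... | inj₂ refl = proj₂ (0≤+⇒ (S-≥0< n (λ j l → h j (ℕₚ.m<n⇒m<1+n l))) (h n ℕₚ.≤-refl) (trans (sym (S-last n f)) e))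

S-tight : ∀ n {f g : ℕ → ℤ} → (∀ j → j ℕ.< n → f j ≤ g j) → S n f ≡ S n g → ∀ j → j ℕ.< n → f j ≡ g j
S-tight n {f} {g} h e j l = sym (ℤₚ.i-j≡0⇒i≡j (g j) (f j) (S-zero⁻ n (λ j l → ℤₚ.i≤j⇒0≤j-i (h j l))
  (trans (∑-- (upTo n) g f) (trans (cong (λ z → S n g - z) e) (ℤₚ.+-inverseʳ (S n g)))) j l))

S-pred : ∀ p .{{_ : ℕ.NonZero p}} (f : ℕ → ℤ) → S p f ≡ f 0 + S (ℕ.pred p) (f ∘ suc)
S-pred (suc n) f = S-head n f

S-single0 : ∀ p .{{_ : ℕ.NonZero p}} (f : ℕ → ℤ) → (∀ l → 0 ℕ.< l → l ℕ.< p → f l ≡ 0ℤ) → S p f ≡ f 0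
S-single0 (suc n) f h = trans (S-head n f) (trans (cong (_+_ (f 0)) (trans (S-cong< n (λ j l → h (suc j) (s≤s z≤n) (s≤s l))) (trans (S-const n 0ℤ) (ℤₚ.*-zeroʳ (+ n))))) (ℤₚ.+-identityʳ (f 0)))

module SequenceEnergy (p : ℕ) where
  open Periodic p

  S-Corr : ∀ {f g} → Per f → S p (λ i → Corr f g i 0) ≡ S p f * S p g
  S-Corr {f} {g} pf = begin
    S p (λ i → S p (λ j → f (j ℕ.+ i) * g (j ℕ.+ 0)))   ≡⟨ ∑-swap (upTo p) (upTo p) _ ⟩
    S p (λ j → S p (λ i → f (j ℕ.+ i) * g (j ℕ.+ 0)))   ≡⟨ ∑-cong (upTo p) (λ j → trans (∑-*ʳ (upTo p) (g (j ℕ.+ 0)) (λ i → f (j ℕ.+ i)))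
                                                             (cong₂ _*_ (trans (∑-cong (upTo p) (λ i → cong f (ℕₚ.+-comm j i))) (S-shift j pf)) (cong g (ℕₚ.+-identityʳ j)))) ⟩
    S p (λ j → S p f * g j)                             ≡⟨ ∑-*ˡ (upTo p) (S p f) g ⟩
    S p f * S p g                                       ∎
    where open ≡-Reasoning

  -- Both sides are the coefficient at 0 of (g f̄)(f ḡ) = (f f̄)(g ḡ).
  S-Corr² : ∀ {f g} → Per f → Per g →
            S p (λ i → Corr g f i 0 * Corr g f i 0) ≡ S p (λ i → Corr f f i 0 * Corr g g i 0)
  S-Corr² {f} {g} pf pg = begin
    S p (λ i → Corr g f i 0 * Corr g f i 0)
      ≡⟨ ∑-cong (upTo p) (λ i → ∑-*-∑ (upTo p) (upTo p) (λ j → g (j ℕ.+ i) * f (j ℕ.+ 0)) (λ l → g (l ℕ.+ i) * f (l ℕ.+ 0))) ⟩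
    S p (λ i → S p (λ j → S p (λ l → (g (j ℕ.+ i) * f (j ℕ.+ 0)) * (g (l ℕ.+ i) * f (l ℕ.+ 0)))))
      ≡⟨ ∑-swap (upTo p) (upTo p) _ ⟩
    S p (λ j → S p (λ i → S p (λ l → (g (j ℕ.+ i) * f (j ℕ.+ 0)) * (g (l ℕ.+ i) * f (l ℕ.+ 0)))))
      ≡⟨ ∑-cong (upTo p) (λ j → ∑-swap (upTo p) (upTo p) _) ⟩
    S p (λ j → S p (λ l → S p (λ i → (g (j ℕ.+ i) * f (j ℕ.+ 0)) * (g (l ℕ.+ i) * f (l ℕ.+ 0)))))
      ≡⟨ ∑-cong (upTo p) (λ j → ∑-cong (upTo p) (λ l → trans (∑-cong (upTo p) (λ i → regroup j l i)) (∑-*ˡ (upTo p) (f j * f l) _))) ⟩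
    S p (λ j → S p (λ l → H j l))
      ≡⟨ ∑-swap (upTo p) (upTo p) H ⟩
    S p (λ l → S p (λ j → H j l))
      ≡⟨ ∑-cong (upTo p) (λ l → S-shift {f = λ j → H j l} l (λ j → cong₂ _*_ (cong (_* f l) (pf j)) (∑-cong (upTo p) (λ i → cong (_* g (i ℕ.+ l)) (trans (cong g (sym (ℕₚ.+-assoc i j p))) (pg (i ℕ.+ j))))))) ⟨
    S p (λ l → S p (λ i → H (i ℕ.+ l) l))
      ≡⟨ ∑-cong (upTo p) (λ l → ∑-cong (upTo p) (λ i → cong₂ _*_ (cong₂ (λ u v → f u * f v) (ℕₚ.+-comm i l) (sym (ℕₚ.+-identityʳ l))) (translate i l))) ⟩
    S p (λ l → S p (λ i → (f (l ℕ.+ i) * f (l ℕ.+ 0)) * Corr g g i 0))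
      ≡⟨ ∑-swap (upTo p) (upTo p) _ ⟩
    S p (λ i → S p (λ l → (f (l ℕ.+ i) * f (l ℕ.+ 0)) * Corr g g i 0))
      ≡⟨ ∑-cong (upTo p) (λ i → ∑-*ʳ (upTo p) (Corr g g i 0) (λ l → f (l ℕ.+ i) * f (l ℕ.+ 0))) ⟩
    S p (λ i → Corr f f i 0 * Corr g g i 0) ∎
    where
    open ≡-Reasoning
    H : ℕ → ℕ → ℤ
    H j l = (f j * f l) * Corr g g j l
    shuffle : ∀ a b c d → (a * b) * (c * d) ≡ (b * d) * (a * c)
    shuffle = solve-∀
    regroup : ∀ j l i → (g (j ℕ.+ i) * f (j ℕ.+ 0)) * (g (l ℕ.+ i) * f (l ℕ.+ 0)) ≡ (f j * f l) * (g (i ℕ.+ j) * g (i ℕ.+ l))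
    regroup j l i = trans (shuffle (g (j ℕ.+ i)) (f (j ℕ.+ 0)) (g (l ℕ.+ i)) (f (l ℕ.+ 0)))
      (cong₂ _*_ (cong₂ (λ u v → f u * f v) (ℕₚ.+-identityʳ j) (ℕₚ.+-identityʳ l)) (cong₂ (λ u v → g u * g v) (ℕₚ.+-comm j i) (ℕₚ.+-comm l i)))
    translate : ∀ i l → Corr g g (i ℕ.+ l) l ≡ Corr g g i 0
    translate i l = trans (∑-cong (upTo p) (λ j → cong₂ (λ u v → g u * g v) (exch j i l) (sym (ℕₚ.+-identityʳ (j ℕ.+ l)))))
      (S-shift {f = λ j → g (j ℕ.+ i) * g (j ℕ.+ 0)} l (λ j → cong₂ _*_ (Per-shift i pg j) (Per-shift 0 pg j)))
      where
      exch : ∀ j i l → j ℕ.+ (i ℕ.+ l) ≡ j ℕ.+ l ℕ.+ i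
      exch = ℕ-solve-∀

-- P with the involution σ

module Twisted {X : Set} (F : Finite X) {_∙_ : X → X → X} {ε : X} {_⁻¹ : X → X}
  (isAbelianGroup : IsAbelianGroup _≡_ _∙_ ε _⁻¹)
  (p : ℕ) (pr : Prime p) (m : ℕ) (p-odd : p ≡ 1 ℕ.+ 2 ℕ.* m)
  (size² : length (elems F) ≡ p ℕ.* p)
  (N : X → Bool) (N-ε : N ε ≡ true)
  (N-∙ : ∀ {x y} → N x ≡ true → N y ≡ true → N (x ∙ y) ≡ true)
  (N-⁻¹ : ∀ {x} → N x ≡ true → N (x ⁻¹) ≡ true)
  (ΣN : FiniteSum.Σ* F (λ x → [ N x ]) ≡ + p)
  (σ : X → X) (σ-∙ : ∀ x y → σ (x ∙ y) ≡ σ x ∙ σ y) (σσ : ∀ x → σ (σ x) ≡ x)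
  (exponent : ∀ x → GroupSum._^_ F (IsAbelianGroup.isGroup isAbelianGroup) x p ≡ ε)
  where

  open AbelianSum F isAbelianGroup
  open PrimePeriod p pr
  open Setup F isAbelianGroup p pr m p-odd size² N N-ε N-∙ N-⁻¹ ΣN
  open Elementary F isAbelianGroup p pr exponent

  private
    E : List X
    E = elems F
    ν : X → ℤ
    ν x = [ N x ]

  2∣p-1 : + 2 ∣ + p - 1ℤ
  2∣p-1 = divides (+ m) (trans (cong (λ z → + z - 1ℤ) p-odd) (trans (cong (λ z → (1ℤ + z) - 1ℤ) (ℤₚ.pos-* 2 m)) (lem (+ m))))
    where
    lem : ∀ z → (1ℤ + + 2 * z) - 1ℤ ≡ z * + 2
    lem = solve-∀

  1<p : 1 ℕ.< p
  1<p = subst (1 ℕ.<_) (sym p-odd) (s≤s (ℕₚ.*-mono-≤ {1} {2} {1} {m} (s≤s z≤n) (0<m m p-odd)))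
    where
    0<m : ∀ k → p ≡ 1 ℕ.+ 2 ℕ.* k → 1 ℕ.≤ k
    0<m zero e = contradiction (subst Prime e pr) ¬prime[1]
    0<m (suc k) e = s≤s z≤n

  σ-ε : σ ε ≡ ε
  σ-ε = ∙-cancelˡ (σ ε) (σ ε) ε (trans (sym (σ-∙ ε ε)) (trans (cong σ (identityˡ ε)) (sym (identityʳ (σ ε)))))

  σ-⁻¹ : ∀ x → σ (x ⁻¹) ≡ (σ x) ⁻¹
  σ-⁻¹ x = inverseʳ-unique (σ x) (σ (x ⁻¹)) (trans (sym (σ-∙ x (x ⁻¹))) (trans (cong σ (inverseʳ x)) σ-ε))

  σ-^ : ∀ x n → σ (x ^ n) ≡ (σ x) ^ n
  σ-^ x zero    = σ-ε
  σ-^ x (suc n) = trans (σ-∙ x (x ^ n)) (cong (σ x ∙_) (σ-^ x n))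

  Σ-σ : (f : X → ℤ) → Σ* (f ∘ σ) ≡ Σ* f
  Σ-σ = ∑-reindex F σ σ σσ σσ

  corr-σ : ∀ f h x → corr (f ∘ σ) (h ∘ σ) x ≡ corr f h (σ x)
  corr-σ f h x = trans (∑-cong E (λ w → cong (λ z → f z * h (σ w)) (σ-∙ x w))) (Σ-σ (λ w → f (σ x ∙ w) * h w))

  N-subgroup : Subgroup (λ x → N x ≡ true)
  N-subgroup = record { H-ε = N-ε ; H-∙ = N-∙ ; H-⁻¹ = N-⁻¹ }

  ∉N : ∀ {x} → N x ≡ false → ¬ (N x ≡ true)
  ∉N e e′ with () ← trans (sym e) e′

  ∉N⇒≢ε : ∀ {x} → N x ≡ false → x ≢ ε
  ∉N⇒≢ε e refl = ∉N e N-ε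

  N-generator : ∃ λ y → N y ≡ true × y ≢ ε
  N-generator = [ (λ { (y , e) → y , split (N y) (does (y ≟ ε)) refl refl e }) , (λ h → ⊥-elim (all-trivial h)) ]′ (search F (λ x → N x ∧ not (does (x ≟ ε))))
    where
    split : ∀ {y} b c → N y ≡ b → does (y ≟ ε) ≡ c → b ∧ not c ≡ true → N y ≡ true × y ≢ ε
    split {y} true false n d _ = n , λ e → contradiction (trans (sym d) (dec-true (y ≟ ε) e)) λ ()
    all-trivial : (∀ x → N x ∧ not (does (x ≟ ε)) ≡ false) → ⊥
    all-trivial h = ℕₚ.<⇒≢ 1<p (ℤₚ.+-injective (trans (sym (trans (∑-at F ε (λ x x≢ε → off x x≢ε)) (cong [_] N-ε))) ΣN))
      where
      off : ∀ x → x ≢ ε → ν x ≡ 0ℤ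
      off x x≢ε = cong [_] (go (N x) (trans (cong (λ b → N x ∧ not b) (sym (dec-false (x ≟ ε) x≢ε))) (h x)))
        where
        go : ∀ b → b ∧ true ≡ false → b ≡ false
        go false e = refl

  outside-N : ∃ λ h → N h ≡ false
  outside-N = [ (λ { (h , e) → h , flip (N h) e }) , (λ h → ⊥-elim (full h)) ]′ (search F (not ∘ N))
    where
    flip : ∀ b → not b ≡ true → b ≡ false
    flip false _ = refl
    full : (∀ x → not (N x) ≡ false) → ⊥
    full h = ℕₚ.<⇒≢ 1<p (sym (ℕₚ.*-cancelˡ-≡ p 1 p (sym (trans (ℕₚ.*-identityʳ p) (ℤₚ.+-injective (trans (sym ΣN) (trans (∑-cong E (λ x → cong [_] (go (N x) (h x)))) (trans Σ-one (cong +_ size²)))))))))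
      where
      go : ∀ b → not b ≡ false → b ≡ true
      go true _ = refl

  ⟨⟩∩N : ∀ {g l} → N g ≡ false → 0 ℕ.< l → l ℕ.< p → N (g ^ l) ≡ false
  ⟨⟩∩N {g} {l} g∉N 0<l l<p with N (g ^ l) in eq
  ... | false = refl
  ... | true  = contradiction (Subgroup.H-root N-subgroup 0<l l<p eq) (∉N g∉N)

  N∌⟨⟩ : ∀ {g y} → N g ≡ false → N y ≡ true → y ≢ ε → ¬ (y ∈⟨ g ⟩)
  N∌⟨⟩ {g} g∉N y∈N y≢ε y∈g with ∈⟨⟩-bounded y∈g
  ... | zero  , _ , e = y≢ε e
  ... | suc l , l<p , e = ∉N (⟨⟩∩N g∉N (s≤s z≤n) l<p) (trans (cong N (sym e)) y∈N)

  module Coset (g : X) where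

    ⟪_⟫ : (X → ℤ) → X → ℤ
    ⟪ f ⟫ x = S p (λ l → f (x ∙ (g ^ l)))

    ⟪⟫-shift : ∀ f x {k} → k ∈⟨ g ⟩ → ⟪ f ⟫ (x ∙ k) ≡ ⟪ f ⟫ x
    ⟪⟫-shift f x (s , refl) = trans (∑-cong (upTo p) (λ l → cong f (trans (assoc x (g ^ s) (g ^ l)) (cong (x ∙_) (comm (g ^ s) (g ^ l))))))
      (S-⟨⟩-shift g (λ z → f (x ∙ z)) s)

    ⟪⟫-flip : ∀ f x → S p (λ l → f (x ∙ ((g ^ l) ⁻¹))) ≡ ⟪ f ⟫ x
    ⟪⟫-flip f x = S-⟨⟩-inv g (λ z → f (x ∙ z))

    ⟪⟫-inv : ∀ f x → S p (λ l → f ((x ∙ (g ^ l)) ⁻¹)) ≡ ⟪ f ⟫ (x ⁻¹)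
    ⟪⟫-inv f x = trans (∑-cong (upTo p) (λ l → cong f (sym (⁻¹-∙-comm x (g ^ l))))) (⟪⟫-flip f (x ⁻¹))

    ⟪⟫-σ : σ g ≡ g ⊎ σ g ≡ g ⁻¹ → ∀ f x → ⟪ f ∘ σ ⟫ x ≡ ⟪ f ⟫ (σ x)
    ⟪⟫-σ (inj₁ e) f x = ∑-cong (upTo p) (λ l → cong f (trans (σ-∙ x (g ^ l)) (cong (σ x ∙_) (trans (σ-^ g l) (cong (_^ l) e)))))
    ⟪⟫-σ (inj₂ e) f x = trans (∑-cong (upTo p) (λ l → cong f (trans (σ-∙ x (g ^ l)) (cong (σ x ∙_) (trans (σ-^ g l) (trans (cong (_^ l) e) (inv-^ l)))))))
                              (⟪⟫-flip f (σ x))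
      where
      inv-^ : ∀ l → (g ⁻¹) ^ l ≡ (g ^ l) ⁻¹
      inv-^ l = inverseʳ-unique (g ^ l) ((g ⁻¹) ^ l) (trans (sym (^-∙ g (g ⁻¹) l)) (trans (cong (_^ l) (inverseʳ g)) (ε^ l)))

  -- A nontrivial y in N lies outside ⟨g⟩, so every coset of ⟨g⟩ contains a power yʲ; among the
  -- products yʲgˡ only the one with l = 0 is in N.
  N-meets-coset : ∀ {g} → N g ≡ false → ∀ x → Coset.⟪_⟫ g ν x ≡ 1ℤ
  N-meets-coset {g} g∉N x = go (coord x)
    where
    y = proj₁ N-generator
    y∈N = proj₁ (proj₂ N-generator)
    open Coset g
    open Coordinates size² (N∌⟨⟩ g∉N y∈N (proj₂ (proj₂ N-generator))) (∉N⇒≢ε g∉N)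
    base : ∀ j → ⟪ ν ⟫ (y ^ j) ≡ 1ℤ
    base j = trans (S-single0 p (λ l → ν ((y ^ j) ∙ (g ^ l))) (λ l 0<l l<p → cong [_] (out l 0<l l<p)))
                   (cong [_] (trans (cong N (identityʳ (y ^ j))) (Subgroup.H-^ N-subgroup j y∈N)))
      where
      out : ∀ l → 0 ℕ.< l → l ℕ.< p → N ((y ^ j) ∙ (g ^ l)) ≡ false
      out l 0<l l<p with N ((y ^ j) ∙ (g ^ l)) in eq
      ... | false = refl
      ... | true  = contradiction (trans (cong N (sym (x⁻¹∙xy (y ^ j) (g ^ l)))) (N-∙ (N-⁻¹ (Subgroup.H-^ N-subgroup j y∈N)) eq)) (∉N (⟨⟩∩N g∉N 0<l l<p))
    go : (∃₂ λ j i → j ℕ.< p × i ℕ.< p × x ≡ (y ^ j) ∙ (g ^ i)) → ⟪ ν ⟫ x ≡ 1ℤ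
    go (j , i , _ , _ , e) = trans (cong ⟪ ν ⟫ e) (trans (⟪⟫-shift ν (y ^ j) (i , refl)) (base j))

  -- Since N meets each coset of ⟨g⟩ once, the image of κ in the quotient is 2p times the identity
  -- plus the constant 2p - 2.
  κ-coset : ∀ {g} → N g ≡ false → ∀ x →
            Coset.⟪_⟫ g κ x ≡ + 2 * + p * S p (λ l → δ (x ∙ (g ^ l)) ε) + (+ 2 * + p - + 2)
  κ-coset {g} g∉N x = begin
    S p (λ l → (+ 2 * + p * δl l + + 2) - + 2 * ν (x ∙ (g ^ l)))
      ≡⟨ ∑-- (upTo p) (λ l → + 2 * + p * δl l + + 2) (λ l → + 2 * ν (x ∙ (g ^ l))) ⟩
    S p (λ l → + 2 * + p * δl l + + 2) - S p (λ l → + 2 * ν (x ∙ (g ^ l)))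
      ≡⟨ cong₂ _-_ (trans (∑-⊕ (upTo p) (λ l → + 2 * + p * δl l) (λ _ → + 2)) (cong₂ _+_ (∑-*ˡ (upTo p) (+ 2 * + p) δl) (S-const p (+ 2))))
                   (trans (∑-*ˡ (upTo p) (+ 2) (λ l → ν (x ∙ (g ^ l)))) (cong (+ 2 *_) (N-meets-coset g∉N x))) ⟩
    (+ 2 * + p * S p δl + + p * + 2) - + 2 * 1ℤ
      ≡⟨ lem (+ p) (+ 2 * + p * S p δl) ⟩
    + 2 * + p * S p δl + (+ 2 * + p - + 2) ∎
    where
    open ≡-Reasoning
    δl : ℕ → ℤ
    δl l = δ (x ∙ (g ^ l)) ε
    lem : ∀ r d → (d + r * + 2) - + 2 * 1ℤ ≡ d + (+ 2 * r - + 2)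
    lem = solve-∀

  ⊛-σ : ∀ f h x → (f ⊛ h) (σ x) ≡ ((f ∘ σ) ⊛ (h ∘ σ)) x
  ⊛-σ f h x = trans (sym (Σ-σ (λ w → f w * h ((w ⁻¹) ∙ σ x))))
    (∑-cong E (λ w → cong (λ z → f (σ w) * h z) (trans (cong (_∙ σ x) (sym (σ-⁻¹ w))) (sym (σ-∙ (w ⁻¹) x)))))

  ⊛-symmetric : ∀ f h → (∀ x → h (x ⁻¹) ≡ h x) → ∀ x → (f ⊛ h) x ≡ Σ* (λ n → h n * f (x ∙ n))
  ⊛-symmetric f h sym-h x = trans (⊛-comm f h x) (trans (sym (Σ-inv (λ w → h w * f ((w ⁻¹) ∙ x))))
    (∑-cong E (λ n → cong₂ _*_ (sym-h n) (cong f (trans (cong (_∙ x) (⁻¹-involutive n)) (comm n x))))))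

  ⊛-cong : ∀ {f f′ h h′ : X → ℤ} → (∀ x → f x ≡ f′ x) → (∀ x → h x ≡ h′ x) → ∀ x → (f ⊛ h) x ≡ (f′ ⊛ h′) x
  ⊛-cong = CommutativeRing.*-cong groupRing

  Σ-corr : ∀ f h → Σ* (corr f h) ≡ Σ* f * Σ* h
  Σ-corr f h = trans (∑-swap E E (λ x w → f (x ∙ w) * h w))
    (trans (∑-cong E (λ w → trans (∑-*ʳ E (h w) (λ x → f (x ∙ w))) (cong (_* h w) (Σ-transʳ w f)))) (∑-*ˡ E (Σ* f) h))

  -- With μ the indicator of σN this is κ ∘ σ, as `κ-σ` shows.
  κ-like : (X → ℤ) → X → ℤ
  κ-like μ x = (+ 2 * + p * δ x ε + + 2) - + 2 * μ x

  ⊛-κ : ∀ f μ x → (f ⊛ κ-like μ) x ≡ (+ 2 * + p * f x + + 2 * Σ* f) - + 2 * (f ⊛ μ) x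
  ⊛-κ f μ x = begin
    Σ* (λ w → f w * κ-like μ ((w ⁻¹) ∙ x))
      ≡⟨ ∑-cong E (λ w → lem (f w) (+ p) (δ ((w ⁻¹) ∙ x) ε) (μ ((w ⁻¹) ∙ x))) ⟩
    Σ* (λ w → (+ 2 * + p * (f w * δ ((w ⁻¹) ∙ x) ε) + + 2 * f w) - + 2 * (f w * μ ((w ⁻¹) ∙ x)))
      ≡⟨ trans (∑-- E (λ w → + 2 * + p * (f w * δ ((w ⁻¹) ∙ x) ε) + + 2 * f w) (λ w → + 2 * (f w * μ ((w ⁻¹) ∙ x))))
               (cong₂ _-_ (trans (∑-⊕ E (λ w → + 2 * + p * (f w * δ ((w ⁻¹) ∙ x) ε)) (λ w → + 2 * f w)) (cong₂ _+_ (∑-*ˡ E (+ 2 * + p) (λ w → f w * δ ((w ⁻¹) ∙ x) ε)) (∑-*ˡ E (+ 2) f)))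
                          (∑-*ˡ E (+ 2) (λ w → f w * μ ((w ⁻¹) ∙ x)))) ⟩
    (+ 2 * + p * (f ⊛ 𝟙) x + + 2 * Σ* f) - + 2 * (f ⊛ μ) x
      ≡⟨ cong (λ z → (+ 2 * + p * z + + 2 * Σ* f) - + 2 * (f ⊛ μ) x) (trans (⊛-comm f 𝟙 x) (⊛-identityˡ f x)) ⟩
    (+ 2 * + p * f x + + 2 * Σ* f) - + 2 * (f ⊛ μ) x ∎
    where
    open ≡-Reasoning
    lem : ∀ f q d u → f * ((+ 2 * q * d + + 2) - + 2 * u) ≡ (+ 2 * q * (f * d) + + 2 * f) - + 2 * (f * u)
    lem = solve-∀

  κ-σ : ∀ x → κ (σ x) ≡ κ-like (ν ∘ σ) x
  κ-σ x = cong (λ d → (+ 2 * + p * d + + 2) - + 2 * ν (σ x)) (δ-σ (x ≟ ε))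
    where
    δ-σ : Dec (x ≡ ε) → δ (σ x) ε ≡ δ x ε
    δ-σ (yes refl) = trans (cong (λ z → δ z ε) σ-ε) refl
    δ-σ (no n)     = trans (δ-≢ (λ e → n (trans (sym (σσ x)) (trans (cong σ e) σ-ε)))) (sym (δ-≢ n))

  ν-inv : ∀ x → ν (x ⁻¹) ≡ ν x
  ν-inv x = cong [_] (N-inv x)

  ν̂-inv : ∀ x → ν (σ (x ⁻¹)) ≡ ν (σ x)
  ν̂-inv x = trans (cong ν (σ-⁻¹ x)) (ν-inv (σ x))

  N-absorb : ∀ u v → N u ≡ true → N (u ∙ v) ≡ N v
  N-absorb u v u∈N with N v in eq | N (u ∙ v) in eq′
  ... | true  | true  = refl
  ... | false | false = refl
  ... | true  | false = trans (sym eq′) (N-∙ u∈N eq)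
  ... | false | true  = sym (trans (sym eq) (trans (cong N (sym (x⁻¹∙xy u v))) (N-∙ (N-⁻¹ u∈N) eq′)))

  2∤p : ¬ (+ 2 ∣ + p)
  2∤p d = contradiction (ℕ∣.∣⇒≤ (∣⇒∣ᵤ (∣-minus {+ 2} {+ p} {1ℤ} d 2∣p-1))) (λ { (s≤s ()) })

  module Pair (A B : X → Bool)
    (autocorr : ∀ x → corr ([_] ∘ A) ([_] ∘ A) x + corr ([_] ∘ B) ([_] ∘ B) x ≡ κ x)
    (total : Σ* ([_] ∘ A) + Σ* ([_] ∘ B) ≡ + 2 * + p)
    (crosscorr : ∀ x → corr ([_] ∘ A) ([_] ∘ B ∘ σ) x + corr ([_] ∘ B) ([_] ∘ A ∘ σ) x ≡ + 2)
    where

    open Raw A B autocorr total using (a; b; U; V; U≥0; V≥0; κ-∉N; U-N; A-transversal; B-transversal; Σa; Σb)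

    private
      b̂ Z : X → ℤ
      b̂ = b ∘ σ
      Z = corr a b̂

    -- The second cross-correlation at x is Z at (σx)⁻¹, so the relation involves the single
    -- function Z.
    Z-relation : ∀ x → Z x + Z ((σ x) ⁻¹) ≡ + 2
    Z-relation x = trans (cong (_+_ (Z x)) (trans (corr-inv a b̂ (σ x)) (trans (sym (corr-σ b̂ a x)) (∑-cong E (λ w → cong (λ z → b z * a (σ w)) (σσ (x ∙ w))))))) (crosscorr x)

    U-ε : U ε ≡ + p
    U-ε = trans (∑-cong E (λ w → trans (cong (λ z → a z * a w) (identityˡ w)) ([]-idem (A w)))) Σa

    U-inv : ∀ x → U (x ⁻¹) ≡ U x
    U-inv = corr-inv a a

    V-inv : ∀ x → V (x ⁻¹) ≡ V x
    V-inv = corr-inv b b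

    U≤2 : ∀ {x} → N x ≡ false → U x ≤ + 2
    U≤2 {x} x∉N = subst (U x ≤_) (trans (autocorr x) (κ-∉N x∉N)) (subst (_≤ U x + V x) (ℤₚ.+-identityʳ (U x)) (ℤₚ.+-monoʳ-≤ (U x) (V≥0 x)))

    -- The hypothesis makes ⟨g⟩ stable under σ, so the relations pass to P/⟨g⟩ and the result on
    -- periodic sequences applies. What is used later is `even` and `odd-on-cosets`.
    module Key {g : X} (g∉N : N g ≡ false) (σg : σ g ≡ g ⊎ σ g ≡ g ⁻¹) where
      open Coset g

      private
        y₀ = proj₁ N-generator
        y₀∉⟨g⟩ : ¬ (y₀ ∈⟨ g ⟩)
        y₀∉⟨g⟩ = N∌⟨⟩ g∉N (proj₁ (proj₂ N-generator)) (proj₂ (proj₂ N-generator))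

        -- σ acts on P/⟨g⟩, which has order p, as 1 or as -1.
        Basis : Set
        Basis = ∃ λ y → ¬ (y ∈⟨ g ⟩) × (σ y ≡ y ⊎ ∃ λ k → k ∈⟨ g ⟩ × σ y ≡ (y ⁻¹) ∙ k)

        -- The element y₀ · σy₀ is fixed by σ. If it lies outside ⟨g⟩ it generates the quotient; if
        -- it lies inside, σ inverts y₀ modulo ⟨g⟩.
        basis : Basis
        basis with (y₀ ∙ σ y₀) ∈⟨ g ⟩?
        ... | no n  = y₀ ∙ σ y₀ , n , inj₁ (trans (σ-∙ y₀ (σ y₀)) (trans (cong (σ y₀ ∙_) (σσ y₀)) (comm _ _)))
        ... | yes k = y₀ , y₀∉⟨g⟩ , inj₂ (y₀ ∙ σ y₀ , k , sym (x⁻¹∙xy y₀ (σ y₀)))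

        module WithBasis (y : X) (y∉⟨g⟩ : ¬ (y ∈⟨ g ⟩)) (σy : σ y ≡ y ⊎ ∃ λ k → k ∈⟨ g ⟩ × σ y ≡ (y ⁻¹) ∙ k) where
          open Coordinates size² y∉⟨g⟩ (∉N⇒≢ε g∉N)

          q : ℕ → ℕ → X
          q m n = (y ^ m) ∙ ((y ^ n) ⁻¹)

          q-inv : ∀ m n → (q m n) ⁻¹ ≡ q n m
          q-inv m n = trans (⁻¹-anti-homo-∙ (y ^ m) ((y ^ n) ⁻¹)) (cong (_∙ ((y ^ m) ⁻¹)) (⁻¹-involutive (y ^ n)))

          σq : ∀ m n → σ (q m n) ≡ q m n ⊎ ∃ λ k → k ∈⟨ g ⟩ × σ (q m n) ≡ ((q m n) ⁻¹) ∙ k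
          σq m n = [ (λ e → inj₁ (trans (σ-∙ _ _) (cong₂ _∙_ (trans (σ-^ y m) (cong (_^ m) e)) (trans (σ-⁻¹ _) (cong _⁻¹ (trans (σ-^ y n) (cong (_^ n) e)))))))
                   , (λ { (k , k∈g , e) → inj₂ ((k ^ m) ∙ ((k ^ n) ⁻¹) , ∈⟨⟩-∙ (Subgroup.H-^ (cyclic g) m k∈g) (∈⟨⟩-⁻¹ (Subgroup.H-^ (cyclic g) n k∈g)) , eq k e) }) ]′ σy
            where
            pw : ∀ k → σ y ≡ (y ⁻¹) ∙ k → ∀ m → σ (y ^ m) ≡ ((y ^ m) ⁻¹) ∙ (k ^ m)
            pw k e m = trans (σ-^ y m) (trans (cong (_^ m) e) (trans (^-∙ (y ⁻¹) k m) (cong (_∙ (k ^ m))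
              (inverseʳ-unique (y ^ m) ((y ⁻¹) ^ m) (trans (sym (^-∙ y (y ⁻¹) m)) (trans (cong (_^ m) (inverseʳ y)) (ε^ m)))))))
            eq : ∀ k → σ y ≡ (y ⁻¹) ∙ k → σ (q m n) ≡ ((q m n) ⁻¹) ∙ ((k ^ m) ∙ ((k ^ n) ⁻¹))
            eq k e = begin
              σ (q m n)                                                        ≡⟨ σ-∙ _ _ ⟩
              σ (y ^ m) ∙ σ ((y ^ n) ⁻¹)                                       ≡⟨ cong₂ _∙_ (pw k e m) (trans (σ-⁻¹ (y ^ n)) (cong _⁻¹ (pw k e n))) ⟩
              (((y ^ m) ⁻¹) ∙ (k ^ m)) ∙ ((((y ^ n) ⁻¹) ∙ (k ^ n)) ⁻¹)         ≡⟨ cong ((((y ^ m) ⁻¹) ∙ (k ^ m)) ∙_) (sym (⁻¹-∙-comm ((y ^ n) ⁻¹) (k ^ n))) ⟩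
              (((y ^ m) ⁻¹) ∙ (k ^ m)) ∙ ((((y ^ n) ⁻¹) ⁻¹) ∙ ((k ^ n) ⁻¹))    ≡⟨ interchange _ _ _ _ ⟩
              (((y ^ m) ⁻¹) ∙ (((y ^ n) ⁻¹) ⁻¹)) ∙ ((k ^ m) ∙ ((k ^ n) ⁻¹))    ≡⟨ cong (_∙ ((k ^ m) ∙ ((k ^ n) ⁻¹))) (⁻¹-∙-comm (y ^ m) ((y ^ n) ⁻¹)) ⟩
              ((q m n) ⁻¹) ∙ ((k ^ m) ∙ ((k ^ n) ⁻¹))                          ∎
              where open ≡-Reasoning

          e : ℕ → ℕ → ℤ
          e m n = S p (λ l → δ (q m n ∙ (g ^ l)) ε)

          e-cong : ∀ {m n m′ n′} → q m n ≡ q m′ n′ → e m n ≡ e m′ n′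
          e-cong eq = ∑-cong (upTo p) (λ l → cong (λ z → δ (z ∙ (g ^ l)) ε) eq)

          e-shift : ∀ d m n → e (m ℕ.+ d) (n ℕ.+ d) ≡ e m n
          e-shift d m n = e-cong {m ℕ.+ d} {n ℕ.+ d} {m} {n} (begin
            (y ^ (m ℕ.+ d)) ∙ ((y ^ (n ℕ.+ d)) ⁻¹)              ≡⟨ cong₂ (λ u v → u ∙ (v ⁻¹)) (^-+ y m d) (^-+ y n d) ⟩
            ((y ^ m) ∙ (y ^ d)) ∙ (((y ^ n) ∙ (y ^ d)) ⁻¹)      ≡⟨ cong (((y ^ m) ∙ (y ^ d)) ∙_) (sym (⁻¹-∙-comm (y ^ n) (y ^ d))) ⟩
            ((y ^ m) ∙ (y ^ d)) ∙ (((y ^ n) ⁻¹) ∙ ((y ^ d) ⁻¹)) ≡⟨ interchange _ _ _ _ ⟩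
            q m n ∙ ((y ^ d) ∙ ((y ^ d) ⁻¹))                    ≡⟨ trans (cong (q m n ∙_) (inverseʳ (y ^ d))) (identityʳ _) ⟩
            q m n                                               ∎)
            where open ≡-Reasoning

          e-diag : ∀ m → e m m ≡ 1ℤ
          e-diag m = trans (∑-cong (upTo p) (λ l → cong (λ z → δ z ε) (trans (cong (_∙ (g ^ l)) (inverseʳ (y ^ m))) (identityˡ (g ^ l)))))
            (trans (S-single0 p (λ l → δ (g ^ l) ε) (λ l 0<l l<p → δ-≢ (λ gl → ∉N (⟨⟩∩N g∉N 0<l l<p) (trans (cong N gl) N-ε)))) (δ-refl ε))

          e-off : ∀ {m n} → m ℕ.< p → n ℕ.< p → m ≢ n → e m n ≡ 0ℤ
          e-off {m} {n} m<p n<p m≢n = trans (∑-cong (upTo p) (λ l → δ-≢ (λ eq → m≢n (coord-injˡ {i = l} {0} m<p n<p (move l eq)))))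
                                            (trans (S-const p 0ℤ) (ℤₚ.*-zeroʳ (+ p)))
            where
            move : ∀ l → q m n ∙ (g ^ l) ≡ ε → (y ^ m) ∙ (g ^ l) ≡ (y ^ n) ∙ (g ^ 0)
            move l eq = trans (sym (yx⁻¹∙x (y ^ n) ((y ^ m) ∙ (g ^ l)))) (trans (cong (_∙ (y ^ n)) (trans (trans (assoc _ _ _) (trans (cong ((y ^ m) ∙_) (comm _ _)) (sym (assoc _ _ _)))) eq)) (comm ε (y ^ n)))

          -- The coset of `q m n` goes under σ to itself or to its inverse, and V is invariant under
          -- inversion; thus σB may replace B in the projected relation.
          ⟪V⟫-σ : ∀ m n → ⟪ corr b̂ b̂ ⟫ (q m n) ≡ ⟪ V ⟫ (q m n)
          ⟪V⟫-σ m n = trans (∑-cong (upTo p) (λ l → corr-σ b b (q m n ∙ (g ^ l)))) (trans (⟪⟫-σ σg V (q m n))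
            ([ (λ e → cong ⟪ V ⟫ e)
             , (λ { (k , k∈g , e) → trans (cong ⟪ V ⟫ e) (trans (⟪⟫-shift V ((q m n) ⁻¹) k∈g) (trans (sym (⟪⟫-inv V (q m n))) (∑-cong (upTo p) (λ l → V-inv _)))) }) ]′ (σq m n)))

          sum-corr : ∀ m n → Corr (project a) (project a) m n + Corr (project b̂) (project b̂) m n ≡ + 2 * + p * e m n + (+ 2 * + p - + 2)
          sum-corr m n = trans (cong₂ _+_ (project-corr a a m n) (trans (project-corr b̂ b̂ m n) (⟪V⟫-σ m n)))
            (trans (sym (∑-⊕ (upTo p) (λ l → U (q m n ∙ (g ^ l))) (λ l → V (q m n ∙ (g ^ l))))) (trans (∑-cong (upTo p) (λ l → autocorr (q m n ∙ (g ^ l)))) (κ-coset g∉N (q m n))))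

          ⟪Z⟫-relation : ∀ x → ⟪ Z ⟫ x + ⟪ Z ⟫ ((σ x) ⁻¹) ≡ + 2 * + p
          ⟪Z⟫-relation x = trans (cong (_+_ (⟪ Z ⟫ x)) (sym (trans (⟪⟫-σ σg (λ z → Z (z ⁻¹)) x) (⟪⟫-inv Z (σ x)))))
            (trans (sym (∑-⊕ (upTo p) (λ l → Z (x ∙ (g ^ l))) (λ l → Z ((σ (x ∙ (g ^ l))) ⁻¹))))
            (trans (∑-cong (upTo p) (λ l → Z-relation (x ∙ (g ^ l)))) (trans (S-const p (+ 2)) (ℤₚ.*-comm (+ p) (+ 2)))))

          cross-corr : ∀ m n → Corr (project a) (project b̂) m n + Corr (project a) (project b̂) n m ≡ + 2 * + p
          cross-corr m n = trans (cong₂ _+_ (project-corr a b̂ m n) (project-corr a b̂ n m))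
            ([ fixed , inverted ]′ (σq m n))
            where
            fixed : σ (q m n) ≡ q m n → ⟪ Z ⟫ (q m n) + ⟪ Z ⟫ (q n m) ≡ + 2 * + p
            fixed e = trans (cong (λ z → ⟪ Z ⟫ (q m n) + ⟪ Z ⟫ z) (trans (sym (q-inv m n)) (cong _⁻¹ (sym e)))) (⟪Z⟫-relation (q m n))
            -- If σ inverts x modulo ⟨g⟩, then (σx)⁻¹ lies in the coset of x, and `⟪Z⟫-relation`
            -- pairs that coset with itself.
            half : ∀ x {k} → k ∈⟨ g ⟩ → σ x ≡ (x ⁻¹) ∙ k → ⟪ Z ⟫ x ≡ + p
            half x {k} k∈g e = *-cancel-2 (trans (lem (⟪ Z ⟫ x)) (trans (cong (_+_ (⟪ Z ⟫ x)) (sym (trans (cong ⟪ Z ⟫ eq) (⟪⟫-shift Z x (∈⟨⟩-⁻¹ k∈g))))) (⟪Z⟫-relation x)))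
              where
              lem : ∀ z → + 2 * z ≡ z + z
              lem = solve-∀
              eq : (σ x) ⁻¹ ≡ x ∙ (k ⁻¹)
              eq = trans (cong _⁻¹ e) (trans (sym (⁻¹-∙-comm (x ⁻¹) k)) (cong (_∙ (k ⁻¹)) (⁻¹-involutive x)))
            inverted : (∃ λ k → k ∈⟨ g ⟩ × σ (q m n) ≡ ((q m n) ⁻¹) ∙ k) → ⟪ Z ⟫ (q m n) + ⟪ Z ⟫ (q n m) ≡ + 2 * + p
            inverted (k , k∈g , e) = trans (cong₂ _+_ (half (q m n) k∈g e) (half (q n m) (∈⟨⟩-⁻¹ k∈g) e′)) (lem (+ p))
              where
              lem : ∀ z → z + z ≡ + 2 * z
              lem = solve-∀
              e′ : σ (q n m) ≡ ((q n m) ⁻¹) ∙ (k ⁻¹)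
              e′ = trans (cong σ (sym (q-inv m n))) (trans (σ-⁻¹ (q m n)) (trans (cong _⁻¹ e) (trans (sym (⁻¹-∙-comm ((q m n) ⁻¹) k)) (cong (λ z → (z ⁻¹) ∙ (k ⁻¹)) (q-inv m n)))))

          open Sequences p pr using (module Pair)
          open Pair e e-shift (λ m n → e-cong {m ℕ.+ p} {n} {m} {n} (cong (_∙ ((y ^ n) ⁻¹)) (^-per y m))) (λ m n → e-cong {m} {n ℕ.+ p} {m} {n} (cong (λ z → (y ^ m) ∙ (z ⁻¹)) (^-per y n)))
               e-diag e-off (project a) (project b̂) (project-per a) (project-per b̂)
               (trans (Σ-project a) Σa) (trans (Σ-project b̂) (trans (Σ-σ b) Σb)) sum-corr cross-corr

          ⟪U⟫-at-ε : ⟪ U ⟫ ε ≡ + p ⊎ ⟪ U ⟫ ε ≡ + 3 * + p - + 2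
          ⟪U⟫-at-ε = subst (λ z → z ≡ + p ⊎ z ≡ + 3 * + p - + 2) (trans (project-corr a a 0 0) (cong ⟪ U ⟫ (inverseʳ ε))) (autocorr-at-0 2∣p-1)

          ⟪U⟫-odd : ∀ x → ¬ (x ∈⟨ g ⟩) → + 2 ∣ ⟪ U ⟫ x - + p
          ⟪U⟫-odd x x∉⟨g⟩ = go (coord x)
            where
            go : (∃₂ λ j i → j ℕ.< p × i ℕ.< p × x ≡ (y ^ j) ∙ (g ^ i)) → + 2 ∣ ⟪ U ⟫ x - + p
            go (zero , i , _ , _ , refl) = contradiction (i , identityˡ (g ^ i)) x∉⟨g⟩
            go (suc j , i , j<p , _ , refl) = subst (λ z → + 2 ∣ z - + p)
              (trans (project-corr a a (suc j) 0) (trans (cong ⟪ U ⟫ (trans (cong ((y ^ suc j) ∙_) ε⁻¹≈ε) (identityʳ _))) (sym (⟪⟫-shift U (y ^ suc j) (i , refl)))))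
              (autocorr-parity 2∣p-1 (suc j) (s≤s z≤n) j<p)

        module W = WithBasis (proj₁ basis) (proj₁ (proj₂ basis)) (proj₂ (proj₂ basis))

      odd-on-cosets : ∀ x → ¬ (x ∈⟨ g ⟩) → + 2 ∣ ⟪ U ⟫ x - + p
      odd-on-cosets = W.⟪U⟫-odd

      -- Over ⟨g⟩ the values of U sum to p or 3p - 2, and U ε = p. The other p - 1 values lie
      -- between 0 and 2 and sum to 0 or 2p - 2, so they are all 0 or all 2.
      even : + 2 ∣ U g
      even = [ (λ e → divides 0ℤ (at-g (λ _ → 0ℤ) (all-zero e))) , (λ e → divides 1ℤ (at-g (λ _ → + 2) (all-two e))) ]′ W.⟪U⟫-at-ε
        where
        f : ℕ → ℤ
        f l = U (g ^ suc l)
        r : ℕ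
        r = ℕ.pred p
        0<r : 0 ℕ.< r
        0<r = ℕₚ.<-≤-trans (s≤s z≤n) (ℕ.s≤s⁻¹ (subst (1 ℕ.<_) (sym (ℕₚ.suc-pred p)) 1<p))
        at-g : ∀ (h : ℕ → ℤ) → (∀ j → j ℕ.< r → f j ≡ h j) → U g ≡ h 0
        at-g h hyp = trans (cong U (sym (identityʳ g))) (hyp 0 0<r)
        decompose : ⟪ U ⟫ ε ≡ + p + S r f
        decompose = trans (∑-cong (upTo p) (λ l → cong U (identityˡ (g ^ l)))) (trans (S-pred p (λ l → U (g ^ l))) (cong (_+ S r f) U-ε))
        all-zero : ⟪ U ⟫ ε ≡ + p → ∀ j → j ℕ.< r → f j ≡ 0ℤ
        all-zero e = S-zero⁻ r (λ j _ → U≥0 (g ^ suc j)) (ℤ+-cancelˡ (+ p) _ _ (trans (sym decompose) (trans e (sym (ℤₚ.+-identityʳ (+ p))))))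
        all-two : ⟪ U ⟫ ε ≡ + 3 * + p - + 2 → ∀ j → j ℕ.< r → f j ≡ + 2
        all-two e = S-tight r (λ j j<r → U≤2 (⟨⟩∩N g∉N (s≤s z≤n) (subst (suc j ℕ.<_) (ℕₚ.suc-pred p) (s≤s j<r))))
          (trans (trans (lem₁ (+ p) (S r f)) (trans (cong (_- + p) (trans (sym decompose) e)) (trans (cong (λ z → (+ 3 * z - + 2) - z) (trans (cong +_ (sym (ℕₚ.suc-pred p))) refl)) (lem₂ (+ r))))) (sym (S-const r (+ 2))))
          where
          lem₁ : ∀ c s → s ≡ (c + s) - c
          lem₁ = solve-∀
          lem₂ : ∀ r → (+ 3 * (1ℤ + r) - + 2) - (1ℤ + r) ≡ r * + 2
          lem₂ = solve-∀

    private
      â U̇ V̇ : X → ℤ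
      â = a ∘ σ
      U̇ = U ∘ σ
      V̇ = V ∘ σ
      Ẑ : X → ℤ
      Ẑ = corr b̂ a

      ΣZ : Σ* Z ≡ + p * + p
      ΣZ = trans (Σ-corr a b̂) (cong₂ _*_ Σa (trans (Σ-σ b) Σb))
      ΣẐ : Σ* Ẑ ≡ + p * + p
      ΣẐ = trans (Σ-corr b̂ a) (cong₂ _*_ (trans (Σ-σ b) Σb) Σa)

      open RingIdentities groupRing

      products : ∀ f h x → (corr f f ⊛ corr h h) x ≡ (corr f h ⊛ corr h f) x
      products f h x = begin
        (corr f f ⊛ corr h h) x             ≡⟨ ⊛-cong (corr-⊛ f f) (corr-⊛ h h) x ⟩
        ((f ⊛ f *ᵍ) ⊛ (h ⊛ h *ᵍ)) x         ≡⟨ four-fold f (f *ᵍ) h (h *ᵍ) x ⟨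
        ((f ⊛ h *ᵍ) ⊛ (f *ᵍ ⊛ h)) x         ≡⟨ ⊛-cong (λ z → sym (corr-⊛ f h z)) (λ z → trans (⊛-comm (f *ᵍ) h z) (sym (corr-⊛ h f z))) x ⟩
        (corr f h ⊛ corr h f) x             ∎
        where open ≡-Reasoning

      bâ : ∀ x → corr b â x ≡ + 2 - Z x
      bâ x = trans (lem (Z x) (corr b â x)) (cong (_- Z x) (crosscorr x))
        where
        lem : ∀ u v → v ≡ (u + v) - u
        lem = solve-∀

      âb : ∀ x → corr â b x ≡ + 2 - Ẑ x
      âb x = trans (sym (corr-inv b â x)) (trans (bâ (x ⁻¹)) (cong (_-_ (+ 2)) (corr-inv a b̂ x)))

      -- The constant terms cancel because Z and Ẑ both sum to p², the order of P.
      complement : ∀ x → ((λ w → + 2 - Ẑ w) ⊛ (λ w → + 2 - Z w)) x ≡ (Ẑ ⊛ Z) x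
      complement x = begin
        Σ* (λ w → (+ 2 - Ẑ w) * (+ 2 - Z ((w ⁻¹) ∙ x)))
          ≡⟨ ∑-cong E (λ w → lem₁ (Ẑ w) (Z ((w ⁻¹) ∙ x))) ⟩
        Σ* (λ w → (+ 4 - + 2 * Ẑ w) + (Ẑ w * Z ((w ⁻¹) ∙ x) - + 2 * Z ((w ⁻¹) ∙ x)))
          ≡⟨ trans (∑-⊕ E (λ w → + 4 - + 2 * Ẑ w) (λ w → Ẑ w * Z ((w ⁻¹) ∙ x) - + 2 * Z ((w ⁻¹) ∙ x)))
                   (cong₂ _+_ (trans (∑-- E (λ _ → + 4) (λ w → + 2 * Ẑ w)) (cong₂ _-_ (trans (∑-const E (+ 4)) (cong (_* + 4) (trans (cong +_ size²) (ℤₚ.pos-* p p)))) (trans (∑-*ˡ E (+ 2) Ẑ) (cong (+ 2 *_) ΣẐ))))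
                              (trans (∑-- E (λ w → Ẑ w * Z ((w ⁻¹) ∙ x)) (λ w → + 2 * Z ((w ⁻¹) ∙ x)))
                                     (cong (_-_ ((Ẑ ⊛ Z) x)) (trans (∑-*ˡ E (+ 2) (λ w → Z ((w ⁻¹) ∙ x))) (cong (+ 2 *_) (trans (Σ-inv (λ w → Z (w ∙ x))) (trans (Σ-transʳ x Z) ΣZ))))))) ⟩
        (+ p * + p * + 4 - + 2 * (+ p * + p)) + ((Ẑ ⊛ Z) x - + 2 * (+ p * + p))
          ≡⟨ lem₂ (+ p * + p) ((Ẑ ⊛ Z) x) ⟩
        (Ẑ ⊛ Z) x ∎
        where
        open ≡-Reasoning
        lem₁ : ∀ u v → (+ 2 - u) * (+ 2 - v) ≡ (+ 4 - + 2 * u) + (u * v - + 2 * v)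
        lem₁ = solve-∀
        lem₂ : ∀ q z → (q * + 4 - + 2 * q) + (z - + 2 * q) ≡ z
        lem₂ = solve-∀

      -- Both sides equal Z Ẑ. For the right side, the cross relation replaces the correlations of
      -- σA with B by 2 - Z and 2 - Ẑ, and `complement` removes the constants.
      UV : ∀ x → (U ⊛ V̇) x ≡ (U̇ ⊛ V) x
      UV x = begin
        (U ⊛ V̇) x                                       ≡⟨ ⊛-cong {U} {U} {V̇} {corr b̂ b̂} (λ _ → refl) (λ z → sym (corr-σ b b z)) x ⟩
        (corr a a ⊛ corr b̂ b̂) x                         ≡⟨ products a b̂ x ⟩
        (Z ⊛ Ẑ) x                                       ≡⟨ ⊛-comm Z Ẑ x ⟩
        (Ẑ ⊛ Z) x                                       ≡⟨ complement x ⟨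
        ((λ w → + 2 - Ẑ w) ⊛ (λ w → + 2 - Z w)) x       ≡⟨ ⊛-cong (λ z → sym (âb z)) (λ z → sym (bâ z)) x ⟩
        (corr â b ⊛ corr b â) x                         ≡⟨ products â b x ⟨
        (corr â â ⊛ corr b b) x                         ≡⟨ ⊛-cong {corr â â} {U̇} {V} {V} (corr-σ a a) (λ _ → refl) x ⟩
        (U̇ ⊛ V) x                                       ∎
        where open ≡-Reasoning

      -- Add U · σU to both sides of `UV`; the sums U + V and σU + σV are then κ and its σ-image.
      Uκ : ∀ x → (U ⊛ κ-like (ν ∘ σ)) x ≡ (U̇ ⊛ κ) x
      Uκ x = begin
        (U ⊛ κ-like (ν ∘ σ)) x         ≡⟨ ⊛-cong {U} {U} {κ-like (ν ∘ σ)} {λ w → U̇ w + V̇ w} (λ _ → refl) (λ w → trans (sym (κ-σ w)) (sym (autocorr (σ w)))) x ⟩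
        (U ⊛ (λ w → U̇ w + V̇ w)) x      ≡⟨ CommutativeRing.distribˡ groupRing U U̇ V̇ x ⟩
        (U ⊛ U̇) x + (U ⊛ V̇) x          ≡⟨ cong₂ _+_ (⊛-comm U U̇ x) (UV x) ⟩
        (U̇ ⊛ U) x + (U̇ ⊛ V) x          ≡⟨ CommutativeRing.distribˡ groupRing U̇ U V x ⟨
        (U̇ ⊛ (λ w → U w + V w)) x      ≡⟨ ⊛-cong {U̇} {U̇} {λ w → U w + V w} {κ} (λ _ → refl) autocorr x ⟩
        (U̇ ⊛ κ) x                      ∎
        where open ≡-Reasoning

    L : X → ℤ
    L = U ⊛ (ν ∘ σ)

    -- The coefficients of `Uκ` written out: pU - U · σN is invariant under σ. Thus the σ-invariance
    -- of U reduces to that of L, the sums of U over cosets of σN.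
    U-twist : ∀ x → + p * U x - L x ≡ + p * U (σ x) - L (σ x)
    U-twist x = *-cancel-2 (cancel (+ p) (U x) (U (σ x)) (Σ* U) (L x) (L (σ x)) (begin
      (+ 2 * + p * U x + + 2 * Σ* U) - + 2 * L x           ≡⟨ ⊛-κ U (ν ∘ σ) x ⟨
      (U ⊛ κ-like (ν ∘ σ)) x                               ≡⟨ Uκ x ⟩
      (U̇ ⊛ κ) x                                            ≡⟨ ⊛-κ U̇ ν x ⟩
      (+ 2 * + p * U̇ x + + 2 * Σ* U̇) - + 2 * (U̇ ⊛ ν) x     ≡⟨ cong₂ (λ s l → (+ 2 * + p * U̇ x + + 2 * s) - + 2 * l) (Σ-σ U)
                                                                (trans (⊛-cong {U̇} {U̇} {ν} {ν ∘ σ ∘ σ} (λ _ → refl) (λ w → cong ν (sym (σσ w))) x) (sym (⊛-σ U (ν ∘ σ) x))) ⟩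
      (+ 2 * + p * U (σ x) + + 2 * Σ* U) - + 2 * L (σ x)   ∎))
      where
      open ≡-Reasoning
      cancel : ∀ q u u′ s l l′ → (+ 2 * q * u + + 2 * s) - + 2 * l ≡ (+ 2 * q * u′ + + 2 * s) - + 2 * l′ →
               + 2 * (q * u - l) ≡ + 2 * (q * u′ - l′)
      cancel q u u′ s l l′ e = trans (lem q u s l) (trans (cong (_- + 2 * s) e) (sym (lem q u′ s l′)))
        where
        lem : ∀ q u s l → + 2 * (q * u - l) ≡ ((+ 2 * q * u + + 2 * s) - + 2 * l) - + 2 * s
        lem = solve-∀

    U-σ : (∀ x → L x ≡ L (σ x)) → ∀ x → U x ≡ U (σ x)
    U-σ h x = *-cancel-p (trans (lem (+ p * U x) (L x)) (trans (cong₂ _+_ (U-twist x) (h x)) (sym (lem (+ p * U (σ x)) (L (σ x))))))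
      where
      lem : ∀ u l → u ≡ (u - l) + l
      lem = solve-∀

    -- As A is a transversal, for each w in A exactly one n in N puts xnw into A; so there is one
    -- quotient in xN for each of the p elements w.
    ΣNU : ∀ x → Σ* (λ n → ν n * U (x ∙ n)) ≡ + p
    ΣNU x = begin
      Σ* (λ n → ν n * U (x ∙ n))                                    ≡⟨ ∑-cong E (λ n → sym (∑-*ˡ E (ν n) (λ w → a ((x ∙ n) ∙ w) * a w))) ⟩
      Σ* (λ n → Σ* (λ w → ν n * (a ((x ∙ n) ∙ w) * a w)))           ≡⟨ ∑-swap E E _ ⟩
      Σ* (λ w → Σ* (λ n → ν n * (a ((x ∙ n) ∙ w) * a w)))           ≡⟨ ∑-cong E (λ w → trans (∑-cong E (λ n → trans (sym (ℤₚ.*-assoc (ν n) _ (a w))) (cong (λ z → (ν n * a z) * a w) (swap n w)))) (∑-*ʳ E (a w) (λ n → ν n * a ((x ∙ w) ∙ n)))) ⟩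
      Σ* (λ w → Σ* (λ n → ν n * a ((x ∙ w) ∙ n)) * a w)             ≡⟨ ∑-cong E (λ w → trans (cong (_* a w) (A-transversal (x ∙ w))) (ℤₚ.*-identityˡ (a w))) ⟩
      Σ* a                                                          ≡⟨ Σa ⟩
      + p                                                           ∎
      where
      open ≡-Reasoning
      swap : ∀ n w → (x ∙ n) ∙ w ≡ (x ∙ w) ∙ n
      swap n w = trans (assoc x n w) (trans (cong (x ∙_) (comm n w)) (sym (assoc x w n)))

    -- The case σN = N

    module Normal (σN : ∀ {n} → N n ≡ true → N (σ n) ≡ true) where

      private
        N-σ : ∀ x → N (σ x) ≡ N x
        N-σ x with N x in eq | N (σ x) in eq′
        ... | true  | true  = refl
        ... | false | false = refl
        ... | true  | false = trans (sym eq′) (σN eq)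
        ... | false | true  = sym (trans (sym eq) (trans (cong N (sym (σσ x))) (σN eq′)))

        L≡p : ∀ x → L x ≡ + p
        L≡p x = trans (⊛-cong {U} {U} {ν ∘ σ} {ν} (λ _ → refl) (λ w → cong [_] (N-σ w)) x) (trans (⊛-symmetric U ν ν-inv x) (ΣNU x))

        invariant : ∀ x → U x ≡ U (σ x)
        invariant = U-σ (λ x → trans (L≡p x) (sym (L≡p (σ x))))

        -- On a coset hN preserved by ι = σ or ι = σ(·)⁻¹ the sum of U is the odd number p,
        -- while U is even at the fixed points of ι.
        module _ {h : X} (h∉N : N h ≡ false) (ι : X → X) (ιι : ∀ x → ι (ι x) ≡ x)
                 (Uι : ∀ x → U (ι x) ≡ U x) (Nι : ∀ x → N ((h ⁻¹) ∙ ι x) ≡ N ((h ⁻¹) ∙ x))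
                 (fixed : ∀ x → ι x ≡ x → σ x ≡ x ⊎ σ x ≡ x ⁻¹) where

          coset-parity : ⊥
          coset-parity = 2∤p (subst (+ 2 ∣_) coset-sum (involution-parity ι ιι f fι f-even))
            where
            f : X → ℤ
            f x = ν ((h ⁻¹) ∙ x) * U x
            fι : ∀ x → f (ι x) ≡ f x
            fι x = cong₂ (λ b u → [ b ] * u) (Nι x) (Uι x)
            coset-sum : Σ* f ≡ + p
            coset-sum = trans (sym (Σ-transˡ h f)) (trans (∑-cong E (λ n → cong (λ z → ν z * U (h ∙ n)) (x⁻¹∙xy h n))) (ΣNU h))
            f-even : ∀ x → ι x ≡ x → + 2 ∣ f x
            f-even x e = go (N ((h ⁻¹) ∙ x)) refl
              where
              go : ∀ c → N ((h ⁻¹) ∙ x) ≡ c → + 2 ∣ [ c ] * U x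
              go false _  = divides 0ℤ (ℤₚ.*-zeroˡ (U x))
              go true  eq = ∣n⇒∣m*n 1ℤ (Key.even x∉N (fixed x e))
                where
                x∉N : N x ≡ false
                x∉N = trans (cong N (sym (trans (comm _ _) (x∙x⁻¹y h x)))) (trans (N-absorb _ h eq) h∉N)

      -- For h outside N put k = h · σh, which σ fixes. If k is outside N, the coset kN is stable
      -- under σ; if k is in N, then σh lies in h⁻¹N and hN is stable under x ↦ (σx)⁻¹.
      contradiction-normal : ⊥
      contradiction-normal = go (N (h ∙ σ h)) refl
        where
        h = proj₁ outside-N
        h∉N = proj₂ outside-N
        go : ∀ c → N (h ∙ σ h) ≡ c → ⊥
        go false k∉N = coset-parity k∉N σ σσ (λ x → sym (invariant x)) Nι (λ x e → inj₁ e)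
          where
          k = h ∙ σ h
          σk : σ k ≡ k
          σk = trans (σ-∙ h (σ h)) (trans (cong (σ h ∙_) (σσ h)) (comm _ _))
          Nι : ∀ x → N ((k ⁻¹) ∙ σ x) ≡ N ((k ⁻¹) ∙ x)
          Nι x = trans (cong N (trans (cong (_∙ σ x) (trans (cong _⁻¹ (sym σk)) (sym (σ-⁻¹ k)))) (sym (σ-∙ (k ⁻¹) x)))) (N-σ _)
        go true k∈N = coset-parity h∉N (λ x → (σ x) ⁻¹) ιι (λ x → trans (U-inv (σ x)) (sym (invariant x))) Nι
                        (λ x e → inj₂ (trans (sym (⁻¹-involutive (σ x))) (cong _⁻¹ e)))
          where
          ιι : ∀ x → (σ ((σ x) ⁻¹)) ⁻¹ ≡ x
          ιι x = trans (cong _⁻¹ (trans (σ-⁻¹ (σ x)) (cong _⁻¹ (σσ x)))) (⁻¹-involutive x)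
          Nι : ∀ x → N ((h ⁻¹) ∙ ((σ x) ⁻¹)) ≡ N ((h ⁻¹) ∙ x)
          Nι x = begin
            N ((h ⁻¹) ∙ ((σ x) ⁻¹))                    ≡⟨ cong N (⁻¹-∙-comm h (σ x)) ⟩
            N ((h ∙ σ x) ⁻¹)                           ≡⟨ N-inv (h ∙ σ x) ⟩
            N (h ∙ σ x)                                ≡⟨ cong (λ z → N (h ∙ z)) (sym (x∙x⁻¹y (σ h) (σ x))) ⟩
            N (h ∙ (σ h ∙ (((σ h) ⁻¹) ∙ σ x)))         ≡⟨ cong N (sym (assoc h (σ h) _)) ⟩
            N ((h ∙ σ h) ∙ (((σ h) ⁻¹) ∙ σ x))         ≡⟨ N-absorb _ _ k∈N ⟩
            N (((σ h) ⁻¹) ∙ σ x)                       ≡⟨ cong (λ z → N (z ∙ σ x)) (sym (σ-⁻¹ h)) ⟩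
            N (σ (h ⁻¹) ∙ σ x)                         ≡⟨ cong N (sym (σ-∙ (h ⁻¹) x)) ⟩
            N (σ ((h ⁻¹) ∙ x))                         ≡⟨ N-σ _ ⟩
            N ((h ⁻¹) ∙ x)                             ∎
            where open ≡-Reasoning

    -- The case σN ≠ N

    module Nonnormal {y : X} (y∈N : N y ≡ true) (σy∉N : N (σ y) ≡ false) where

      private
        y′ = σ y
        r = ℕ.pred p
        1+r : suc r ≡ p
        1+r = ℕₚ.suc-pred p

        y≢ε : y ≢ ε
        y≢ε refl = ∉N σy∉N (trans (cong N σ-ε) N-ε)

        y^≢ε : ∀ {d} → 0 ℕ.< d → d ℕ.< p → y ^ d ≢ ε
        y^≢ε 0<d d<p e = y≢ε (Subgroup.H-root trivial 0<d d<p e)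

        y^∈N : ∀ j → N (y ^ j) ≡ true
        y^∈N j = Subgroup.H-^ N-subgroup j y∈N

        open Coset y′
        open Coordinates size² (N∌⟨⟩ σy∉N y∈N y≢ε) (∉N⇒≢ε σy∉N)
        open SequenceEnergy p

        σ-y′^ : ∀ l → σ (y′ ^ l) ≡ y ^ l
        σ-y′^ l = trans (σ-^ y′ l) (cong (_^ l) (σσ y))

        N-sum : ∀ (f : X → ℤ) → Σ* (λ x → ν x * f x) ≡ S p (λ j → f (y ^ j))
        N-sum f = trans (Σ-coord (λ x → ν x * f x)) (∑-cong (upTo p) (λ j →
          trans (S-single0 p (λ i → ν ((y ^ j) ∙ (y′ ^ i)) * f ((y ^ j) ∙ (y′ ^ i))) (λ i 0<i i<p →
                   trans (cong (λ b → [ b ] * f ((y ^ j) ∙ (y′ ^ i))) (trans (N-absorb (y ^ j) (y′ ^ i) (y^∈N j)) (⟨⟩∩N σy∉N 0<i i<p))) (ℤₚ.*-zeroˡ (f ((y ^ j) ∙ (y′ ^ i))))))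
                (trans (cong (λ z → ν z * f z) (identityʳ (y ^ j))) (trans (cong (λ b → [ b ] * f (y ^ j)) (y^∈N j)) (ℤₚ.*-identityˡ (f (y ^ j)))))))

        N̂-sum : ∀ (f : X → ℤ) → Σ* (λ x → ν (σ x) * f x) ≡ S p (λ l → f (y′ ^ l))
        N̂-sum f = trans (∑-cong E (λ x → cong (λ z → ν (σ x) * f z) (sym (σσ x)))) (trans (Σ-σ (λ x → ν x * f (σ x)))
          (trans (N-sum (f ∘ σ)) (∑-cong (upTo p) (λ l → cong f (σ-^ y l)))))

        ⊛ν̂ : ∀ f x → (f ⊛ (ν ∘ σ)) x ≡ ⟪ f ⟫ x
        ⊛ν̂ f x = trans (⊛-symmetric f (ν ∘ σ) ν̂-inv x) (N̂-sum (λ n → f (x ∙ n)))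

        -- The sum D + D₂ = A⁻¹B + (σB)⁻¹σA is the t-part of R⁻¹R.
        D D₂ : X → ℤ
        D  = corr b a
        D₂ = corr â b̂

        D₂ν : ∀ x → (D₂ ⊛ ν) x ≡ ⟪ D ⟫ ((σ x) ⁻¹)
        D₂ν x = trans (⊛-symmetric D₂ ν ν-inv x) (trans (N-sum (λ n → D₂ (x ∙ n))) (trans (∑-cong (upTo p) (λ l →
          trans (corr-σ a b (x ∙ (y ^ l))) (trans (sym (corr-inv b a (σ (x ∙ (y ^ l))))) (cong (λ z → D (z ⁻¹)) (trans (σ-∙ x (y ^ l)) (cong (σ x ∙_) (σ-^ y l)))))))
          (⟪⟫-inv D (σ x))))

        Dκ : ∀ x → (D₂ ⊛ κ) x + (D ⊛ κ-like (ν ∘ σ)) x ≡ + p * + p * + 2 + + p * + p * + 2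
        Dκ x = trans (cong₂ _+_ (⊛-cong {D₂} {b̂ *ᵍ ⊛ â} {κ} {λ w → (a ⊛ a *ᵍ) w + (b ⊛ b *ᵍ) w}
                                         (λ w → trans (corr-⊛ â b̂ w) (⊛-comm â (b̂ *ᵍ) w))
                                         (λ w → trans (sym (autocorr w)) (cong₂ _+_ (corr-⊛ a a w) (corr-⊛ b b w))) x)
                                 (⊛-cong {D} {a *ᵍ ⊛ b} {κ-like (ν ∘ σ)} {λ w → (â ⊛ â *ᵍ) w + (b̂ ⊛ b̂ *ᵍ) w}
                                         (λ w → trans (corr-⊛ b a w) (⊛-comm b (a *ᵍ) w))
                                         (λ w → trans (sym (κ-σ w)) (trans (sym (autocorr (σ w))) (cong₂ _+_ (trans (sym (corr-σ a a w)) (corr-⊛ â â w)) (trans (sym (corr-σ b b w)) (corr-⊛ b̂ b̂ w))))) x))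
               (trans (cross-identity a (a *ᵍ) â (â *ᵍ) b (b *ᵍ) b̂ (b̂ *ᵍ) x)
               (cong₂ _+_ (trans (⊛-cong {â ⊛ a *ᵍ} {corr â a} {λ w → (a ⊛ b̂ *ᵍ) w + (b ⊛ â *ᵍ) w} {λ _ → + 2} (λ w → sym (corr-⊛ â a w))
                                         (λ w → trans (sym (cong₂ _+_ (corr-⊛ a b̂ w) (corr-⊛ b â w))) (crosscorr w)) x)
                                 (trans (⊛-const (corr â a) (+ 2) x) (cong (_* + 2) (trans (Σ-corr â a) (cong₂ _*_ (trans (Σ-σ a) Σa) Σa)))))
                          (trans (⊛-cong {b ⊛ b̂ *ᵍ} {corr b b̂} {λ w → (b *ᵍ ⊛ â) w + (a *ᵍ ⊛ b̂) w} {λ _ → + 2} (λ w → sym (corr-⊛ b b̂ w))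
                                         (λ w → trans (cong₂ _+_ (trans (⊛-comm (b *ᵍ) â w) (trans (sym (corr-⊛ â b w)) (âb w))) (trans (⊛-comm (a *ᵍ) b̂ w) (sym (corr-⊛ b̂ a w)))) (lem (Ẑ w))) x)
                                 (trans (⊛-const (corr b b̂) (+ 2) x) (cong (_* + 2) (trans (Σ-corr b b̂) (cong₂ _*_ Σb (trans (Σ-σ b) Σb))))))))
          where
          lem : ∀ z → (+ 2 - z) + z ≡ + 2
          lem = solve-∀

        -- Expand both occurrences of κ in `Dκ`; the constants cancel. The left side is p times an
        -- integer, and this integrality is the source of the divisibility that follows.
        pD : ∀ x → + p * (D₂ x + D x) ≡ ⟪ D ⟫ x + ⟪ D ⟫ ((σ x) ⁻¹)
        pD x = *-cancel-2 (cancel (+ p) (D₂ x) (D x) (⟪ D ⟫ x) (⟪ D ⟫ ((σ x) ⁻¹)) (begin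
          ((+ 2 * + p * D₂ x + + 2 * (+ p * + p)) - + 2 * ⟪ D ⟫ ((σ x) ⁻¹)) + ((+ 2 * + p * D x + + 2 * (+ p * + p)) - + 2 * ⟪ D ⟫ x)
            ≡⟨ cong₂ _+_ (cong₂ (λ s l → (+ 2 * + p * D₂ x + + 2 * s) - + 2 * l) (trans (Σ-corr â b̂) (cong₂ _*_ (trans (Σ-σ a) Σa) (trans (Σ-σ b) Σb))) (D₂ν x))
                         (cong₂ (λ s l → (+ 2 * + p * D x + + 2 * s) - + 2 * l) (trans (Σ-corr b a) (cong₂ _*_ Σb Σa)) (⊛ν̂ D x)) ⟨
          ((+ 2 * + p * D₂ x + + 2 * Σ* D₂) - + 2 * (D₂ ⊛ ν) x) + ((+ 2 * + p * D x + + 2 * Σ* D) - + 2 * (D ⊛ (ν ∘ σ)) x)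
            ≡⟨ cong₂ _+_ (⊛-κ D₂ ν x) (⊛-κ D (ν ∘ σ) x) ⟨
          (D₂ ⊛ κ) x + (D ⊛ κ-like (ν ∘ σ)) x
            ≡⟨ Dκ x ⟩
          + p * + p * + 2 + + p * + p * + 2 ∎))
          where
          open ≡-Reasoning
          cancel : ∀ q d₂ d t t′ → ((+ 2 * q * d₂ + + 2 * (q * q)) - + 2 * t′) + ((+ 2 * q * d + + 2 * (q * q)) - + 2 * t) ≡ q * q * + 2 + q * q * + 2 →
                   + 2 * (q * (d₂ + d)) ≡ + 2 * (t + t′)
          cancel q d₂ d t t′ e = trans (lem₁ q d₂ d t t′) (trans (cong (λ z → (z - (q * q * + 2 + q * q * + 2)) + + 2 * (t + t′)) e) (lem₂ (q * q * + 2 + q * q * + 2) (+ 2 * (t + t′))))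
            where
            lem₁ : ∀ q d₂ d t t′ → + 2 * (q * (d₂ + d)) ≡ ((((+ 2 * q * d₂ + + 2 * (q * q)) - + 2 * t′) + ((+ 2 * q * d + + 2 * (q * q)) - + 2 * t)) - (q * q * + 2 + q * q * + 2)) + + 2 * (t + t′)
            lem₁ = solve-∀
            lem₂ : ∀ z s → (z - z) + s ≡ s
            lem₂ = solve-∀

        -- Apply `pD` at yⁱ: its second argument (σyⁱ)⁻¹ lies in ⟨y′⟩, the coset of ε.
        p∣sum : ∀ i → + p ∣ ⟪ D ⟫ (y ^ i) + ⟪ D ⟫ ε
        p∣sum i = divides (D₂ (y ^ i) + D (y ^ i)) (trans (cong (_+_ (⟪ D ⟫ (y ^ i))) (sym on-⟨y′⟩)) (trans (sym (pD (y ^ i))) (ℤₚ.*-comm (+ p) _)))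
          where
          on-⟨y′⟩ : ⟪ D ⟫ ((σ (y ^ i)) ⁻¹) ≡ ⟪ D ⟫ ε
          on-⟨y′⟩ = trans (cong ⟪ D ⟫ (trans (cong _⁻¹ (σ-^ y i)) (sym (identityˡ _)))) (⟪⟫-shift D ε (∈⟨⟩-⁻¹ (i , refl)))

        -- For i = 0 the previous sum is twice this number, and p - 2m = 1 removes the 2.
        p∣⟪D⟫ε : + p ∣ ⟪ D ⟫ ε
        p∣⟪D⟫ε = subst (+ p ∣_) eq (∣m∣n⇒∣m-n (∣m⇒∣m*n {+ p} {+ p} (⟪ D ⟫ ε) ∣-refl) (∣n⇒∣m*n (+ m) (p∣sum 0)))
          where
          eq : + p * ⟪ D ⟫ ε - + m * (⟪ D ⟫ ε + ⟪ D ⟫ ε) ≡ ⟪ D ⟫ ε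
          eq = trans (cong (λ z → z * ⟪ D ⟫ ε - + m * (⟪ D ⟫ ε + ⟪ D ⟫ ε)) (trans (cong +_ p-odd) (cong (_+_ 1ℤ) (ℤₚ.pos-* 2 m)))) (lem (+ m) (⟪ D ⟫ ε))
            where
            lem : ∀ m z → (1ℤ + + 2 * m) * z - m * (z + z) ≡ z
            lem = solve-∀

        p∣⟪D⟫ : ∀ i → + p ∣ ⟪ D ⟫ (y ^ i)
        p∣⟪D⟫ i = ∣m+n∣n⇒∣m {+ p} {⟪ D ⟫ (y ^ i)} (p∣sum i) p∣⟪D⟫ε

        a′ b′ u v w : ℕ → ℤ
        a′ = project a
        b′ = project b
        u i = Corr a′ a′ i 0
        v i = Corr b′ b′ i 0
        -- The value U ε = p is replaced by 0, so that W is the sum over σN without the identity and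
        -- `u-form` holds at 0 as well.
        w zero    = 0ℤ
        w (suc l) = U (y′ ^ suc l)

        at-y^ : ∀ f i → ⟪ f ⟫ ((y ^ i) ∙ ((y ^ 0) ⁻¹)) ≡ ⟪ f ⟫ (y ^ i)
        at-y^ f i = cong ⟪ f ⟫ (trans (cong ((y ^ i) ∙_) ε⁻¹≈ε) (identityʳ _))

        u≡ : ∀ i → u i ≡ ⟪ U ⟫ (y ^ i)
        u≡ i = trans (project-corr a a i 0) (at-y^ U i)

        v≡ : ∀ i → v i ≡ ⟪ V ⟫ (y ^ i)
        v≡ i = trans (project-corr b b i 0) (at-y^ V i)

        -- Apply `U-twist` at y′ᵈ, which σ sends to yᵈ. For d ≠ 0 the element yᵈ is in N ∖ {ε},
        -- where U vanishes, and the coset sum of U at y′ᵈ is the one at ε, that is u 0.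
        u-form : ∀ d → d ℕ.< p → u d ≡ u 0 - + p * w d
        u-form zero    _   = lem (u 0) (+ p)
          where
          lem : ∀ z q → z ≡ z - q * 0ℤ
          lem = solve-∀
        u-form (suc l) d<p = trans (u≡ (suc l)) (trans (lem (+ p) (U (y′ ^ suc l)) (⟪ U ⟫ (y ^ suc l)) (u 0) twist) refl)
          where
          twist : + p * U (y′ ^ suc l) - u 0 ≡ + p * 0ℤ - ⟪ U ⟫ (y ^ suc l)
          twist = begin
            + p * U (y′ ^ suc l) - u 0                              ≡⟨ cong (_-_ (+ p * U (y′ ^ suc l))) (trans (u≡ 0) (trans (sym (⟪⟫-shift U ε (suc l , refl))) (trans (cong ⟪ U ⟫ (identityˡ (y′ ^ suc l))) (sym (⊛ν̂ U (y′ ^ suc l)))))) ⟩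
            + p * U (y′ ^ suc l) - L (y′ ^ suc l)                   ≡⟨ U-twist (y′ ^ suc l) ⟩
            + p * U (σ (y′ ^ suc l)) - L (σ (y′ ^ suc l))           ≡⟨ cong (λ z → + p * U z - L z) (σ-y′^ (suc l)) ⟩
            + p * U (y ^ suc l) - L (y ^ suc l)                     ≡⟨ cong₂ (λ s t → + p * s - t) (U-N (y ^ suc l) (y^∈N (suc l)) (y^≢ε (s≤s z≤n) d<p)) (⊛ν̂ U (y ^ suc l)) ⟩
            + p * 0ℤ - ⟪ U ⟫ (y ^ suc l)                            ∎
            where open ≡-Reasoning
          lem : ∀ q s t z → q * s - z ≡ q * 0ℤ - t → t ≡ z - q * s
          lem q s t z e = trans (lem₁ q t) (trans (cong -_ (sym e)) (lem₂ q s z))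
            where
            lem₁ : ∀ q t → t ≡ - (q * 0ℤ - t)
            lem₁ = solve-∀
            lem₂ : ∀ q s z → - (q * s - z) ≡ z - q * s
            lem₂ = solve-∀

        u+v : ∀ i → u i + v i ≡ + 2 * + p * S p (λ l → δ ((y ^ i) ∙ (y′ ^ l)) ε) + (+ 2 * + p - + 2)
        u+v i = trans (cong₂ _+_ (u≡ i) (v≡ i)) (trans (sym (∑-⊕ (upTo p) (λ l → U ((y ^ i) ∙ (y′ ^ l))) (λ l → V ((y ^ i) ∙ (y′ ^ l)))))
          (trans (∑-cong (upTo p) (λ l → autocorr ((y ^ i) ∙ (y′ ^ l)))) (κ-coset σy∉N (y ^ i))))

        v₀ : v 0 ≡ (+ 4 * + p - + 2) - u 0
        v₀ = trans (lem₁ (u 0) (v 0)) (cong (_- u 0) (trans (u+v 0) (trans (cong (λ z → + 2 * + p * z + (+ 2 * + p - + 2)) one) (lem₂ (+ p)))))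
          where
          lem₁ : ∀ u v → v ≡ (u + v) - u
          lem₁ = solve-∀
          lem₂ : ∀ q → + 2 * q * 1ℤ + (+ 2 * q - + 2) ≡ + 4 * q - + 2
          lem₂ = solve-∀
          one : S p (λ l → δ ((y ^ 0) ∙ (y′ ^ l)) ε) ≡ 1ℤ
          one = trans (S-single0 p (λ l → δ (ε ∙ (y′ ^ l)) ε) (λ l 0<l l<p → δ-≢ (λ e → ∉N (⟨⟩∩N σy∉N 0<l l<p) (trans (cong N (trans (sym (identityˡ _)) e)) N-ε))))
                      (trans (cong (λ z → δ z ε) (identityˡ ε)) (δ-refl ε))

        v-form : ∀ d → 0 ℕ.< d → d ℕ.< p → v d ≡ (+ 2 * + p - + 2) - u d
        v-form d 0<d d<p = trans (lem₁ (u d) (v d)) (cong (_- u d) (trans (u+v d) (trans (cong (λ z → + 2 * + p * z + (+ 2 * + p - + 2)) none) (lem₂ (+ p)))))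
          where
          lem₁ : ∀ u v → v ≡ (u + v) - u
          lem₁ = solve-∀
          lem₂ : ∀ q → + 2 * q * 0ℤ + (+ 2 * q - + 2) ≡ + 2 * q - + 2
          lem₂ = solve-∀
          none : S p (λ l → δ ((y ^ d) ∙ (y′ ^ l)) ε) ≡ 0ℤ
          none = ∑-zero (upTo p) (λ l → δ-≢ (λ e → N∌⟨⟩ σy∉N (y^∈N d) (y^≢ε 0<d d<p) (subst (_∈⟨ y′ ⟩) (sym (inverseˡ-unique (y ^ d) (y′ ^ l) e)) (∈⟨⟩-⁻¹ (l , refl)))))

        W : ℤ
        W = S p w

        W≡ : W ≡ S r (λ l → U (y′ ^ suc l))
        W≡ = trans (S-pred p w) (ℤₚ.+-identityˡ _)

        -- Sum `u-form` over d; the values of u add up to (Σ a)² = p².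
        u₀ : u 0 ≡ + p + W
        u₀ = *-cancel-p (lem (+ p) (u 0) W (trans (sym total-u) (trans (S-Corr {a′} {a′} (project-per a)) (cong₂ _*_ (trans (Σ-project a) Σa) (trans (Σ-project a) Σa)))))
          where
          total-u : S p u ≡ + p * u 0 - + p * W
          total-u = trans (S-cong< p u-form) (trans (∑-- (upTo p) (λ _ → u 0) (λ d → + p * w d)) (cong₂ _-_ (S-const p (u 0)) (∑-*ˡ (upTo p) (+ p) w)))
          lem : ∀ q s t → q * s - q * t ≡ q * q → q * s ≡ q * (q + t)
          lem q s t e = trans (lem₁ q s t) (trans (cong (_+ q * t) e) (lem₂ q t))
            where
            lem₁ : ∀ q s t → q * s ≡ (q * s - q * t) + q * t
            lem₁ = solve-∀
            lem₂ : ∀ q t → q * q + q * t ≡ q * (q + t)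
            lem₂ = solve-∀

        W₂ : ℤ
        W₂ = S r (λ l → U (y′ ^ suc l) * U (y′ ^ suc l))

        energy-uv : S p (λ d → u d * v d) ≡ + p * ((+ p * + p + W * (W + + 2)) - + p * W₂)
        energy-uv = begin
          S p (λ d → u d * v d)
            ≡⟨ S-pred p (λ d → u d * v d) ⟩
          u 0 * v 0 + S r (λ l → u (suc l) * v (suc l))
            ≡⟨ cong₂ (λ s t → u 0 * s + t) v₀ (S-cong< r (λ l l<r → trans (cong (u (suc l) *_) (v-form (suc l) (s≤s z≤n) (<p l<r))) (trans (cong (λ z → z * ((+ 2 * + p - + 2) - z)) (u-form (suc l) (<p l<r))) (expand (u 0) (+ p) (f l))))) ⟩
          u 0 * ((+ 4 * + p - + 2) - u 0) + S r (λ l → (c₁ + c₂ * f l) - + p * + p * (f l * f l))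
            ≡⟨ cong (_+_ (u 0 * ((+ 4 * + p - + 2) - u 0))) (trans (∑-- (upTo r) (λ l → c₁ + c₂ * f l) (λ l → + p * + p * (f l * f l)))
                 (cong₂ _-_ (trans (∑-⊕ (upTo r) (λ _ → c₁) (λ l → c₂ * f l)) (cong₂ _+_ (S-const r c₁) (trans (∑-*ˡ (upTo r) c₂ f) (cong (c₂ *_) (sym W≡)))))
                            (∑-*ˡ (upTo r) (+ p * + p) (λ l → f l * f l)))) ⟩
          u 0 * ((+ 4 * + p - + 2) - u 0) + ((+ r * c₁ + c₂ * W) - + p * + p * W₂)
            -- Writing p as 1 + r, where r = p - 1 is the number of remaining terms, makes both
            -- sides polynomials in r, W and W₂ for the ring solver.
            ≡⟨ cong₂ (λ z q → z * ((+ 4 * q - + 2) - z) + ((+ r * (z * ((+ 2 * q - + 2) - z)) + (q * ((+ 2 * z - + 2 * q) + + 2)) * W) - q * q * W₂)) u₀ (sym p≡1+r) ⟩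
          (+ p + W) * ((+ 4 * (1ℤ + + r) - + 2) - (+ p + W)) + ((+ r * ((+ p + W) * ((+ 2 * (1ℤ + + r) - + 2) - (+ p + W))) + ((1ℤ + + r) * ((+ 2 * (+ p + W) - + 2 * (1ℤ + + r)) + + 2)) * W) - (1ℤ + + r) * (1ℤ + + r) * W₂)
            ≡⟨ cong (λ q → (q + W) * ((+ 4 * (1ℤ + + r) - + 2) - (q + W)) + ((+ r * ((q + W) * ((+ 2 * (1ℤ + + r) - + 2) - (q + W))) + ((1ℤ + + r) * ((+ 2 * (q + W) - + 2 * (1ℤ + + r)) + + 2)) * W) - (1ℤ + + r) * (1ℤ + + r) * W₂)) (sym p≡1+r) ⟩
          ((1ℤ + + r) + W) * ((+ 4 * (1ℤ + + r) - + 2) - ((1ℤ + + r) + W)) + ((+ r * (((1ℤ + + r) + W) * ((+ 2 * (1ℤ + + r) - + 2) - ((1ℤ + + r) + W))) + ((1ℤ + + r) * ((+ 2 * ((1ℤ + + r) + W) - + 2 * (1ℤ + + r)) + + 2)) * W) - (1ℤ + + r) * (1ℤ + + r) * W₂)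
            ≡⟨ simplify (+ r) W W₂ ⟩
          (1ℤ + + r) * (((1ℤ + + r) * (1ℤ + + r) + W * (W + + 2)) - (1ℤ + + r) * W₂)
            ≡⟨ cong (λ q → q * ((q * q + W * (W + + 2)) - q * W₂)) p≡1+r ⟩
          + p * ((+ p * + p + W * (W + + 2)) - + p * W₂) ∎
          where
          open ≡-Reasoning
          p≡1+r : 1ℤ + + r ≡ + p
          p≡1+r = cong +_ 1+r
          <p : ∀ {l} → l ℕ.< r → suc l ℕ.< p
          <p l<r = subst (_ ℕ.<_) 1+r (s≤s l<r)
          f : ℕ → ℤ
          f l = U (y′ ^ suc l)
          c₁ c₂ : ℤ
          c₁ = u 0 * ((+ 2 * + p - + 2) - u 0)
          c₂ = + p * ((+ 2 * u 0 - + 2 * + p) + + 2)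
          expand : ∀ z q f → (z - q * f) * ((+ 2 * q - + 2) - (z - q * f)) ≡ (z * ((+ 2 * q - + 2) - z) + (q * ((+ 2 * z - + 2 * q) + + 2)) * f) - q * q * (f * f)
          expand = solve-∀
          simplify : ∀ r W W₂ → ((1ℤ + r) + W) * ((+ 4 * (1ℤ + r) - + 2) - ((1ℤ + r) + W)) + ((r * (((1ℤ + r) + W) * ((+ 2 * (1ℤ + r) - + 2) - ((1ℤ + r) + W))) + ((1ℤ + r) * ((+ 2 * ((1ℤ + r) + W) - + 2 * (1ℤ + r)) + + 2)) * W) - (1ℤ + r) * (1ℤ + r) * W₂)
                       ≡ (1ℤ + r) * (((1ℤ + r) * (1ℤ + r) + W * (W + + 2)) - (1ℤ + r) * W₂)
          simplify = solve-∀

        -- Σ_d u(d) v(d) is also the energy of the correlation of b′ with a′, whose values are divisible by p.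
        p∣W[W+2] : + p ∣ W * (W + + 2)
        p∣W[W+2] = subst (+ p ∣_) (lem (+ p) W W₂)
          (∣m∣n⇒∣m-n (∣m∣n⇒∣m+n (*-cancelˡ-∣ (+ p) {+ p} {(+ p * + p + W * (W + + 2)) - + p * W₂} p²∣) (∣m⇒∣m*n {+ p} {+ p} W₂ ∣-refl)) (∣m⇒∣m*n {+ p} {+ p} (+ p) ∣-refl))
          where
          lem : ∀ q W z → (((q * q + W * (W + + 2)) - q * z) + q * z) - q * q ≡ W * (W + + 2)
          lem = solve-∀
          square : ∀ {z} → + p ∣ z → + p * + p ∣ z * z
          square (divides k refl) = divides (k * k) (lem′ k (+ p))
            where
            lem′ : ∀ k q → (k * q) * (k * q) ≡ (k * k) * (q * q)
            lem′ = solve-∀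
          p²∣ : + p * + p ∣ + p * ((+ p * + p + W * (W + + 2)) - + p * W₂)
          p²∣ = subst (+ p * + p ∣_) (trans (S-Corr² {a′} {b′} (project-per a) (project-per b)) energy-uv)
            (∑-∣ (upTo p) (λ i → square (subst (+ p ∣_) (sym (trans (project-corr b a i 0) (at-y^ D i))) (p∣⟪D⟫ i))))

        -- Modulo 2 the energy u 0 = p + W of `a′` agrees with its sum p.
        W-even : + 2 ∣ W
        W-even = subst (+ 2 ∣_) eq (∑-∣ (upTo p) (λ j → 2∣z²-z (a′ j)))
          where
          lem : ∀ q W → (q + W) - q ≡ W
          lem = solve-∀
          eq : S p (λ j → a′ j * a′ j - a′ j) ≡ W
          eq = trans (∑-- (upTo p) (λ j → a′ j * a′ j) a′) (trans (cong₂ _-_ (trans (∑-cong (upTo p) (λ j → cong₂ (λ s t → a′ s * a′ t) (sym (ℕₚ.+-identityʳ j)) (sym (ℕₚ.+-identityʳ j)))) u₀) (trans (Σ-project a) Σa)) (lem (+ p) W))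

        <r⇒∉N : ∀ {l} → l ℕ.< r → N (y′ ^ suc l) ≡ false
        <r⇒∉N {l} l<r = ⟨⟩∩N σy∉N (s≤s z≤n) (subst (suc l ℕ.<_) 1+r (s≤s l<r))

      U-vanishes V-vanishes : Set
      U-vanishes = ∀ l → l ℕ.< ℕ.pred p → U (σ y ^ suc l) ≡ 0ℤ
      V-vanishes = ∀ l → l ℕ.< ℕ.pred p → V (σ y ^ suc l) ≡ 0ℤ

      private
        W≥0 : 0ℤ ≤ W
        W≥0 = subst (0ℤ ≤_) (sym W≡) (S-≥0< r (λ l _ → U≥0 (y′ ^ suc l)))

        2r-W≥0 : 0ℤ ≤ + r * + 2 - W
        2r-W≥0 = subst (0ℤ ≤_) (trans (∑-- (upTo r) (λ _ → + 2) (λ l → U (y′ ^ suc l))) (cong₂ _-_ (S-const r (+ 2)) (sym W≡)))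
          (S-≥0< r (λ l l<r → ℤₚ.i≤j⇒0≤j-i (U≤2 (<r⇒∉N l<r))))

        W≡0⇒ : W ≡ 0ℤ → U-vanishes
        W≡0⇒ e = S-zero⁻ r (λ l _ → U≥0 (y′ ^ suc l)) (trans (sym W≡) e)

        W≡2r⇒ : W ≡ + r * + 2 → V-vanishes
        W≡2r⇒ e l l<r = trans (lem (U (y′ ^ suc l)) (V (y′ ^ suc l))) (trans (cong₂ _-_ (trans (autocorr (y′ ^ suc l)) (κ-∉N (<r⇒∉N l<r)))
          (S-tight r (λ l l<r → U≤2 (<r⇒∉N l<r)) (trans (sym W≡) (trans e (sym (S-const r (+ 2))))) l l<r)) refl)
          where
          lem : ∀ u v → v ≡ (u + v) - u
          lem = solve-∀

        -- Here 0 ≤ W ≤ 2(p - 1) and W is even. So p | W leaves W = 0, and p | W + 2 leaves W + 2 =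
        -- 2p; the multiple p itself is odd. In the second case every value of U reaches its bound
        -- 2, and V vanishes.
        nat-case : ∀ n → W ≡ + n → n ℕ.≤ r ℕ.* 2 → + p ∣ + n ⊎ + p ∣ + n + + 2 → U-vanishes ⊎ V-vanishes
        nat-case n W≡n n≤2r = [ first ∘ ∣⇒∣ᵤ , second ∘ ∣⇒∣ᵤ ]′
          where
          2∣n : + 2 ∣ + n
          2∣n = subst (+ 2 ∣_) W≡n W-even
          2r<2p : r ℕ.* 2 ℕ.< 2 ℕ.* p
          2r<2p = subst (r ℕ.* 2 ℕ.<_) (ℕₚ.*-comm p 2) (ℕₚ.*-monoˡ-< 2 (subst (r ℕ.<_) 1+r ℕₚ.≤-refl))
          first : p ℕ∣.∣ n → U-vanishes ⊎ V-vanishes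
          first (ℕ∣.divides zero e) = inj₁ (W≡0⇒ (trans W≡n (cong +_ e)))
          first (ℕ∣.divides (suc zero) e) = ⊥-elim (2∤p (subst (λ z → + 2 ∣ + z) (trans e (ℕₚ.*-identityˡ p)) 2∣n))
          first (ℕ∣.divides (suc (suc k)) e) = ⊥-elim (ℕₚ.<⇒≱ (ℕₚ.≤-<-trans n≤2r 2r<2p) (subst (2 ℕ.* p ℕ.≤_) (sym e) (ℕₚ.*-monoˡ-≤ p {2} {suc (suc k)} (s≤s (s≤s z≤n)))))
          second : p ℕ∣.∣ n ℕ.+ 2 → U-vanishes ⊎ V-vanishes
          second (ℕ∣.divides zero e) = ⊥-elim (ℕₚ.m+1+n≢0 n e)
          second (ℕ∣.divides (suc zero) e) = ⊥-elim (2∤p (subst (λ z → + 2 ∣ + z) (trans e (ℕₚ.*-identityˡ p)) (∣m∣n⇒∣m+n 2∣n (divides 1ℤ refl))))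
          second (ℕ∣.divides (suc (suc zero)) e) = inj₂ (W≡2r⇒ (trans W≡n (trans (cong +_ (ℕₚ.+-cancelʳ-≡ 2 n (r ℕ.* 2) (trans e (trans (cong (2 ℕ.*_) (sym 1+r)) (lem r))))) (ℤₚ.pos-* r 2))))
            where
            lem : ∀ r → 2 ℕ.* suc r ≡ r ℕ.* 2 ℕ.+ 2
            lem = ℕ-solve-∀
          second (ℕ∣.divides (suc (suc (suc k))) e) = ⊥-elim (ℕₚ.<⇒≱ (ℕₚ.≤-<-trans (ℕₚ.+-monoˡ-≤ 2 n≤2r) (subst (ℕ._< 3 ℕ.* p) (lem r) (ℕₚ.≤-<-trans (ℕₚ.≤-reflexive (cong (2 ℕ.*_) 1+r)) (ℕₚ.*-monoˡ-< p {2} {3} ℕₚ.≤-refl))))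
                                                        (subst (3 ℕ.* p ℕ.≤_) (sym e) (ℕₚ.*-monoˡ-≤ p {3} {suc (suc (suc k))} (s≤s (s≤s (s≤s z≤n))))))
            where
            lem : ∀ r → 2 ℕ.* suc r ≡ r ℕ.* 2 ℕ.+ 2
            lem = ℕ-solve-∀

      vanishing : U-vanishes ⊎ V-vanishes
      vanishing = go W refl W≥0 2r-W≥0 (∣-prime pr {W} {W + + 2} p∣W[W+2])
        where
        go : ∀ z → W ≡ z → 0ℤ ≤ z → 0ℤ ≤ + r * + 2 - z → + p ∣ W ⊎ + p ∣ W + + 2 → U-vanishes ⊎ V-vanishes
        go (+ n) e _ h d = nat-case n e (ℤₚ.drop‿+≤+ (subst (+ n ≤_) (sym (ℤₚ.pos-* r 2)) (ℤₚ.0≤i-j⇒j≤i h))) (subst (λ z → + p ∣ z ⊎ + p ∣ z + + 2) e d)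

      -- With U zero on σN ∖ {ε}, `u-form` makes u constant, so L is constant and U is σ-invariant.
      -- Then U is summed over the σ-stable coset k⟨z⟩: the pairing by σ makes the sum even, while
      -- `odd-on-cosets` makes it odd.
      contradiction-nonnormal : U-vanishes → ⊥
      contradiction-nonnormal vanish = 2∤p (∣-minus′ (involution-parity σ σσ f fσ f-even))
        where
        u-const : ∀ d → d ℕ.< p → u d ≡ u 0
        u-const zero    _   = refl
        u-const (suc l) d<p = trans (u-form (suc l) d<p) (trans (cong (λ z → u 0 - + p * z) (vanish l (ℕ.s≤s⁻¹ (subst (suc l ℕ.<_) (sym 1+r) d<p)))) (lem (u 0) (+ p)))
          where
          lem : ∀ z q → z - q * 0ℤ ≡ z
          lem = solve-∀
        L-const : ∀ x → L x ≡ u 0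
        L-const x = go (coord x)
          where
          go : (∃₂ λ j i → j ℕ.< p × i ℕ.< p × x ≡ (y ^ j) ∙ (y′ ^ i)) → L x ≡ u 0
          go (j , i , j<p , _ , e) = trans (⊛ν̂ U x) (trans (cong ⟪ U ⟫ e) (trans (⟪⟫-shift U (y ^ j) (i , refl)) (trans (sym (u≡ j)) (u-const j j<p))))
        invariant : ∀ x → U x ≡ U (σ x)
        invariant = U-σ (λ x → trans (L-const x) (sym (L-const (σ x))))

        z k : X
        z = y ∙ (y′ ⁻¹)
        k = y ∙ y′
        y′⁻¹∉N : N (y′ ⁻¹) ≡ false
        y′⁻¹∉N = trans (N-inv y′) σy∉N
        z∉N : N z ≡ false
        z∉N = trans (N-absorb y (y′ ⁻¹) y∈N) y′⁻¹∉N
        σz : σ z ≡ z ⁻¹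
        σz = trans (σ-∙ y (y′ ⁻¹)) (trans (cong (y′ ∙_) (trans (σ-⁻¹ y′) (cong _⁻¹ (σσ y)))) (trans (comm _ _) (trans (cong ((y ⁻¹) ∙_) (sym (⁻¹-involutive y′))) (⁻¹-∙-comm y (y′ ⁻¹)))))
        σk : σ k ≡ k
        σk = trans (σ-∙ y y′) (trans (cong (y′ ∙_) (σσ y)) (comm _ _))
        2<p : 2 ℕ.< p
        2<p = ℕₚ.≤∧≢⇒< 1<p (λ e → 2∤p (subst (λ z → + 2 ∣ + z) e (divides 1ℤ refl)))
        -- Otherwise kz = y², a nontrivial element of N because p > 2, would lie in ⟨z⟩.
        k∉⟨z⟩ : ¬ (k ∈⟨ z ⟩)
        k∉⟨z⟩ k∈ = N∌⟨⟩ z∉N (y^∈N 2) (y^≢ε (s≤s z≤n) 2<p) (subst (_∈⟨ z ⟩) eq (∈⟨⟩-∙ k∈ (1 , sym (identityʳ z))))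
          where
          eq : k ∙ z ≡ y ^ 2
          eq = trans (interchange y y′ y (y′ ⁻¹)) (trans (cong ((y ∙ y) ∙_) (inverseʳ y′)) (assoc y y ε))

        μ f : X → ℤ
        μ x = S p (λ l → δ x (k ∙ (z ^ l)))
        f x = μ x * U x

        Σf : Σ* f ≡ Coset.⟪_⟫ z U k
        Σf = trans (∑-cong E (λ x → sym (∑-*ʳ (upTo p) (U x) (λ l → δ x (k ∙ (z ^ l)))))) (trans (∑-swap E (upTo p) (λ x l → δ x (k ∙ (z ^ l)) * U x))
          (∑-cong (upTo p) (λ l → Σ-δ (k ∙ (z ^ l)) U)))

        δ-σ : ∀ x c → δ (σ x) c ≡ δ x (σ c)
        δ-σ x c = go (x ≟ σ c)
          where
          go : Dec (x ≡ σ c) → δ (σ x) c ≡ δ x (σ c)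
          go (yes refl) = trans (cong (λ t → δ t c) (σσ c)) (trans (δ-refl c) (sym (δ-refl (σ c))))
          go (no n)     = trans (δ-≢ (λ e → n (trans (sym (σσ x)) (cong σ e)))) (sym (δ-≢ n))

        fσ : ∀ x → f (σ x) ≡ f x
        fσ x = cong₂ _*_ (trans (∑-cong (upTo p) (λ l → δ-σ x (k ∙ (z ^ l)))) (trans (Coset.⟪⟫-σ z (inj₂ σz) (δ x) k) (cong (λ c → S p (λ l → δ x (c ∙ (z ^ l)))) σk))) (sym (invariant x))

        f-even : ∀ x → σ x ≡ x → + 2 ∣ f x
        f-even x e = go (x ≟ ε) (N x) refl
          where
          go : Dec (x ≡ ε) → ∀ c → N x ≡ c → + 2 ∣ f x
          -- The identity has to be excluded from the coset, since U ε = p is odd.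
          go (yes refl) _ _ = ∣m⇒∣m*n (U ε) (subst (+ 2 ∣_) (sym (∑-zero (upTo p) (λ l → δ-≢ (λ eq → k∉⟨z⟩ (subst (_∈⟨ z ⟩) (sym (inverseˡ-unique k (z ^ l) (sym eq))) (∈⟨⟩-⁻¹ (l , refl))))))) (divides 0ℤ refl))
          go (no x≢ε) true  x∈N = ∣n⇒∣m*n (μ x) (subst (+ 2 ∣_) (sym (U-N x x∈N x≢ε)) (divides 0ℤ refl))
          go (no x≢ε) false x∉N = ∣n⇒∣m*n (μ x) (Key.even x∉N (inj₁ e))

        ∣-minus′ : + 2 ∣ Σ* f → + 2 ∣ + p
        ∣-minus′ d = ∣-minus {+ 2} {Coset.⟪_⟫ z U k} {+ p} (subst (+ 2 ∣_) Σf d) (Key.odd-on-cosets z∉N (inj₂ σz) k k∉⟨z⟩)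

-- Finite groups of order 2p²

¬true⇒false : ∀ {b} → ¬ (b ≡ true) → b ≡ false
¬true⇒false {true}  n = contradiction refl n
¬true⇒false {false} n = refl

true≢false : ∀ {b} → b ≡ true → b ≡ false → ⊥
true≢false refl ()

∧-intro : ∀ {b c} → b ≡ true → c ≡ true → b ∧ c ≡ true
∧-intro refl refl = refl

∧-elim : ∀ {b c} → b ∧ c ≡ true → b ≡ true × c ≡ true
∧-elim {true} {true} _ = refl , refl

∑-[]-ℕ : {X : Set} (xs : List X) (q : X → Bool) → ∃ λ k → ∑ xs (λ x → [ q x ]) ≡ + k
∑-[]-ℕ []       q = 0 , refl
∑-[]-ℕ (x ∷ xs) q with q x | ∑-[]-ℕ xs q
... | true  | k , e = suc k , cong (_+_ 1ℤ) e
... | false | k , e = k , trans (ℤₚ.+-identityˡ _) e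

[]-mono : ∀ {b c} → (b ≡ true → c ≡ true) → [ b ] ≤ [ c ]
[]-mono {false} {c}    h = 0≤[] c
[]-mono {true}  {true} h = ℤₚ.≤-refl
[]-mono {true}  {false} h with () ← h refl

[]≡1 : ∀ {b} → [ b ] ≡ 1ℤ → b ≡ true
[]≡1 {true} _ = refl

witness : ∀ {A : Set} (d : Dec A) → does d ≡ true → A
witness (yes a) _ = a

module _ {X : Set} where

  find : (X → Bool) → X → List X → X
  find q d []       = d
  find q d (x ∷ xs) = if q x then x else find q d xs

  find-sat : ∀ (q : X → Bool) d xs → q d ≡ true → q (find q d xs) ≡ true
  find-sat q d []       qd = qd
  find-sat q d (x ∷ xs) qd with q x in eq
  ... | true  = eq
  ... | false = find-sat q d xs qd

  -- As soon as some entry satisfies the predicate, the default is never reached. In `lagrange` this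
  -- makes the representative depend on the coset alone.
  find-ext : ∀ {q q′ : X → Bool} d d′ xs {a} → (∀ x → q x ≡ q′ x) → a ∈ xs → q a ≡ true → find q d xs ≡ find q′ d′ xs
  find-ext {q} {q′} d d′ (x ∷ xs) ext i qa rewrite sym (ext x) with q x in eq
  find-ext d d′ (x ∷ xs) ext i qa           | true  = refl
  find-ext d d′ (x ∷ xs) ext (here refl) qa | false = ⊥-elim (true≢false qa eq)
  find-ext d d′ (x ∷ xs) ext (there i) qa   | false = find-ext d d′ xs ext i qa

module FinGroupTheory {X : Set} (F : Finite X) {_∙_ : X → X → X} {ε : X} {_⁻¹ : X → X}
                      (isGroup : IsGroup _≡_ _∙_ ε _⁻¹) where

  open GroupSum F isGroup

  private
    E : List X
    E = elems F

  card : (X → Bool) → ℤ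
  card q = Σ* (λ x → [ q x ])

  at-most-one : (q : X → Bool) → (∀ {x y} → q x ≡ true → q y ≡ true → x ≡ y) → card q ≤ 1ℤ
  at-most-one q uniq = [ (λ { (a , qa) → subst (_≤ 1ℤ) (sym (∑-at F a (λ x x≢a → cong [_] (¬true⇒false (λ qx → x≢a (uniq qx qa)))))) ([]≤1 (q a)) })
                       , (λ none → subst (_≤ 1ℤ) (sym (∑-zero E (λ x → cong [_] (none x)))) (+≤+ z≤n)) ]′ (search F q)

  card-tight : (q r : X → Bool) → (∀ {x} → q x ≡ true → r x ≡ true) → card q ≡ card r → ∀ {x} → r x ≡ true → q x ≡ true
  card-tight q r sub e {x} rx = []≡1 (trans (∑-tight (λ x → []-mono (sub {x})) e (complete x)) (cong [_] rx))

  record IsSub (H : X → Bool) : Set where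
    field
      ε∈  : H ε ≡ true
      ∙∈  : ∀ {x y} → H x ≡ true → H y ≡ true → H (x ∙ y) ≡ true
      ⁻¹∈ : ∀ {x} → H x ≡ true → H (x ⁻¹) ≡ true

    absorbˡ : ∀ {u} v → H u ≡ true → H (u ∙ v) ≡ H v
    absorbˡ {u} v hu with H v in eq
    ... | true  = ∙∈ hu eq
    ... | false = ¬true⇒false (λ h → true≢false (trans (cong H (sym (x⁻¹∙xy u v))) (∙∈ (⁻¹∈ hu) h)) eq)

    absorbʳ : ∀ {u} v → H u ≡ true → H (v ∙ u) ≡ H v
    absorbʳ {u} v hu with H v in eq
    ... | true  = ∙∈ eq hu
    ... | false = ¬true⇒false (λ h → true≢false (trans (cong H (sym (yx∙x⁻¹ u v))) (∙∈ h (⁻¹∈ hu))) eq)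

  open IsSub

  -- A left coset xS is represented by its first element in the enumeration of the group.
  lagrange : ∀ {S H} → IsSub S → IsSub H → (∀ {x} → S x ≡ true → H x ≡ true) → ∃ λ c → card H ≡ + c * card S
  lagrange {S} {H} sS sH S⊆H = c , (begin
    card H                                                            ≡⟨ ∑-cong E (λ x → sym (trans (Σ-δ (rep x) (λ _ → [ H x ])) refl)) ⟩
    Σ* (λ x → Σ* (λ r → δ r (rep x) * [ H x ]))                       ≡⟨ ∑-swap E E _ ⟩
    Σ* (λ r → Σ* (λ x → δ r (rep x) * [ H x ]))                       ≡⟨ ∑-cong E (λ r → trans (∑-cong E (λ x → pointwise r x)) (trans (∑-*ˡ E [ isRep r ] _) (cong ([ isRep r ] *_) (coset-card r)))) ⟩
    Σ* (λ r → [ isRep r ] * card S)                                   ≡⟨ ∑-*ʳ E (card S) (λ r → [ isRep r ]) ⟩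
    card isRep * card S                                               ≡⟨ cong (_* card S) (proj₂ (∑-[]-ℕ E isRep)) ⟩
    + c * card S                                                      ∎)
    where
    open ≡-Reasoning
    rep : X → X
    rep x = find (λ y → S ((x ⁻¹) ∙ y)) x E
    rep-∈ : ∀ x → S ((x ⁻¹) ∙ rep x) ≡ true
    rep-∈ x = find-sat (λ y → S ((x ⁻¹) ∙ y)) x E (trans (cong S (inverseˡ x)) (ε∈ sS))
    rep-eq : ∀ {x y} → S ((x ⁻¹) ∙ y) ≡ true → rep x ≡ rep y
    rep-eq {x} {y} h = find-ext x y E (λ z → trans (cong S (split z)) (absorbˡ sS ((y ⁻¹) ∙ z) h)) (complete x) (trans (cong S (inverseˡ x)) (ε∈ sS))
      where
      split : ∀ z → (x ⁻¹) ∙ z ≡ ((x ⁻¹) ∙ y) ∙ ((y ⁻¹) ∙ z)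
      split z = sym (trans (assoc (x ⁻¹) y _) (cong ((x ⁻¹) ∙_) (x∙x⁻¹y y z)))
    isRep : X → Bool
    isRep r = does (r ≟ rep r) ∧ H r
    c = proj₁ (∑-[]-ℕ E isRep)
    H-rep : ∀ x r → S ((r ⁻¹) ∙ x) ≡ true → H x ≡ H r
    H-rep x r h = trans (cong H (sym (x∙x⁻¹y r x))) (absorbʳ sH r (S⊆H h))
    pointwise : ∀ r x → δ r (rep x) * [ H x ] ≡ [ isRep r ] * [ S ((r ⁻¹) ∙ x) ]
    pointwise r x = go (r ≟ rep x) (S ((r ⁻¹) ∙ x)) refl
      where
      flip : S ((r ⁻¹) ∙ x) ≡ true → S ((x ⁻¹) ∙ r) ≡ true
      flip h = trans (cong S (sym (trans (⁻¹-anti-homo-∙ (r ⁻¹) x) (cong ((x ⁻¹) ∙_) (⁻¹-involutive r))))) (⁻¹∈ sS h)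
      go : Dec (r ≡ rep x) → ∀ b → S ((r ⁻¹) ∙ x) ≡ b → δ r (rep x) * [ H x ] ≡ [ isRep r ] * [ b ]
      go (yes e) true h = trans (cong₂ (λ u b → u * [ b ]) (trans (cong (δ r) (sym e)) (δ-refl r)) (H-rep x r h))
        (trans (ℤₚ.*-identityˡ [ H r ]) (trans (cong (λ b → [ b ∧ H r ]) (sym (dec-true (r ≟ rep r) (trans e (sym (rep-eq h)))))) (sym (ℤₚ.*-identityʳ _))))
      go (yes e) false h = ⊥-elim (true≢false (trans (cong S (sym (trans (⁻¹-anti-homo-∙ (x ⁻¹) r) (cong ((r ⁻¹) ∙_) (⁻¹-involutive x))))) (⁻¹∈ sS (trans (cong (λ z → S ((x ⁻¹) ∙ z)) e) (rep-∈ x)))) h)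
      go (no n) true h = trans (trans (cong (_* [ H x ]) (δ-≢ n)) (ℤₚ.*-zeroˡ [ H x ])) (sym (trans (cong (λ b → [ b ∧ H r ] * 1ℤ) (dec-false (r ≟ rep r) (λ e → n (trans e (rep-eq h))))) refl))
      go (no n) false h = trans (trans (cong (_* [ H x ]) (δ-≢ n)) (ℤₚ.*-zeroˡ [ H x ])) (sym (ℤₚ.*-zeroʳ [ isRep r ]))
    coset-card : ∀ r → Σ* (λ x → [ S ((r ⁻¹) ∙ x) ]) ≡ card S
    coset-card r = Σ-transˡ (r ⁻¹) (λ x → [ S x ])

  -- If ε were the only fixed point of inversion, the other elements would pair up and the order
  -- would be odd.
  involution : ∀ h → size ≡ + 2 * h → ∃ λ t → t ≢ ε × t ∙ t ≡ ε
  involution h even = [ (λ { (t , e) → t , extract t (does (t ≟ ε)) (does ((t ⁻¹) ≟ t)) refl refl e }) , (λ none → ⊥-elim (impossible none)) ]′ (search F (λ x → not (does (x ≟ ε)) ∧ does ((x ⁻¹) ≟ x)))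
    where
    extract : ∀ t b c → does (t ≟ ε) ≡ b → does ((t ⁻¹) ≟ t) ≡ c → not b ∧ c ≡ true → t ≢ ε × t ∙ t ≡ ε
    extract t false true e e′ _ = (λ eq → true≢false (dec-true (t ≟ ε) eq) e) , involutive ((t ⁻¹) ≟ t) e′
      where
      involutive : (d : Dec ((t ⁻¹) ≡ t)) → does d ≡ true → t ∙ t ≡ ε
      involutive (yes eq) _ = trans (cong (_∙ t) (sym eq)) (inverseˡ t)
    impossible : (∀ x → not (does (x ≟ ε)) ∧ does ((x ⁻¹) ≟ x) ≡ false) → ⊥
    impossible none = contradiction (ℕ∣.∣⇒≤ (∣⇒∣ᵤ (∣-minus {+ 2} {size} {1ℤ} (divides h (trans even (ℤₚ.*-comm (+ 2) h))) 2∣size-1))) (λ { (s≤s ()) })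
      where
      fixed : ∀ x → (x ⁻¹) ≡ x → + 2 ∣ 1ℤ - δ x ε
      fixed x e = go (x ≟ ε)
        where
        go : Dec (x ≡ ε) → + 2 ∣ 1ℤ - δ x ε
        go (yes refl) = subst (λ z → + 2 ∣ 1ℤ - z) (sym (δ-refl ε)) (divides 0ℤ refl)
        go (no n) = ⊥-elim (true≢false (trans (cong₂ (λ b c → not b ∧ c) (dec-false (x ≟ ε) n) (dec-true ((x ⁻¹) ≟ x) e)) refl) (none x))
      2∣size-1 : + 2 ∣ size - 1ℤ
      2∣size-1 = subst (+ 2 ∣_) (trans (∑-- E (λ _ → 1ℤ) (λ x → δ x ε)) (cong₂ _-_ Σ-one (trans (∑-at F ε (λ x n → δ-≢ n)) (δ-refl ε))))
        (involution-parity _⁻¹ ⁻¹-involutive (λ x → 1ℤ - δ x ε) (λ x → cong (_-_ 1ℤ) (δ-inv x)) fixed)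
        where
        δ-inv : ∀ x → δ (x ⁻¹) ε ≡ δ x ε
        δ-inv x = go (x ≟ ε)
          where
          go : Dec (x ≡ ε) → δ (x ⁻¹) ε ≡ δ x ε
          go (yes refl) = cong (λ z → δ z ε) ε⁻¹≈ε
          go (no n)     = trans (δ-≢ (λ e → n (trans (sym (⁻¹-involutive x)) (trans (cong _⁻¹ e) ε⁻¹≈ε)))) (sym (δ-≢ n))

  -- Left multiplication by x permutes the right cosets {g, gt}; x lies in the subgroup P iff the
  -- number of chosen representatives mapped to a chosen one is odd.
  module IndexTwo (t : X) (t≢ε : t ≢ ε) (tt : t ∙ t ≡ ε) (h : ℤ) (order : size ≡ + 2 * h) (h-odd : + 2 ∣ h - 1ℤ) where

    private
      B : X → Bool
      B g = does (code g ℕₚ.<? code (g ∙ t))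

      gtt : ∀ g → (g ∙ t) ∙ t ≡ g
      gtt g = trans (assoc g t t) (trans (cong (g ∙_) tt) (identityʳ g))

      gt≢g : ∀ g → g ∙ t ≢ g
      gt≢g g e = t≢ε (∙-cancelˡ g t ε (trans e (sym (identityʳ g))))

      B-t : ∀ g → B (g ∙ t) ≡ not (B g)
      B-t g with ℕₚ.<-cmp (code g) (code (g ∙ t))
      ... | tri< l _ _ = trans (dec-false (code (g ∙ t) ℕₚ.<? code ((g ∙ t) ∙ t)) (λ l′ → ℕₚ.<-asym l (subst (code (g ∙ t) ℕ.<_) (cong code (gtt g)) l′))) (cong not (sym (dec-true (code g ℕₚ.<? code (g ∙ t)) l)))
      ... | tri≈ _ e _ = contradiction (sym (code-inj e)) (gt≢g g)
      ... | tri> _ _ l = trans (dec-true (code (g ∙ t) ℕₚ.<? code ((g ∙ t) ∙ t)) (subst (code (g ∙ t) ℕ.<_) (sym (cong code (gtt g))) l)) (cong not (sym (dec-false (code g ℕₚ.<? code (g ∙ t)) (ℕₚ.<-asym l))))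

      β : X → ℤ
      β g = [ B g ]

      [not] : ∀ b → [ not b ] ≡ 1ℤ - [ b ]
      [not] true  = refl
      [not] false = refl

      Σβ : Σ* β ≡ h
      Σβ = *-cancel-2 (trans (lem (Σ* β)) (trans (cong (_+_ (Σ* β)) eq) (trans (lem′ (Σ* β) size) order)))
        where
        lem : ∀ z → + 2 * z ≡ z + z
        lem = solve-∀
        lem′ : ∀ z s → z + (s - z) ≡ s
        lem′ = solve-∀
        eq : Σ* β ≡ size - Σ* β
        eq = trans (sym (Σ-transʳ t β)) (trans (∑-cong E (λ g → trans (cong [_] (B-t g)) ([not] (B g)))) (trans (∑-- E (λ _ → 1ℤ) β) (cong (_- Σ* β) Σ-one)))

      c : X → ℤ
      c x = Σ* (λ g → β (x ∙ g) * β g)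

      sq : ℤ → ℤ
      sq z = z * z

      -- The count h - c x of chosen g with xg not chosen has the parity of the transfer of x to
      -- ⟨t⟩; the lemma is its additivity. The function `f` tells whether x changes the choice at yz
      -- and y changes it at z. It is unchanged under z ↦ zt, so its sum is even, and modulo 2 it
      -- expands to `g`.
      flips : ∀ x y → + 2 ∣ (c x + c (x ∙ y)) + (h + c y)
      flips x y = ∣-minus {+ 2} {Σ* f} {(c x + c (x ∙ y)) + (h + c y)} f-even (subst (λ z → + 2 ∣ Σ* f - z) Σg
                    (subst (+ 2 ∣_) (∑-- E f g) (∑-∣ E (λ z → table (B (x ∙ (y ∙ z))) (B (y ∙ z)) (B z)))))
        where
        f g : X → ℤ
        f z = sq (β (x ∙ (y ∙ z)) - β (y ∙ z)) * sq (β (y ∙ z) - β z)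
        g z = (β (x ∙ (y ∙ z)) * β (y ∙ z) + β (x ∙ (y ∙ z)) * β z) + (β (y ∙ z) + β (y ∙ z) * β z)
        table : ∀ a b c → + 2 ∣ sq ([ a ] - [ b ]) * sq ([ b ] - [ c ]) - (([ a ] * [ b ] + [ a ] * [ c ]) + ([ b ] + [ b ] * [ c ]))
        table false false false = divides 0ℤ refl
        table false false true  = divides 0ℤ refl
        table false true  false = divides 0ℤ refl
        table false true  true  = divides -1ℤ refl
        table true  false false = divides 0ℤ refl
        table true  false true  = divides 0ℤ refl
        table true  true  false = divides -1ℤ refl
        table true  true  true  = divides (- + 2) refl
        sq-flip : ∀ b c → sq ([ not b ] - [ not c ]) ≡ sq ([ b ] - [ c ])
        sq-flip false false = refl
        sq-flip false true  = refl
        sq-flip true  false = refl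
        sq-flip true  true  = refl
        yzt : ∀ z → y ∙ (z ∙ t) ≡ (y ∙ z) ∙ t
        yzt z = sym (assoc y z t)
        f-t : ∀ z → f (z ∙ t) ≡ f z
        f-t z = cong₂ _*_
          (trans (cong₂ (λ b c → sq ([ b ] - [ c ])) (trans (cong B (trans (cong (x ∙_) (yzt z)) (sym (assoc x (y ∙ z) t)))) (B-t (x ∙ (y ∙ z)))) (trans (cong B (yzt z)) (B-t (y ∙ z)))) (sq-flip (B (x ∙ (y ∙ z))) (B (y ∙ z))))
          (trans (cong₂ (λ b c → sq ([ b ] - [ c ])) (trans (cong B (yzt z)) (B-t (y ∙ z))) (B-t z)) (sq-flip (B (y ∙ z)) (B z)))
        f-even : + 2 ∣ Σ* f
        f-even = involution-parity (_∙ t) gtt f f-t (λ z e → contradiction e (gt≢g z))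
        Σg : Σ* g ≡ (c x + c (x ∙ y)) + (h + c y)
        Σg = trans (∑-⊕ E (λ z → β (x ∙ (y ∙ z)) * β (y ∙ z) + β (x ∙ (y ∙ z)) * β z) (λ z → β (y ∙ z) + β (y ∙ z) * β z))
          (cong₂ _+_ (trans (∑-⊕ E (λ z → β (x ∙ (y ∙ z)) * β (y ∙ z)) (λ z → β (x ∙ (y ∙ z)) * β z))
                            (cong₂ _+_ (Σ-transˡ y (λ z → β (x ∙ z) * β z)) (∑-cong E (λ z → cong (λ s → β s * β z) (sym (assoc x y z))))))
                     (trans (∑-⊕ E (λ z → β (y ∙ z)) (λ z → β (y ∙ z) * β z)) (cong (_+ c y) (trans (Σ-transˡ y β) Σβ))))

      c-ε : c ε ≡ h
      c-ε = trans (∑-cong E (λ g → trans (cong (λ z → β z * β g) (identityˡ g)) ([]-idem (B g)))) Σβ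

      -- The summands at g and tg agree, and left multiplication by t fixes nothing. So t lies
      -- outside P.
      c-t : + 2 ∣ c t
      c-t = involution-parity (t ∙_) ttg (λ g → β (t ∙ g) * β g) (λ g → trans (cong (λ z → β z * β (t ∙ g)) (ttg g)) (ℤₚ.*-comm (β g) (β (t ∙ g))))
        (λ g e → contradiction (∙-cancelʳ g t ε (trans e (sym (identityˡ g)))) t≢ε)
        where
        ttg : ∀ g → t ∙ (t ∙ g) ≡ g
        ttg g = trans (sym (assoc t t g)) (trans (cong (_∙ g) tt) (identityˡ g))

      isOdd : ∀ {z} → + 2 ∣ z ⊎ + 2 ∣ z - 1ℤ → Bool
      isOdd (inj₁ _) = false
      isOdd (inj₂ _) = true

      ¬both : ∀ {z} → + 2 ∣ z → + 2 ∣ z - 1ℤ → ⊥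
      ¬both {z} e o = contradiction (ℕ∣.∣⇒≤ (∣⇒∣ᵤ (∣-minus {+ 2} {z} {1ℤ} e o))) (λ { (s≤s ()) })

    P : X → Bool
    P x = isOdd (even⊎odd (c x))

    private
      status : ∀ {z} (s : + 2 ∣ z ⊎ + 2 ∣ z - 1ℤ) → (isOdd s ≡ false × + 2 ∣ z) ⊎ (isOdd s ≡ true × + 2 ∣ z - 1ℤ)
      status (inj₁ e) = inj₁ (refl , e)
      status (inj₂ o) = inj₂ (refl , o)

      even⇒ : ∀ {x} → + 2 ∣ c x → P x ≡ false
      even⇒ {x} e = [ proj₁ , (λ o → ⊥-elim (¬both e (proj₂ o))) ]′ (status (even⊎odd (c x)))

      odd⇒ : ∀ {x} → + 2 ∣ c x - 1ℤ → P x ≡ true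
      odd⇒ {x} o = [ (λ e → ⊥-elim (¬both (proj₂ e) o)) , proj₁ ]′ (status (even⊎odd (c x)))

    P-∙ : ∀ x y → P (x ∙ y) ≡ not (P x xor P y)
    P-∙ x y = go (status (even⊎odd (c x))) (status (even⊎odd (c y)))
      where
      l₁ : ∀ cx cxy h cy → ((((cx + cxy) + (h + cy)) - cx) - cy) - (h - 1ℤ) - + 2 ≡ cxy - 1ℤ
      l₁ = solve-∀
      l₂ : ∀ cx cxy h cy → ((((cx + cxy) + (h + cy)) - cx) - (cy - 1ℤ)) - (h - 1ℤ) - + 2 ≡ cxy
      l₂ = solve-∀
      l₃ : ∀ cx cxy h cy → ((((cx + cxy) + (h + cy)) - (cx - 1ℤ)) - cy) - (h - 1ℤ) - + 2 ≡ cxy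
      l₃ = solve-∀
      l₄ : ∀ cx cxy h cy → ((((cx + cxy) + (h + cy)) - (cx - 1ℤ)) - (cy - 1ℤ)) - (h - 1ℤ) - + 4 ≡ cxy - 1ℤ
      l₄ = solve-∀
      less : ∀ {u v w} k → + 2 ∣ u → + 2 ∣ v → + 2 ∣ (((((c x + c (x ∙ y)) + (h + c y)) - u) - v) - (h - 1ℤ)) - k * + 2
      less k du dv = ∣m∣n⇒∣m-n (∣m∣n⇒∣m-n (∣m∣n⇒∣m-n (∣m∣n⇒∣m-n (flips x y) du) dv) h-odd) (divides k refl)
      go : ((P x ≡ false × + 2 ∣ c x) ⊎ (P x ≡ true × + 2 ∣ c x - 1ℤ)) → ((P y ≡ false × + 2 ∣ c y) ⊎ (P y ≡ true × + 2 ∣ c y - 1ℤ)) → P (x ∙ y) ≡ not (P x xor P y)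
      go (inj₁ (px , dx)) (inj₁ (py , dy)) = trans (odd⇒ (subst (+ 2 ∣_) (l₁ (c x) (c (x ∙ y)) h (c y)) (less {w = 0ℤ} 1ℤ dx dy))) (sym (cong₂ (λ a b → not (a xor b)) px py))
      go (inj₁ (px , dx)) (inj₂ (py , dy)) = trans (even⇒ (subst (+ 2 ∣_) (l₂ (c x) (c (x ∙ y)) h (c y)) (less {w = 0ℤ} 1ℤ dx dy))) (sym (cong₂ (λ a b → not (a xor b)) px py))
      go (inj₂ (px , dx)) (inj₁ (py , dy)) = trans (even⇒ (subst (+ 2 ∣_) (l₃ (c x) (c (x ∙ y)) h (c y)) (less {w = 0ℤ} 1ℤ dx dy))) (sym (cong₂ (λ a b → not (a xor b)) px py))
      go (inj₂ (px , dx)) (inj₂ (py , dy)) = trans (odd⇒ (subst (+ 2 ∣_) (l₄ (c x) (c (x ∙ y)) h (c y)) (less {w = 0ℤ} (+ 2) dx dy))) (sym (cong₂ (λ a b → not (a xor b)) px py))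

    P-sub : IsSub P
    P-sub = record
      { ε∈  = P-ε
      ; ∙∈  = λ {x} {y} px py → trans (P-∙ x y) (cong₂ (λ a b → not (a xor b)) px py)
      ; ⁻¹∈ = λ {x} px → inv (P (x ⁻¹)) (trans (sym (cong (λ b → not (P (x ⁻¹) xor b)) px)) (trans (sym (P-∙ (x ⁻¹) x)) (trans (cong P (inverseˡ x)) P-ε))) }
      where
      P-ε : P ε ≡ true
      P-ε = odd⇒ (subst (λ z → + 2 ∣ z - 1ℤ) (sym c-ε) h-odd)
      inv : ∀ b → not (b xor true) ≡ true → b ≡ true
      inv true _ = refl

    P-t : ∀ x → P (x ∙ t) ≡ not (P x)
    P-t x = trans (P-∙ x t) (trans (cong (λ b → not (P x xor b)) (even⇒ c-t)) (cong not (Boolₚ.xor-identityʳ (P x))))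

    Σ-split : ∀ (f : X → ℤ) → Σ* f ≡ Σ* (λ w → [ P w ] * (f w + f (w ∙ t)))
    Σ-split f = begin
      Σ* f                                                              ≡⟨ ∑-cong E (λ w → split [ P w ] (f w)) ⟩
      Σ* (λ w → [ P w ] * f w + (1ℤ - [ P w ]) * f w)                   ≡⟨ ∑-⊕ E (λ w → [ P w ] * f w) (λ w → (1ℤ - [ P w ]) * f w) ⟩
      Σ* (λ w → [ P w ] * f w) + Σ* (λ w → (1ℤ - [ P w ]) * f w)        ≡⟨ cong (_+_ (Σ* (λ w → [ P w ] * f w))) (sym (Σ-transʳ t (λ w → (1ℤ - [ P w ]) * f w))) ⟩
      Σ* (λ w → [ P w ] * f w) + Σ* (λ w → (1ℤ - [ P (w ∙ t) ]) * f (w ∙ t)) ≡⟨ cong (_+_ (Σ* (λ w → [ P w ] * f w))) (∑-cong E (λ w → cong (_* f (w ∙ t)) (trans (cong (λ b → 1ℤ - [ b ]) (P-t w)) (1-not (P w))))) ⟩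
      Σ* (λ w → [ P w ] * f w) + Σ* (λ w → [ P w ] * f (w ∙ t))         ≡⟨ ∑-⊕ E (λ w → [ P w ] * f w) (λ w → [ P w ] * f (w ∙ t)) ⟨
      Σ* (λ w → [ P w ] * f w + [ P w ] * f (w ∙ t))                    ≡⟨ ∑-cong E (λ w → sym (ℤₚ.*-distribˡ-+ [ P w ] (f w) (f (w ∙ t)))) ⟩
      Σ* (λ w → [ P w ] * (f w + f (w ∙ t)))                            ∎
      where
      open ≡-Reasoning
      split : ∀ q z → z ≡ q * z + (1ℤ - q) * z
      split = solve-∀
      1-not : ∀ b → 1ℤ - [ not b ] ≡ [ b ]
      1-not true  = refl
      1-not false = refl

    card-P : card P ≡ h
    card-P = *-cancel-2 (trans (sym (trans (sym Σ-one) (trans (Σ-split (λ _ → 1ℤ)) (trans (∑-*ʳ E (+ 2) (λ w → [ P w ])) (ℤₚ.*-comm (card P) (+ 2)))))) order)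

    -- Left multiplication by an element of H outside P would exchange H ∩ P with H ∖ P and make the
    -- order of H even.
    odd-subgroup-⊆P : ∀ {H} → IsSub H → ¬ (+ 2 ∣ card H) → ∀ {x} → H x ≡ true → P x ≡ true
    odd-subgroup-⊆P {H} sH odd {x} hx = go (P x) refl
      where
      go : ∀ b → P x ≡ b → b ≡ true
      go true  _ = refl
      go false e = ⊥-elim (odd (divides half (lem half (card H) twice)))
        where
        half = Σ* (λ g → [ H g ] * [ P g ])
        [not]′ : ∀ u b → u * [ not (false xor b) ] ≡ u - u * [ b ]
        [not]′ u true  = lem₁ u
          where
          lem₁ : ∀ u → u * 0ℤ ≡ u - u * 1ℤ
          lem₁ = solve-∀
        [not]′ u false = lem₁ u
          where
          lem₁ : ∀ u → u * 1ℤ ≡ u - u * 0ℤ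
          lem₁ = solve-∀
        twice : half ≡ card H - half
        twice = trans (sym (Σ-transˡ x (λ g → [ H g ] * [ P g ]))) (trans (∑-cong E (λ g → trans (cong₂ (λ a b → [ a ] * [ b ]) (absorbˡ sH g hx) (trans (P-∙ x g) (cong (λ b → not (b xor P g)) e))) ([not]′ [ H g ] (P g))))
          (∑-- E (λ g → [ H g ]) (λ g → [ H g ] * [ P g ])))
        lem : ∀ z s → z ≡ s - z → s ≡ z * + 2
        lem z s e = trans (lem₁ z s) (trans (cong (_+ z) (sym e)) (lem₂ z))
          where
          lem₁ : ∀ z s → s ≡ (s - z) + z
          lem₁ = solve-∀
          lem₂ : ∀ z → z + z ≡ z * + 2
          lem₂ = solve-∀

  -- Commutativity of a subgroup of order p² containing one of order p

  module PrimeSquare (p : ℕ) (pr : Prime p) {N P : X → Bool} (sN : IsSub N) (sP : IsSub P)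
                     (N⊆P : ∀ {x} → N x ≡ true → P x ≡ true) (card-N : card N ≡ + p) (card-P : card P ≡ + p * + p) where

    private
      1<p : 1 ℕ.< p
      1<p = go p pr
        where
        go : ∀ q → Prime q → 1 ℕ.< q
        go (suc zero)    pq = contradiction pq ¬prime[1]
        go (suc (suc q)) _  = s≤s (s≤s z≤n)

      instance
        p≢0 : ℕ.NonZero p
        p≢0 = prime⇒nonZero pr

    -- The order of S is at least 2 and divides the prime p.
    within-N : ∀ {S} → IsSub S → (∀ {x} → S x ≡ true → N x ≡ true) → ∀ {s} → S s ≡ true → s ≢ ε → ∀ {x} → N x ≡ true → S x ≡ true
    within-N {S} sS S⊆N {s} ss s≢ε = card-tight S N S⊆N (go (∑-[]-ℕ E S) (lagrange sS sN S⊆N))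
      where
      two : + 2 ≤ card S
      two = subst (_≤ card S) (trans (∑-⊕ E (λ x → δ x ε) (λ x → δ x s)) (cong₂ _+_ (point ε) (point s))) (∑-≤ E below)
        where
        point : ∀ a → Σ* (λ x → δ x a) ≡ 1ℤ
        point a = trans (∑-at F a (λ x n → δ-≢ n)) (δ-refl a)
        below : ∀ x → δ x ε + δ x s ≤ [ S x ]
        below x = at (x ≟ ε) (x ≟ s)
          where
          at : Dec (x ≡ ε) → Dec (x ≡ s) → δ x ε + δ x s ≤ [ S x ]
          at (yes e) (yes e′) = ⊥-elim (s≢ε (trans (sym e′) e))
          at (yes refl) (no n) = ℤₚ.≤-reflexive (trans (cong₂ _+_ (δ-refl ε) (δ-≢ n)) (cong [_] (sym (ε∈ sS))))
          at (no n) (yes refl) = ℤₚ.≤-reflexive (trans (cong₂ _+_ (δ-≢ n) (δ-refl s)) (cong [_] (sym ss)))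
          at (no n) (no n′) = subst (_≤ [ S x ]) (sym (cong₂ _+_ (δ-≢ n) (δ-≢ n′))) (0≤[] (S x))
      go : (∃ λ k → card S ≡ + k) → (∃ λ c → card N ≡ + c * card S) → card S ≡ card N
      go (k , ek) (c , ec) = [ (λ e → contradiction (ℤₚ.drop‿+≤+ (subst (+ 2 ≤_) (trans ek (cong +_ e)) two)) (λ { (s≤s ()) })) , (λ e → trans ek (trans (cong +_ e) (sym card-N))) ]′
        (prime⇒irreducible pr (ℕ∣.divides c (ℤₚ.+-injective (trans (sym card-N) (trans ec (trans (cong (+ c *_) ek) (sym (ℤₚ.pos-* c k))))))))

    -- By Lagrange the index of N in S divides the prime p, and it is not 1 because of s.
    between : ∀ {S} → IsSub S → (∀ {x} → N x ≡ true → S x ≡ true) → (∀ {x} → S x ≡ true → P x ≡ true) →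
              ∀ {s} → S s ≡ true → N s ≡ false → ∀ {x} → P x ≡ true → S x ≡ true
    between {S} sS N⊆S S⊆P {s} ss s∉N = card-tight S P S⊆P (go (lagrange sN sS N⊆S) (lagrange sS sP S⊆P))
      where
      go : (∃ λ c → card S ≡ + c * card N) → (∃ λ e → card P ≡ + e * card S) → card S ≡ card P
      go (c , ec) (e , ee) = [ (λ eq → ⊥-elim (true≢false (card-tight N S N⊆S (sym (trans ec (trans (cong (λ z → + z * card N) eq) (ℤₚ.*-identityˡ (card N))))) ss) s∉N))
                             , (λ eq → trans ec (trans (cong₂ (λ z u → + z * u) eq card-N) (sym card-P))) ]′
        (prime⇒irreducible pr (ℕ∣.divides e (ℕₚ.*-cancelʳ-≡ p (e ℕ.* c) p (ℤₚ.+-injective (begin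
          + (p ℕ.* p)          ≡⟨ ℤₚ.pos-* p p ⟩
          + p * + p            ≡⟨ card-P ⟨
          card P               ≡⟨ ee ⟩
          + e * card S         ≡⟨ cong (+ e *_) (trans ec (cong (+ c *_) card-N)) ⟩
          + e * (+ c * + p)    ≡⟨ cong (+ e *_) (sym (ℤₚ.pos-* c p)) ⟩
          + e * + (c ℕ.* p)    ≡⟨ ℤₚ.pos-* e (c ℕ.* p) ⟨
          + (e ℕ.* (c ℕ.* p))  ≡⟨ cong +_ (sym (ℕₚ.*-assoc e c p)) ⟩
          + (e ℕ.* c ℕ.* p)    ∎)))))
        where open ≡-Reasoning

    private
      commutes : X → X → Bool
      commutes n x = does ((x ∙ n) ≟ (n ∙ x))

      centralizer : ∀ {H} → IsSub H → ∀ n → IsSub (λ x → H x ∧ commutes n x)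
      centralizer {H} sH n = record
        { ε∈  = ∧-intro (ε∈ sH) (dec-true ((ε ∙ n) ≟ (n ∙ ε)) (trans (identityˡ n) (sym (identityʳ n))))
        ; ∙∈  = λ {x} {y} a b → ∧-intro (∙∈ sH (proj₁ (∧-elim a)) (proj₁ (∧-elim b))) (dec-true (((x ∙ y) ∙ n) ≟ (n ∙ (x ∙ y)))
                  (mul (witness ((x ∙ n) ≟ (n ∙ x)) (proj₂ (∧-elim {H x} a))) (witness ((y ∙ n) ≟ (n ∙ y)) (proj₂ (∧-elim {H y} b)))))
        ; ⁻¹∈ = λ {x} a → ∧-intro (⁻¹∈ sH (proj₁ (∧-elim a))) (dec-true (((x ⁻¹) ∙ n) ≟ (n ∙ (x ⁻¹))) (inv (witness ((x ∙ n) ≟ (n ∙ x)) (proj₂ (∧-elim {H x} a))))) }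
        where
        mul : ∀ {x y} → x ∙ n ≡ n ∙ x → y ∙ n ≡ n ∙ y → (x ∙ y) ∙ n ≡ n ∙ (x ∙ y)
        mul {x} {y} ex ey = trans (assoc x y n) (trans (cong (x ∙_) ey) (trans (sym (assoc x n y)) (trans (cong (_∙ y) ex) (assoc n x y))))
        inv : ∀ {x} → x ∙ n ≡ n ∙ x → (x ⁻¹) ∙ n ≡ n ∙ (x ⁻¹)
        inv {x} ex = ∙-cancelˡ x _ _ (trans (x∙x⁻¹y x n) (trans (sym (yx∙x⁻¹ x n)) (trans (cong (_∙ (x ⁻¹)) (sym ex)) (assoc x n (x ⁻¹)))))

      N-comm : ∀ {n n′} → N n ≡ true → N n′ ≡ true → n′ ∙ n ≡ n ∙ n′
      N-comm {n} {n′} n∈N n′∈N = go (n ≟ ε)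
        where
        go : Dec (n ≡ ε) → n′ ∙ n ≡ n ∙ n′
        go (yes refl) = trans (identityʳ n′) (sym (identityˡ n′))
        go (no n≢ε)   = witness ((n′ ∙ n) ≟ (n ∙ n′)) (proj₂ (∧-elim {N n′} (within-N (centralizer sN n) (λ h → proj₁ (∧-elim h)) (∧-intro n∈N (dec-true ((n ∙ n) ≟ (n ∙ n)) refl)) n≢ε n′∈N)))

      conj : X → X → X
      conj x n = (x ∙ n) ∙ (x ⁻¹)

      conj-∙ : ∀ x a b → conj x (a ∙ b) ≡ conj x a ∙ conj x b
      conj-∙ x a b = sym (begin
        ((x ∙ a) ∙ (x ⁻¹)) ∙ ((x ∙ b) ∙ (x ⁻¹))    ≡⟨ assoc (x ∙ a) (x ⁻¹) _ ⟩
        (x ∙ a) ∙ ((x ⁻¹) ∙ ((x ∙ b) ∙ (x ⁻¹)))    ≡⟨ cong (λ z → (x ∙ a) ∙ ((x ⁻¹) ∙ z)) (assoc x b (x ⁻¹)) ⟩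
        (x ∙ a) ∙ ((x ⁻¹) ∙ (x ∙ (b ∙ (x ⁻¹))))    ≡⟨ cong ((x ∙ a) ∙_) (x⁻¹∙xy x _) ⟩
        (x ∙ a) ∙ (b ∙ (x ⁻¹))                     ≡⟨ assoc (x ∙ a) b (x ⁻¹) ⟨
        ((x ∙ a) ∙ b) ∙ (x ⁻¹)                     ≡⟨ cong (_∙ (x ⁻¹)) (assoc x a b) ⟩
        (x ∙ (a ∙ b)) ∙ (x ⁻¹)                     ∎)
        where open ≡-Reasoning

      conj-ε : ∀ x → conj x ε ≡ ε
      conj-ε x = trans (cong (_∙ (x ⁻¹)) (identityʳ x)) (inverseʳ x)

      conj-⁻¹ : ∀ x a → conj x (a ⁻¹) ≡ (conj x a) ⁻¹
      conj-⁻¹ x a = inverseʳ-unique (conj x a) (conj x (a ⁻¹)) (trans (sym (conj-∙ x a (a ⁻¹))) (trans (cong (conj x) (inverseʳ a)) (conj-ε x)))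

      conj-inj : ∀ x {a b} → conj x a ≡ conj x b → a ≡ b
      conj-inj x {a} {b} e = ∙-cancelˡ x a b (∙-cancelʳ (x ⁻¹) _ _ e)

      stable : ∀ x → IsSub (λ n → N n ∧ N (conj x n))
      stable x = record
        { ε∈  = ∧-intro (ε∈ sN) (trans (cong N (conj-ε x)) (ε∈ sN))
        ; ∙∈  = λ {a} {b} ha hb → ∧-intro (∙∈ sN (proj₁ (∧-elim ha)) (proj₁ (∧-elim hb))) (trans (cong N (conj-∙ x a b)) (∙∈ sN (proj₂ (∧-elim {N a} ha)) (proj₂ (∧-elim {N b} hb))))
        ; ⁻¹∈ = λ {a} ha → ∧-intro (⁻¹∈ sN (proj₁ (∧-elim ha))) (trans (cong N (conj-⁻¹ x a)) (⁻¹∈ sN (proj₂ (∧-elim {N a} ha)))) }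

      -- If N meets xNx⁻¹ trivially, the p² products a(xbx⁻¹) fill P; x⁻¹ being one of them puts x in N.
      normal : ∀ {x n} → P x ≡ true → N n ≡ true → N (conj x n) ≡ true
      normal {x} {n} x∈P n∈N = go (N (conj x n)) refl
        where
        go : ∀ b → N (conj x n) ≡ b → b ≡ true
        go true  _   = refl
        go false n∉S = ⊥-elim (true≢false (trans (cong N refl) (∙∈ sN (∙∈ sN x∈N n∈N) (⁻¹∈ sN x∈N))) n∉S)
          where
          trivial-S : ∀ {s} → N s ≡ true → N (conj x s) ≡ true → s ≡ ε
          trivial-S {s} hs hs′ = eq (s ≟ ε)
            where
            eq : Dec (s ≡ ε) → s ≡ ε
            eq (yes e)  = e
            eq (no s≢ε) = ⊥-elim (true≢false (proj₂ (∧-elim {N n} (within-N (stable x) (λ h → proj₁ (∧-elim h)) (∧-intro hs hs′) s≢ε n∈N))) n∉S)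
          -- The b with a(xbx⁻¹) = z; so `q z a` says that a is the first factor of such a
          -- factorization with both a and b in N.
          back : X → X → X
          back a z = ((x ⁻¹) ∙ ((a ⁻¹) ∙ z)) ∙ x
          back-eq : ∀ a z → a ∙ conj x (back a z) ≡ z
          back-eq a z = trans (cong (a ∙_) (trans (cong (_∙ (x ⁻¹)) (trans (sym (assoc x _ x)) (cong (_∙ x) (x∙x⁻¹y x ((a ⁻¹) ∙ z))))) (yx∙x⁻¹ x ((a ⁻¹) ∙ z)))) (x∙x⁻¹y a z)
          q : X → X → Bool
          q z a = N a ∧ N (back a z)
          unique-q : ∀ z {a a′} → q z a ≡ true → q z a′ ≡ true → a ≡ a′
          unique-q z {a} {a′} h h′ = sym (trans (inverseʳ-unique (a ⁻¹) a′ quot≡ε) (⁻¹-involutive a))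
            where
            b = back a z
            b′ = back a′ z
            quot : (a ⁻¹) ∙ a′ ≡ conj x (b ∙ (b′ ⁻¹))
            quot = begin
              (a ⁻¹) ∙ a′                                   ≡⟨ cong ((a ⁻¹) ∙_) (sym (yx∙x⁻¹ (conj x b′) a′)) ⟩
              (a ⁻¹) ∙ ((a′ ∙ conj x b′) ∙ ((conj x b′) ⁻¹)) ≡⟨ cong (λ w → (a ⁻¹) ∙ (w ∙ ((conj x b′) ⁻¹))) (trans (back-eq a′ z) (sym (back-eq a z))) ⟩
              (a ⁻¹) ∙ ((a ∙ conj x b) ∙ ((conj x b′) ⁻¹))   ≡⟨ cong ((a ⁻¹) ∙_) (assoc a (conj x b) _) ⟩
              (a ⁻¹) ∙ (a ∙ (conj x b ∙ ((conj x b′) ⁻¹)))   ≡⟨ x⁻¹∙xy a _ ⟩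
              conj x b ∙ ((conj x b′) ⁻¹)                   ≡⟨ cong (conj x b ∙_) (sym (conj-⁻¹ x b′)) ⟩
              conj x b ∙ conj x (b′ ⁻¹)                     ≡⟨ conj-∙ x b (b′ ⁻¹) ⟨
              conj x (b ∙ (b′ ⁻¹))                          ∎
              where open ≡-Reasoning
            bb′≡ε : b ∙ (b′ ⁻¹) ≡ ε
            bb′≡ε = trivial-S (∙∈ sN (proj₂ (∧-elim {N a} h)) (⁻¹∈ sN (proj₂ (∧-elim {N a′} h′))))
                              (trans (cong N (sym quot)) (∙∈ sN (⁻¹∈ sN (proj₁ (∧-elim {N a} h))) (proj₁ (∧-elim {N a′} h′))))
            quot≡ε : (a ⁻¹) ∙ a′ ≡ ε
            quot≡ε = trans quot (trans (cong (conj x) bb′≡ε) (conj-ε x))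
          in-P : ∀ z a → q z a ≡ true → P z ≡ true
          in-P z a h = trans (cong P (sym (back-eq a z))) (∙∈ sP (N⊆P (proj₁ (∧-elim {N a} h))) (∙∈ sP (∙∈ sP x∈P (N⊆P (proj₂ (∧-elim {N a} h)))) (⁻¹∈ sP x∈P)))
          below : ∀ z → card (q z) ≤ [ P z ]
          below z = bound (P z) refl
            where
            bound : ∀ c → P z ≡ c → card (q z) ≤ [ c ]
            bound true  _ = at-most-one (q z) (unique-q z)
            bound false e = ℤₚ.≤-reflexive (∑-zero E (λ a → cong [_] (¬true⇒false (λ h → true≢false (in-P z a h) e))))
          sum : Σ* (λ z → card (q z)) ≡ card P
          sum = begin
            Σ* (λ z → Σ* (λ a → [ q z a ]))                      ≡⟨ ∑-swap E E _ ⟩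
            Σ* (λ a → Σ* (λ z → [ q z a ]))                      ≡⟨ ∑-cong E (λ a → trans (∑-cong E (λ z → []-∧ (N a) (N (back a z)))) (trans (∑-*ˡ E [ N a ] _) (cong ([ N a ] *_) (shifted a)))) ⟩
            Σ* (λ a → [ N a ] * + p)                             ≡⟨ ∑-*ʳ E (+ p) (λ a → [ N a ]) ⟩
            card N * + p                                         ≡⟨ cong (_* + p) card-N ⟩
            + p * + p                                            ≡⟨ card-P ⟨
            card P                                               ∎
            where
            open ≡-Reasoning
            shifted : ∀ a → Σ* (λ z → [ N (back a z) ]) ≡ + p
            shifted a = trans (Σ-transˡ (a ⁻¹) (λ z → [ N (((x ⁻¹) ∙ z) ∙ x) ])) (trans (Σ-transˡ (x ⁻¹) (λ z → [ N (z ∙ x) ])) (trans (Σ-transʳ x (λ z → [ N z ])) card-N))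
          full : card (q (x ⁻¹)) ≡ 1ℤ
          full = trans (∑-tight below sum (complete (x ⁻¹))) (cong [_] (⁻¹∈ sP x∈P))
          x∈N : N x ≡ true
          x∈N = [ (λ { (a , h) → found a h }) , (λ none → contradiction (trans (sym full) (∑-zero E (λ a → cong [_] (none a)))) (λ ())) ]′ (search F (q (x ⁻¹)))
            where
            found : ∀ a → q (x ⁻¹) a ≡ true → N x ≡ true
            found a h = trans (cong N (sym product)) (⁻¹∈ sN (∙∈ sN (proj₂ (∧-elim {N a} h)) (proj₁ (∧-elim {N a} h))))
              where
              -- For z = x⁻¹ the second factor is b = x⁻¹a⁻¹, whence x⁻¹ = ba is in N.
              product : (back a (x ⁻¹) ∙ a) ⁻¹ ≡ x
              product = trans (cong _⁻¹ (trans (cong (_∙ a) (trans (assoc (x ⁻¹) _ x) (trans (cong ((x ⁻¹) ∙_) (yx⁻¹∙x x (a ⁻¹))) refl))) (yx⁻¹∙x a (x ⁻¹)))) (⁻¹-involutive x)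

      -- If some n ≠ ε in N is not central, N is the centralizer of n in P, and the p conjugates of n
      -- lie in N ∖ {ε}.
      central : ∀ {n x} → N n ≡ true → P x ≡ true → x ∙ n ≡ n ∙ x
      central {n} {x} n∈N x∈P = go (n ≟ ε)
        where
        C : X → Bool
        C x = P x ∧ commutes n x
        N⊆C : ∀ {x} → N x ≡ true → C x ≡ true
        N⊆C {x} h = ∧-intro (N⊆P h) (dec-true ((x ∙ n) ≟ (n ∙ x)) (N-comm n∈N h))
        go : Dec (n ≡ ε) → x ∙ n ≡ n ∙ x
        go (yes refl) = trans (identityʳ x) (sym (identityˡ x))
        go (no n≢ε) = [ (λ { (s , h) → witness ((x ∙ n) ≟ (n ∙ x)) (proj₂ (∧-elim {P x} (between (centralizer sP n) N⊆C (λ h → proj₁ (∧-elim h)) (proj₁ (∧-elim {C s} h)) (Boolₚ.not-injective (proj₂ (∧-elim {C s} h))) x∈P))) })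
                      , (λ none → ⊥-elim (too-many (λ {s} cs → self (N s) (trans (cong (λ b → b ∧ not (N s)) (sym cs)) (none s))))) ]′ (search F (λ s → C s ∧ not (N s)))
          where
          self : ∀ b → true ∧ not b ≡ false → b ≡ true
          self true _ = refl
          too-many : (∀ {s} → C s ≡ true → N s ≡ true) → ⊥
          too-many C⊆N = ℕₚ.<⇒≱ (ℕₚ.m<n+m (p ℕ.* p) {p} (ℕₚ.<-trans (s≤s z≤n) 1<p)) (ℤₚ.drop‿+≤+ (subst₂ _≤_ eq eq′ (ℤₚ.+-monoʳ-≤ (+ p) count)))
            where
            m : X → ℤ
            m v = Σ* (λ z → [ P z ] * δ v (conj z n))
            -- The z in P conjugating n to v all lie in one coset z₀N, because the centralizer of n
            -- lies in N, and v is then a nonidentity element of N by normality. Summed over v this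
            -- would give p² ≤ p(p - 1).
            m-bound : ∀ v → m v ≤ + p * ([ N v ] - δ v ε)
            m-bound v = bound (search F (λ z → P z ∧ does (v ≟ conj z n)))
              where
              vanish : (∀ z → P z ≡ true → v ≢ conj z n) → m v ≡ 0ℤ
              vanish h = ∑-zero E (λ z → each z (P z) refl)
                where
                each : ∀ z b → P z ≡ b → [ b ] * δ v (conj z n) ≡ 0ℤ
                each z false _ = ℤₚ.*-zeroˡ (δ v (conj z n))
                each z true  e = trans (ℤₚ.*-identityˡ _) (δ-≢ (h z e))
              bound : (∃ λ z → P z ∧ does (v ≟ conj z n) ≡ true) ⊎ (∀ z → P z ∧ does (v ≟ conj z n) ≡ false) → m v ≤ + p * ([ N v ] - δ v ε)
              bound (inj₂ none) = subst (_≤ + p * ([ N v ] - δ v ε)) (sym (vanish (λ z hz e → true≢false (∧-intro hz (dec-true (v ≟ conj z n) e)) (none z)))) (*-≥0 {+ p} (+≤+ z≤n) nonneg)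
                where
                nonneg : 0ℤ ≤ [ N v ] - δ v ε
                nonneg = at (v ≟ ε)
                  where
                  at : Dec (v ≡ ε) → 0ℤ ≤ [ N v ] - δ v ε
                  at (yes refl) = ℤₚ.≤-reflexive (sym (cong₂ _-_ (cong [_] (ε∈ sN)) (δ-refl ε)))
                  at (no n)     = subst (0ℤ ≤_) (sym (trans (cong (_-_ [ N v ]) (δ-≢ n)) (ℤₚ.+-identityʳ [ N v ]))) (0≤[] (N v))
              bound (inj₁ (z₀ , h)) = subst (m v ≤_) (sym rhs) (subst (_≤ + p) (Σ-transˡ z₀ (λ z → [ P z ] * δ v (conj z n))) (subst (Σ* (λ z → [ P (z₀ ∙ z) ] * δ v (conj (z₀ ∙ z) n)) ≤_) card-N (∑-≤ E below)))
                where
                z₀∈P = proj₁ (∧-elim {P z₀} h)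
                v≡ : v ≡ conj z₀ n
                v≡ = witness (v ≟ conj z₀ n) (proj₂ (∧-elim {P z₀} h))
                rhs : + p * ([ N v ] - δ v ε) ≡ + p
                rhs = trans (cong₂ (λ b d → + p * ([ b ] - d)) (trans (cong N v≡) (normal z₀∈P n∈N)) (δ-≢ (λ e → n≢ε (conj-inj z₀ (trans (sym v≡) (trans e (sym (conj-ε z₀)))))))) (ℤₚ.*-identityʳ (+ p))
                below : ∀ z → [ P (z₀ ∙ z) ] * δ v (conj (z₀ ∙ z) n) ≤ [ N z ]
                below z = at (P (z₀ ∙ z)) refl (v ≟ conj (z₀ ∙ z) n)
                  where
                  at : ∀ b → P (z₀ ∙ z) ≡ b → Dec (v ≡ conj (z₀ ∙ z) n) → [ b ] * δ v (conj (z₀ ∙ z) n) ≤ [ N z ]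
                  at false _ _ = subst (_≤ [ N z ]) (sym (ℤₚ.*-zeroˡ (δ v (conj (z₀ ∙ z) n)))) (0≤[] (N z))
                  at true _ (no n) = subst (_≤ [ N z ]) (sym (trans (ℤₚ.*-identityˡ _) (δ-≢ n))) (0≤[] (N z))
                  at true hz (yes e) = ℤₚ.≤-reflexive (trans (trans (ℤₚ.*-identityˡ _) (trans (cong (δ v) (sym e)) (δ-refl v))) (cong [_] (sym (C⊆N (∧-intro (trans (sym (absorbˡ sP z z₀∈P)) hz) (dec-true ((z ∙ n) ≟ (n ∙ z)) commute))))))
                    where
                    conj-conj : conj (z₀ ∙ z) n ≡ conj z₀ (conj z n)
                    conj-conj = trans (cong₂ _∙_ (assoc z₀ z n) (⁻¹-anti-homo-∙ z₀ z)) (trans (sym (assoc (z₀ ∙ (z ∙ n)) (z ⁻¹) (z₀ ⁻¹))) (cong (_∙ (z₀ ⁻¹)) (assoc z₀ (z ∙ n) (z ⁻¹))))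
                    commute : z ∙ n ≡ n ∙ z
                    commute = trans (sym (yx⁻¹∙x z (z ∙ n))) (cong (_∙ z) (sym (conj-inj z₀ (trans (sym v≡) (trans e conj-conj)))))
            count : card P ≤ + p * (card N - 1ℤ)
            count = subst (_≤ + p * (card N - 1ℤ)) total (subst (Σ* m ≤_) (trans (∑-*ˡ E (+ p) (λ v → [ N v ] - δ v ε)) (cong (+ p *_) (trans (∑-- E (λ v → [ N v ]) (λ v → δ v ε)) (cong (_-_ (card N)) (trans (∑-at F ε (λ v n → δ-≢ n)) (δ-refl ε)))))) (∑-≤ E m-bound))
              where
              total : Σ* m ≡ card P
              total = trans (∑-swap E E _) (∑-cong E (λ z → trans (∑-cong E (λ v → ℤₚ.*-comm [ P z ] (δ v (conj z n)))) (Σ-δ (conj z n) (λ _ → [ P z ]))))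
            eq : + p + card P ≡ + (p ℕ.+ p ℕ.* p)
            eq = cong (_+_ (+ p)) (trans card-P (sym (ℤₚ.pos-* p p)))
            eq′ : + p + + p * (card N - 1ℤ) ≡ + (p ℕ.* p)
            eq′ = trans (cong (λ z → + p + + p * (z - 1ℤ)) card-N) (trans (lem (+ p)) (sym (ℤₚ.pos-* p p)))
              where
              lem : ∀ q → q + q * (q - 1ℤ) ≡ q * q
              lem = solve-∀

    -- For x outside N the centralizer of x in P contains x and, by `central`, all of N; by
    -- `between` it is P.
    abelian : ∀ {x y} → P x ≡ true → P y ≡ true → x ∙ y ≡ y ∙ x
    abelian {x} {y} x∈P y∈P = go (N x) refl
      where
      go : ∀ b → N x ≡ b → x ∙ y ≡ y ∙ x
      go true  x∈N = sym (central x∈N y∈P)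
      go false x∉N = sym (witness ((y ∙ x) ≟ (x ∙ y)) (proj₂ (∧-elim {P y}
        (between (centralizer sP x) (λ {z} h → ∧-intro (N⊆P h) (dec-true ((z ∙ x) ≟ (x ∙ z)) (sym (central h x∈P)))) (λ h → proj₁ (∧-elim h)) (∧-intro x∈P (dec-true ((x ∙ x) ≟ (x ∙ x)) refl)) x∉N y∈P))))

abelian-contradiction : {X : Set} (F : Finite X) {_∙_ : X → X → X} {ε : X} {_⁻¹ : X → X}
  (isAb : IsAbelianGroup _≡_ _∙_ ε _⁻¹)
  (p : ℕ) (pr : Prime p) (m : ℕ) (p-odd : p ≡ 1 ℕ.+ 2 ℕ.* m)
  (size² : length (elems F) ≡ p ℕ.* p)
  (N : X → Bool) (N-ε : N ε ≡ true)
  (N-∙ : ∀ {x y} → N x ≡ true → N y ≡ true → N (x ∙ y) ≡ true)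
  (N-⁻¹ : ∀ {x} → N x ≡ true → N (x ⁻¹) ≡ true)
  (ΣN : FiniteSum.Σ* F (λ x → [ N x ]) ≡ + p)
  (σ : X → X) → (∀ x y → σ (x ∙ y) ≡ σ x ∙ σ y) → (∀ x → σ (σ x) ≡ x) →
  (let open AbelianSum F isAb; open Setup F isAb p pr m p-odd size² N N-ε N-∙ N-⁻¹ ΣN) →
  (A B : X → Bool) →
  (∀ x → corr ([_] ∘ A) ([_] ∘ A) x + corr ([_] ∘ B) ([_] ∘ B) x ≡ κ x) →
  Σ* ([_] ∘ A) + Σ* ([_] ∘ B) ≡ + 2 * + p →
  (∀ x → corr ([_] ∘ A) ([_] ∘ B ∘ σ) x + corr ([_] ∘ B) ([_] ∘ A ∘ σ) x ≡ + 2) → ⊥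
abelian-contradiction F isAb p pr m p-odd size² N N-ε N-∙ N-⁻¹ ΣN σ σ-∙ σσ A B autocorr total crosscorr =
  [ (λ { (y , h) → nonnormal y (proj₁ (∧-elim {N y} h)) (Boolₚ.not-injective (proj₂ (∧-elim {N y} h))) })
  , (λ none → AB.Normal.contradiction-normal (λ {n} n∈N → kept (N (σ n)) (trans (cong (λ b → b ∧ not (N (σ n))) (sym n∈N)) (none n)))) ]′
  (search F (λ x → N x ∧ not (N (σ x))))
  where
  open Setup F isAb p pr m p-odd size² N N-ε N-∙ N-⁻¹ ΣN using (module Raw)
  open Twisted F isAb p pr m p-odd size² N N-ε N-∙ N-⁻¹ ΣN σ σ-∙ σσ (Raw.exponent A B autocorr total)
  module AB = Pair A B autocorr total crosscorr
  open AbelianSum F isAb using (corr; Σ*)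
  -- The hypotheses are symmetric in A and B; the exchanged copy handles the case where V is the
  -- function that vanishes.
  module BA = Pair B A
    (λ x → trans (ℤₚ.+-comm (corr ([_] ∘ B) ([_] ∘ B) x) (corr ([_] ∘ A) ([_] ∘ A) x)) (autocorr x))
    (trans (ℤₚ.+-comm (Σ* ([_] ∘ B)) (Σ* ([_] ∘ A))) total)
    (λ x → trans (ℤₚ.+-comm (corr ([_] ∘ B) ([_] ∘ A ∘ σ) x) (corr ([_] ∘ A) ([_] ∘ B ∘ σ) x)) (crosscorr x))
  kept : ∀ b → true ∧ not b ≡ false → b ≡ true
  kept true _ = refl
  nonnormal : ∀ y → N y ≡ true → N (σ y) ≡ false → ⊥
  nonnormal y y∈N σy∉N = [ AB.Nonnormal.contradiction-nonnormal y∈N σy∉N , BA.Nonnormal.contradiction-nonnormal y∈N σy∉N ]′ (AB.Nonnormal.vanishing y∈N σy∉N)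

-- Membership is irrelevant, so two elements are equal as soon as their underlying group elements
-- are.
record Sub {X : Set} (q : X → Bool) : Set where
  constructor _,_
  field
    el   : X
    .mem : q el ≡ true

module SubFinite {X : Set} (F : Finite X) (q : X → Bool) where
  open FiniteSum F

  private
    cons : ∀ x b → .(q x ≡ b) → List (Sub q) → List (Sub q)
    cons x true  e ys = (x , e) ∷ ys
    cons x false e ys = ys

  sub : List X → List (Sub q)
  sub []       = []
  sub (x ∷ xs) = cons x (q x) refl (sub xs)

  private
    cons-here : ∀ x b .(e : q x ≡ b) .(m : q x ≡ true) ys → (x , m) ∈ cons x b e ys
    cons-here x true  e m ys = here refl
    cons-here x false e m ys = ⊥-elim (absurd (trans (sym e) m))
      where
      absurd : .(false ≡ true) → ⊥
      absurd ()

    cons-there : ∀ x b .(e : q x ≡ b) {z ys} → z ∈ ys → z ∈ cons x b e ys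
    cons-there x true  e i = there i
    cons-there x false e i = i

    sub-∈ : ∀ {x} xs .(m : q x ≡ true) → x ∈ xs → (x , m) ∈ sub xs
    sub-∈ (y ∷ xs) m (here refl) = cons-here y (q y) refl m (sub xs)
    sub-∈ (y ∷ xs) m (there i)   = cons-there y (q y) refl (sub-∈ xs m i)

    sub-All : ∀ {x} .{m : q x ≡ true} xs → All (x ≢_) xs → All ((x , m) ≢_) (sub xs)
    sub-All []       []       = []
    sub-All {x} {m} (y ∷ xs) (n ∷ ns) = go (q y) refl
      where
      go : ∀ b .(e : q y ≡ b) → All ((x , m) ≢_) (cons y b e (sub xs))
      go true  e = (λ e → n (cong Sub.el e)) ∷ sub-All xs ns
      go false e = sub-All xs ns

    sub-unique : ∀ xs → Unique xs → Unique (sub xs)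
    sub-unique []       []       = []
    sub-unique (x ∷ xs) (n ∷ u) = go (q x) refl
      where
      go : ∀ b .(e : q x ≡ b) → Unique (cons x b e (sub xs))
      go true  e = sub-All xs n ∷ sub-unique xs u
      go false e = sub-unique xs u

  el-injective : {x y : Sub q} → Sub.el x ≡ Sub.el y → x ≡ y
  el-injective refl = refl

  finite : Finite (Sub q)
  finite = record
    { elems = sub (elems F) ; complete = λ { (x , m) → sub-∈ (elems F) m (complete x) }
    ; unique = sub-unique (elems F) unique ; code = code ∘ Sub.el ; code-inj = λ e → el-injective (code-inj e) }

  ∑-sub : ∀ xs (f : X → ℤ) → ∑ (sub xs) (f ∘ Sub.el) ≡ ∑ xs (λ x → [ q x ] * f x)
  ∑-sub []       f = refl
  ∑-sub (x ∷ xs) f = go (q x) refl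
    where
    go : ∀ b .(e : q x ≡ b) → ∑ (cons x b e (sub xs)) (f ∘ Sub.el) ≡ [ b ] * f x + ∑ xs (λ x → [ q x ] * f x)
    go true  e = cong₂ _+_ (sym (ℤₚ.*-identityˡ (f x))) (∑-sub xs f)
    go false e = trans (∑-sub xs f) (sym (trans (cong (_+ ∑ xs (λ x → [ q x ] * f x)) (ℤₚ.*-zeroˡ (f x))) (ℤₚ.+-identityˡ _)))

finFinite : ∀ n → Finite (Fin n)
finFinite n = record { elems = allFin n ; complete = ∈-allFin ; unique = allFin⁺ n ; code = toℕ ; code-inj = Finₚ.toℕ-injective }

∑-lookup : ∀ {n} (S : Subset n) → ∑ (allFin n) (λ x → [ lookup S x ]) ≡ + ∥ S ∥
∑-lookup S = go S id (λ x → [ lookup S x ]) (λ _ → refl)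
  where
  go : ∀ {m k} (S : Subset m) (h : Fin m → Fin k) (f : Fin k → ℤ) → (∀ i → f (h i) ≡ [ lookup S i ]) → ∑ (tabulate h) f ≡ + ∥ S ∥
  go []          h f e = refl
  go (true  ∷ S) h f e = cong₂ _+_ (e Fin.zero) (go S (h ∘ Fin.suc) f (e ∘ Fin.suc))
  go (false ∷ S) h f e = trans (cong₂ _+_ (e Fin.zero) (go S (h ∘ Fin.suc) f (e ∘ Fin.suc))) (ℤₚ.+-identityˡ _)

+length-filter : {X : Set} {Q : X → Set} (Q? : Decidable Q) (xs : List X) → + length (filter Q? xs) ≡ ∑ xs (λ x → [ does (Q? x) ])
+length-filter Q? []       = refl
+length-filter Q? (x ∷ xs) with does (Q? x)
... | true  = cong (_+_ 1ℤ) (+length-filter Q? xs)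
... | false = trans (+length-filter Q? xs) (sym (ℤₚ.+-identityˡ _))

does-∈? : ∀ {n} (x : Fin n) (S : Subset n) → does (x ∈? S) ≡ lookup S x
does-∈? x S with x ∈? S | lookup S x in eq
... | yes i | true  = refl
... | yes i | false = sym (trans (sym eq) ([]=⇒lookup i))
... | no n  | true  = contradiction (lookup⇒[]= x S eq) n
... | no n  | false = refl

-- From a relative difference set to the sets A and B in P

module FromRDS (p : ℕ) (pr : Prime p) (m : ℕ) (p-odd : p ≡ 1 ℕ.+ 2 ℕ.* m)
               (G : FinGroup (2 ℕ.* p ℕ.* p)) (R-exists : ContainsRDS G (2 ℕ.* p) p (2 ℕ.* p) 2) where

  open FinGroup G renaming (isGroup to G-isGroup)
  open ContainsRDS R-exists
  open IsRDS rds

  F : Finite (Fin (2 ℕ.* p ℕ.* p))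
  F = finFinite (2 ℕ.* p ℕ.* p)

  open GroupSum F G-isGroup
  open FinGroupTheory F G-isGroup
  open IsSub

  private
    E = elems F
    Nᵇ Rᵇ : Fin (2 ℕ.* p ℕ.* p) → Bool
    Nᵇ = lookup N
    Rᵇ = lookup R

  sN : IsSub Nᵇ
  sN = record
    { ε∈  = []=⇒lookup (IsSubgroup.ε∈ N-sub)
    ; ∙∈  = λ {x} {y} a b → []=⇒lookup (IsSubgroup.∙-closed N-sub (lookup⇒[]= x N a) (lookup⇒[]= y N b))
    ; ⁻¹∈ = λ {x} a → []=⇒lookup (IsSubgroup.⁻¹-closed N-sub (lookup⇒[]= x N a)) }

  card-N : card Nᵇ ≡ + p
  card-N = trans (∑-lookup N) (cong +_ N-size)

  h : ℤ
  h = + p * + p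

  order₂ : size ≡ + 2 * h
  order₂ = trans (cong +_ (length-tabulate {n = 2 ℕ.* p ℕ.* p} id)) (trans (ℤₚ.pos-* (2 ℕ.* p) p) (trans (cong (_* + p) (ℤₚ.pos-* 2 p)) (ℤₚ.*-assoc (+ 2) (+ p) (+ p))))

  +p : + p ≡ 1ℤ + + 2 * + m
  +p = trans (cong +_ p-odd) (cong (_+_ 1ℤ) (ℤₚ.pos-* 2 m))

  h-odd : + 2 ∣ h - 1ℤ
  h-odd = divides (+ 2 * + m * + m + + 2 * + m) (trans (cong (λ z → z * z - 1ℤ) +p) (lem (+ m)))
    where
    lem : ∀ m → (1ℤ + + 2 * m) * (1ℤ + + 2 * m) - 1ℤ ≡ (+ 2 * m * m + + 2 * m) * + 2
    lem = solve-∀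

  2∤card-N : ¬ (+ 2 ∣ card Nᵇ)
  2∤card-N d = contradiction (ℕ∣.∣⇒≤ (∣⇒∣ᵤ (∣-minus {+ 2} {+ p} {1ℤ} (subst (+ 2 ∣_) card-N d) (divides (+ m) (trans (cong (_- 1ℤ) +p) (lem (+ m))))))) (λ { (s≤s ()) })
    where
    lem : ∀ m → (1ℤ + + 2 * m) - 1ℤ ≡ m * + 2
    lem = solve-∀

  t : Fin (2 ℕ.* p ℕ.* p)
  t = proj₁ (involution h order₂)

  tt : t ∙ t ≡ ε
  tt = proj₂ (proj₂ (involution h order₂))

  open IndexTwo t (proj₁ (proj₂ (involution h order₂))) tt h order₂ h-odd

  N⊆P : ∀ {x} → Nᵇ x ≡ true → P x ≡ true
  N⊆P = odd-subgroup-⊆P sN 2∤card-N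

  open PrimeSquare p pr sN P-sub N⊆P card-N card-P using (abelian)

  ρ : Fin (2 ℕ.* p ℕ.* p) → ℤ
  ρ g = Σ* (λ w → [ Rᵇ (g ∙ w) ] * [ Rᵇ w ])

  -- In a representation g = ab⁻¹ the element b determines a = gb, which leaves a single sum.
  +#reps : ∀ g → + #reps G R g ≡ ρ g
  +#reps g = begin
    + #reps G R g                                                          ≡⟨ +length-filter _ (cartesianProduct E E) ⟩
    ∑ (cartesianProduct E E) _                                             ≡⟨ ∑-× E E _ ⟩
    Σ* (λ a → Σ* (λ b → [ does (a ∈? R) ∧ (does (b ∈? R) ∧ does (g Finₚ.≟ (a ∙ (b ⁻¹)))) ])) ≡⟨ ∑-swap E E _ ⟩
    Σ* (λ b → Σ* (λ a → [ does (a ∈? R) ∧ (does (b ∈? R) ∧ does (g Finₚ.≟ (a ∙ (b ⁻¹)))) ])) ≡⟨ ∑-cong E (λ b → trans (∑-at F (g ∙ b) (λ a n → off a b n)) (on b)) ⟩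
    ρ g                                                                    ∎
    where
    open ≡-Reasoning
    off : ∀ a b → a ≢ g ∙ b → [ does (a ∈? R) ∧ (does (b ∈? R) ∧ does (g Finₚ.≟ (a ∙ (b ⁻¹)))) ] ≡ 0ℤ
    off a b n = cong [_] (trans (cong (λ z → does (a ∈? R) ∧ (does (b ∈? R) ∧ z)) (dec-false (g Finₚ.≟ (a ∙ (b ⁻¹))) (λ e → n (sym (trans (cong (_∙ b) e) (yx⁻¹∙x b a))))))
      (trans (cong (does (a ∈? R) ∧_) (Boolₚ.∧-zeroʳ (does (b ∈? R)))) (Boolₚ.∧-zeroʳ (does (a ∈? R)))))
    on : ∀ b → [ does ((g ∙ b) ∈? R) ∧ (does (b ∈? R) ∧ does (g Finₚ.≟ ((g ∙ b) ∙ (b ⁻¹)))) ] ≡ [ Rᵇ (g ∙ b) ] * [ Rᵇ b ]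
    on b = trans (cong [_] (cong₂ _∧_ (does-∈? (g ∙ b) R) (trans (cong₂ _∧_ (does-∈? b R) (dec-true (g Finₚ.≟ ((g ∙ b) ∙ (b ⁻¹))) (sym (yx∙x⁻¹ b g)))) (Boolₚ.∧-identityʳ (Rᵇ b))))) ([]-∧ (Rᵇ (g ∙ b)) (Rᵇ b))

  ρ-outside : ∀ {g} → Nᵇ g ≡ false → ρ g ≡ + 2
  ρ-outside {g} g∉N = trans (sym (+#reps g)) (cong +_ (outside g (λ i → true≢false ([]=⇒lookup i) g∉N)))

  ρ-inside : ∀ {g} → Nᵇ g ≡ true → g ≢ ε → ρ g ≡ 0ℤ
  ρ-inside {g} g∈N g≢ε = trans (sym (+#reps g)) (cong +_ (inside g (lookup⇒[]= g N g∈N) g≢ε))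

  ρ-ε : ρ ε ≡ + 2 * + p
  ρ-ε = trans (∑-cong E (λ w → trans (cong (λ z → [ Rᵇ z ] * [ Rᵇ w ]) (identityˡ w)) ([]-idem (Rᵇ w)))) (trans (∑-lookup R) (trans (cong +_ R-size) (ℤₚ.pos-* 2 p)))

  Y : Set
  Y = Sub P

  module SF = SubFinite F P

  _·_ : Y → Y → Y
  (x , a) · (y , b) = (x ∙ y) , ∙∈ P-sub a b

  e : Y
  e = ε , ε∈ P-sub

  inv : Y → Y
  inv (x , a) = (x ⁻¹) , ⁻¹∈ P-sub a

  -- Deciding `P x` recovers a usable proof from the irrelevant one.
  mem : (x : Y) → P (Sub.el x) ≡ true
  mem (x , a) = go (P x) refl a
    where
    go : ∀ b → P x ≡ b → .(b ≡ true) → P x ≡ true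
    go true e _ = e

  isAb : IsAbelianGroup _≡_ _·_ e inv
  isAb = record
    { isGroup = record
      { isMonoid = record
        { isSemigroup = record
          { isMagma = record { isEquivalence = isEquivalence ; ∙-cong = cong₂ _·_ }
          ; assoc = λ x y z → SF.el-injective (assoc (Sub.el x) (Sub.el y) (Sub.el z)) }
        ; identity = (λ x → SF.el-injective (identityˡ (Sub.el x))) , (λ x → SF.el-injective (identityʳ (Sub.el x))) }
      ; inverse = (λ x → SF.el-injective (inverseˡ (Sub.el x))) , (λ x → SF.el-injective (inverseʳ (Sub.el x)))
      ; ⁻¹-cong = cong inv }
    ; comm = λ x y → SF.el-injective (abelian (mem x) (mem y)) }

  σᵍ : Fin (2 ℕ.* p ℕ.* p) → Fin (2 ℕ.* p ℕ.* p)
  σᵍ x = (t ∙ x) ∙ t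

  σᵍ-P : ∀ {x} → P x ≡ true → P (σᵍ x) ≡ true
  σᵍ-P {x} px = trans (P-t (t ∙ x)) (cong not (trans (absorbʳ P-sub t px) (trans (cong P (sym (identityˡ t))) (trans (P-t ε) (cong not (ε∈ P-sub))))))

  σ : Y → Y
  σ (x , a) = σᵍ x , σᵍ-P a

  ttx : ∀ x → t ∙ (t ∙ x) ≡ x
  ttx x = trans (sym (assoc t t x)) (trans (cong (_∙ x) tt) (identityˡ x))

  xtt : ∀ x → (x ∙ t) ∙ t ≡ x
  xtt x = trans (assoc x t t) (trans (cong (x ∙_) tt) (identityʳ x))

  σ-· : ∀ x y → σ (x · y) ≡ σ x · σ y
  σ-· x y = SF.el-injective (sym (trans (assoc _ _ _) (trans (cong ((t ∙ Sub.el x) ∙_) (trans (cong (t ∙_) (assoc t (Sub.el y) t)) (ttx _))) (trans (sym (assoc _ _ _)) (cong (_∙ t) (assoc t (Sub.el x) (Sub.el y)))))))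

  σσ : ∀ x → σ (σ x) ≡ x
  σσ x = SF.el-injective (trans (cong (_∙ t) (trans (cong (t ∙_) (assoc t (Sub.el x) t)) (ttx _))) (xtt (Sub.el x)))

  module Y-sums = AbelianSum SF.finite isAb
  open Y-sums using (corr) renaming (Σ* to Σʸ)

  N′ A B : Y → Bool
  N′ x = Nᵇ (Sub.el x)
  A x = Rᵇ (Sub.el x)
  B x = Rᵇ (Sub.el x ∙ t)

  Σ-pair : ∀ (f : Fin (2 ℕ.* p ℕ.* p) → ℤ) → Σʸ (λ w → f (Sub.el w)) + Σʸ (λ w → f (Sub.el w ∙ t)) ≡ Σ* f
  Σ-pair f = trans (cong₂ _+_ (SF.∑-sub E f) (SF.∑-sub E (λ w → f (w ∙ t)))) (trans (sym (∑-⊕ E (λ w → [ P w ] * f w) (λ w → [ P w ] * f (w ∙ t))))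
    (trans (∑-cong E (λ w → sym (ℤₚ.*-distribˡ-+ [ P w ] (f w) (f (w ∙ t))))) (sym (Σ-split f))))

  size² : length (elems SF.finite) ≡ p ℕ.* p
  size² = ℤₚ.+-injective (begin
    + length (elems SF.finite)        ≡⟨ trans (sym (ℤₚ.*-identityʳ _)) (sym (∑-const (elems SF.finite) 1ℤ)) ⟩
    Σʸ (λ _ → 1ℤ)                     ≡⟨ SF.∑-sub E (λ _ → 1ℤ) ⟩
    Σ* (λ w → [ P w ] * 1ℤ)           ≡⟨ ∑-cong E (λ w → ℤₚ.*-identityʳ [ P w ]) ⟩
    card P                            ≡⟨ card-P ⟩
    + p * + p                         ≡⟨ ℤₚ.pos-* p p ⟨
    + (p ℕ.* p)                       ∎)
    where open ≡-Reasoning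

  ΣN′ : Σʸ (λ x → [ N′ x ]) ≡ + p
  ΣN′ = trans (SF.∑-sub E (λ x → [ Nᵇ x ])) (trans (∑-cong E (λ x → drop x (Nᵇ x) refl)) card-N)
    where
    drop : ∀ x b → Nᵇ x ≡ b → [ P x ] * [ b ] ≡ [ b ]
    drop x true  n = trans (ℤₚ.*-identityʳ [ P x ]) (cong [_] (N⊆P n))
    drop x false n = ℤₚ.*-zeroʳ [ P x ]

  open Setup SF.finite isAb p pr m p-odd size² N′ (ε∈ sN) (∙∈ sN) (⁻¹∈ sN) ΣN′ using (κ)

  -- As x(wt) = (xw)t, the two summands are the contributions of P and of Pt to ρ x.
  autocorr : ∀ x → corr ([_] ∘ A) ([_] ∘ A) x + corr ([_] ∘ B) ([_] ∘ B) x ≡ κ x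
  autocorr x = trans (cong (_+_ (corr ([_] ∘ A) ([_] ∘ A) x)) (∑-cong (elems SF.finite) (λ w → cong (λ z → [ Rᵇ z ] * [ B w ]) (assoc (Sub.el x) (Sub.el w) t))))
    (trans (Σ-pair (λ w → [ Rᵇ (Sub.el x ∙ w) ] * [ Rᵇ w ])) (go (x Y-sums.≟ e) (N′ x) refl))
    where
    lem₁ : ∀ q → + 2 * q ≡ (+ 2 * q * 1ℤ + + 2) - + 2 * 1ℤ
    lem₁ = solve-∀
    lem₂ : ∀ q → 0ℤ ≡ (+ 2 * q * 0ℤ + + 2) - + 2 * 1ℤ
    lem₂ = solve-∀
    lem₃ : ∀ q → + 2 ≡ (+ 2 * q * 0ℤ + + 2) - + 2 * 0ℤ
    lem₃ = solve-∀
    go : Dec (x ≡ e) → ∀ b → N′ x ≡ b → ρ (Sub.el x) ≡ κ x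
    go (yes refl) _ _ = trans ρ-ε (trans (lem₁ (+ p)) (cong₂ (λ d b → (+ 2 * + p * d + + 2) - + 2 * [ b ]) (sym (Y-sums.δ-refl e)) (sym (ε∈ sN))))
    go (no n) true  i = trans (ρ-inside i (λ eq → n (SF.el-injective eq))) (trans (lem₂ (+ p)) (cong₂ (λ d b → (+ 2 * + p * d + + 2) - + 2 * [ b ]) (sym (Y-sums.δ-≢ n)) (sym i)))
    go (no n) false i = trans (ρ-outside i) (trans (lem₃ (+ p)) (cong₂ (λ d b → (+ 2 * + p * d + + 2) - + 2 * [ b ]) (sym (Y-sums.δ-≢ n)) (sym i)))

  total : Σʸ ([_] ∘ A) + Σʸ ([_] ∘ B) ≡ + 2 * + p
  total = trans (Σ-pair (λ w → [ Rᵇ w ])) (trans (∑-lookup R) (trans (cong +_ R-size) (ℤₚ.pos-* 2 p)))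

  -- After substituting σw for w, the two summands are the contributions of P and of Pt to ρ at xt.
  -- This element lies outside P, hence outside N, so the count is 2.
  crosscorr : ∀ x → corr ([_] ∘ A) ([_] ∘ B ∘ σ) x + corr ([_] ∘ B) ([_] ∘ A ∘ σ) x ≡ + 2
  crosscorr x = begin
    corr ([_] ∘ A) ([_] ∘ B ∘ σ) x + corr ([_] ∘ B) ([_] ∘ A ∘ σ) x
      ≡⟨ cong₂ _+_ (reindex A B) (reindex B A) ⟩
    Σʸ (λ w → [ A (x · σ w) ] * [ B w ]) + Σʸ (λ w → [ B (x · σ w) ] * [ A w ])
      ≡⟨ ℤₚ.+-comm (Σʸ (λ w → [ A (x · σ w) ] * [ B w ])) _ ⟩
    Σʸ (λ w → [ B (x · σ w) ] * [ A w ]) + Σʸ (λ w → [ A (x · σ w) ] * [ B w ])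
      ≡⟨ cong₂ _+_ (∑-cong E′ (λ w → cong (λ z → [ Rᵇ z ] * [ A w ]) (trans (trans (assoc xᵍ _ t) (cong (xᵍ ∙_) (xtt _))) (sym (assoc xᵍ t (Sub.el w))))))
                   (∑-cong E′ (λ w → cong (λ z → [ Rᵇ z ] * [ B w ]) (trans (cong (xᵍ ∙_) (assoc t (Sub.el w) t)) (sym (assoc xᵍ t _))))) ⟩
    Σʸ (λ w → [ Rᵇ ((xᵍ ∙ t) ∙ Sub.el w) ] * [ Rᵇ (Sub.el w) ]) + Σʸ (λ w → [ Rᵇ ((xᵍ ∙ t) ∙ (Sub.el w ∙ t)) ] * [ Rᵇ (Sub.el w ∙ t) ])
      ≡⟨ Σ-pair (λ w → [ Rᵇ ((xᵍ ∙ t) ∙ w) ] * [ Rᵇ w ]) ⟩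
    ρ (xᵍ ∙ t)
      ≡⟨ ρ-outside (¬true⇒false (λ i → true≢false (N⊆P i) (trans (P-t xᵍ) (cong not (mem x))))) ⟩
    + 2 ∎
    where
    open ≡-Reasoning
    E′ = elems SF.finite
    xᵍ = Sub.el x
    reindex : ∀ (C D : Y → Bool) → corr ([_] ∘ C) ([_] ∘ D ∘ σ) x ≡ Σʸ (λ w → [ C (x · σ w) ] * [ D w ])
    reindex C D = trans (sym (∑-reindex SF.finite σ σ σσ σσ (λ w → [ C (x · w) ] * [ D (σ w) ])))
      (∑-cong E′ (λ w → cong (λ z → [ C (x · σ w) ] * [ D z ]) (σσ w)))

  impossible : ⊥
  impossible = abelian-contradiction SF.finite isAb p pr m p-odd size² N′ (ε∈ sN) (∙∈ sN) (⁻¹∈ sN) ΣN′ σ σ-· σσ A B autocorr total crosscorr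

odd-prime : ∀ {p} → Prime p → ¬ (p ≡ 2) → ∃ λ m → p ≡ 1 ℕ.+ 2 ℕ.* m
odd-prime {p} pr p≢2 = p ℕ/./ 2 , go (p ℕ/.% 2) (ℕ/.m%n<n p 2) (ℕ/.m≡m%n+[m/n]*n p 2)
  where
  go : ∀ r → r ℕ.< 2 → p ≡ r ℕ.+ (p ℕ/./ 2) ℕ.* 2 → p ≡ 1 ℕ.+ 2 ℕ.* (p ℕ/./ 2)
  go zero _ e = [ (λ ()) , (λ e′ → contradiction (sym e′) p≢2) ]′ (prime⇒irreducible pr (ℕ∣.divides (p ℕ/./ 2) e))
  go (suc zero) _ e = trans e (cong suc (ℕₚ.*-comm (p ℕ/./ 2) 2))
  go (suc (suc r)) (s≤s (s≤s ())) e

theorem3p2 : (p : ℕ) → Prime p → ¬ (p ≡ 2) →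
    (G : FinGroup (2 ℕ.* p ℕ.* p)) → ¬ ContainsRDS G (2 ℕ.* p) p (2 ℕ.* p) 2
theorem3p2 p pr p≢2 G R = FromRDS.impossible p pr (proj₁ (odd-prime pr p≢2)) (proj₂ (odd-prime pr p≢2)) G R
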